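{- Let $r\ge1$, $N=2r+2$, and let $\lambda=(\lambda_1\ge\dots\ge\lambda_N\ge0)$ be a partition with at most $N$ parts. Then $$s_\lambda(1,-1,z_1,z_1^{ -1},\dots,z_r,z_r^{ -1})=0\quad\text{(identically in } z_1,\dots,z_r)$$ if and only if at least one of the following holds: (a) the numbers $\beta_j=\lambda_j+N-j$ ($1\le j\le N$) are all even or all odd; (b) $\lambda$ is self-complementary of odd width: there is an odd integer $w$ such that $\lambda_i+\lambda_{N+1-i}=w$ for every $1\le i\le N$.
   Context: $s_\lambda$ is the Schur polynomial in $N$ variables and $z_1,\dots,z_r$ are independent indeterminates. -}

module Defs where

open import Algebra.Bundles.Raw using (RawRing)
open import Data.Bool.Base using (if_then_else_)
open import Data.Fin.Base as Fin using (Fin; toℕ; opposite)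
import Data.Fin.Properties as Fin
open import Data.Integer.Base as ℤ using (ℤ; 0ℤ; 1ℤ; -1ℤ)
import Data.Integer.Properties as ℤ
open import Data.List.Base as List
  using (List; []; _∷_; _++_; allFin; cartesianProductWith; filter; foldr)
open import Data.Nat.Base as ℕ using (ℕ; zero; suc; _≥_)
import Data.Nat.Properties as ℕ
open import Data.Product.Base using (_×_; _,_)
open import Data.Vec.Base as Vec using (Vec; []; _∷_; lookup)
import Data.Vec.Properties as Vec
open import Data.Vec.Relation.Unary.All using (All; []; _∷_)
open import Data.Vec.Relation.Unary.All.Properties using (lookup⁺)
open import Data.Vec.Relation.Unary.Linked using (Linked)
open import Level using (0ℓ)
open import Relation.Binary.PropositionalEquality using (_≡_)
open import Relation.Nullary.Decidable using (Dec; does; _×-dec_; _→-dec_)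

-- Trailing zero parts are allowed: these are the partitions with at most
-- m parts.
IsPartition : ∀ {m} → Vec ℕ m → Set
IsPartition = Linked _≥_

-- Fillings of the Young diagram with row lengths `shape` by letters in Fin n.
Filling : (n : ℕ) {m : ℕ} → Vec ℕ m → Set
Filling n shape = All (Vec (Fin n)) shape

entry : ∀ {n m} {shape : Vec ℕ m} → Filling n shape →
        (i : Fin m) → Fin (lookup shape i) → Fin n
entry T i c = lookup (lookup⁺ T i) c

RowsWeaklyIncrease : ∀ {n m} {shape : Vec ℕ m} → Filling n shape → Set
RowsWeaklyIncrease T =
  ∀ i c d → c Fin.≤ d → entry T i c Fin.≤ entry T i d

-- The cells c of row i and d of row j lie in the same column exactly when
-- toℕ c ≡ toℕ d; their types differ because the rows may differ in length.
ColumnsStrictlyIncrease : ∀ {n m} {shape : Vec ℕ m} → Filling n shape → Set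
ColumnsStrictlyIncrease T =
  ∀ i j c d → i Fin.< j → toℕ c ≡ toℕ d → entry T i c Fin.< entry T j d

Semistandard : ∀ {n m} {shape : Vec ℕ m} → Filling n shape → Set
Semistandard T = RowsWeaklyIncrease T × ColumnsStrictlyIncrease T

semistandard? : ∀ {n m} {shape : Vec ℕ m} (T : Filling n shape) →
                Dec (Semistandard T)
semistandard? T =
  (Fin.all? λ i → Fin.all? λ c → Fin.all? λ d →
     (c Fin.≤? d) →-dec (entry T i c Fin.≤? entry T i d))
  ×-dec
  (Fin.all? λ i → Fin.all? λ j → Fin.all? λ c → Fin.all? λ d →
     (i Fin.<? j) →-dec
     ((toℕ c ℕ.≟ toℕ d) →-dec (entry T i c Fin.<? entry T j d)))

words : (n k : ℕ) → List (Vec (Fin n) k)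
words n zero    = [] ∷ []
words n (suc k) = cartesianProductWith _∷_ (allFin n) (words n k)

fillings : (n : ℕ) {m : ℕ} (shape : Vec ℕ m) → List (Filling n shape)
fillings n []          = [] ∷ []
fillings n (k ∷ shape) =
  cartesianProductWith _∷_ (words n k) (fillings n shape)

tableaux : (n : ℕ) {m : ℕ} (shape : Vec ℕ m) → List (Filling n shape)
tableaux n shape = filter semistandard? (fillings n shape)

module _ {c ℓ} (R : RawRing c ℓ) where
  open RawRing R

  weight : ∀ {n m} {shape : Vec ℕ m} → Vec Carrier n → Filling n shape → Carrier
  weight x []      = 1#
  weight x (u ∷ T) =
    Vec.foldr′ (λ a p → lookup x a * p) 1# u * weight x T

  -- The value at x₁, …, xₙ of the Schur polynomial s_shape = Σ_T x^T in n
  -- variables, T running over the semistandard tableaux of that shape.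
  schur : ∀ {n m} → Vec ℕ m → Vec Carrier n → Carrier
  schur {n} shape x = foldr (λ T s → weight x T + s) 0# (tableaux n shape)

-- Elements of ℤ[z₁^±1, …, z_r^±1], as formal sums of terms a·z^e with
-- e ∈ ℤ^r. Terms may repeat or have coefficient 0, so
-- equality is equality of all coefficients.
Laurent : ℕ → Set
Laurent r = List (ℤ × Vec ℤ r)

coeff : ∀ {r} → Laurent r → Vec ℤ r → ℤ
coeff []            e = 0ℤ
coeff ((a , d) ∷ p) e =
  (if does (Vec.≡-dec ℤ._≟_ d e) then a else 0ℤ) ℤ.+ coeff p e

infix 4 _≈ᴸ_

_≈ᴸ_ : ∀ {r} → Laurent r → Laurent r → Set
p ≈ᴸ q = ∀ e → coeff p e ≡ coeff q e

0ᴸ : ∀ {r} → Laurent r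
0ᴸ = []

laurentRing : ℕ → RawRing 0ℓ 0ℓ
laurentRing r = record
  { Carrier = Laurent r
  ; _≈_     = _≈ᴸ_
  ; _+_     = _++_
  ; _*_     = cartesianProductWith
                λ (a , d) (b , e) → a ℤ.* b , Vec.zipWith ℤ._+_ d e
  ; -_      = List.map (λ (a , d) → ℤ.- a , d)
  ; 0#      = 0ᴸ
  ; 1#      = (1ℤ , Vec.replicate r 0ℤ) ∷ []
  }

z^ : ∀ {r} → ℤ → Fin r → Laurent r
z^ {r} k i = (1ℤ , Vec.replicate r 0ℤ Vec.[ i ]≔ k) ∷ []

point : (r : ℕ) → Vec (Laurent r) (2 ℕ.+ r ℕ.* 2)
point r = 1# ∷ - 1# ∷
          Vec.concat (Vec.tabulate λ i → z^ 1ℤ i ∷ z^ -1ℤ i ∷ [])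
  where open RawRing (laurentRing r)

-- β_j = λ_j + N - j. With indices starting at 0, N - j becomes N - 1 - j.
β : ∀ {N} → Vec ℕ N → Fin N → ℕ
β shape j = lookup shape j ℕ.+ toℕ (opposite j)

-- Let a be the alternant with exponents β at the point -1, 1, z₁^-1, z₁, …. Peeling
-- off the largest letter of a tableau and subtracting adjacent columns of an alternant
-- give the same branching rule, so a is the product of s_λ with the differences of the
-- coordinates; these are not zero divisors, hence s_λ vanishes if and only if a does.
-- Expanding a along the rows of z_r^-1 and z_r, the coefficient of z_r^k is a signed
-- sum over the pairs b, c of exponents with c - b = k of the alternants without b, c.
-- If (b , c) is the only pair with its difference, the alternant without b and c
-- vanishes too. Let a > b > … > y > z be the exponents. The pair (a , z) has a unique
-- difference; so has (a , y) or (b , z), unless a + z = b + y; and once all exponents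
-- but one or two outer ones are known to have the same parity, so has a further pair
-- among these four. By induction on the number of pairs, the exponents all have the
-- same parity or have constant even sums a + z = b + y = ⋯. Conversely, in the first
-- case the rows of 1 and -1 are proportional, and in the second the reflection b ↦ s - b
-- multiplies the alternant by (-1)^r by inverting the z_i, but by (-1)^(r+1) as a
-- permutation of the columns.
module Submission where

open import Defs

open import Algebra.Bundles using (CommutativeRing; RawRing)
open import Algebra.Structures using (IsCommutativeRing)
open import Data.Bool.Base using (Bool; true; false; T; _∧_; if_then_else_)
import Data.Bool.Properties as Bool
open import Data.Empty using (⊥-elim)
open import Data.Fin.Base as Fin using (Fin; toℕ; opposite; fromℕ; inject₁)
import Data.Fin.Properties as Fin
open import Data.Fin.Relation.Unary.Top using (view; ‵fromℕ; ‵inject₁)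
open import Data.Integer.Base as ℤ using (ℤ; 0ℤ; 1ℤ; -1ℤ; ∣_∣; +_)
open import Data.Integer.Divisibility using () renaming (_∣_ to _∣ℤ_)
import Data.Integer.Properties as ℤ
import Data.Integer.Solver as ℤ
open import Data.List.Base as List
  using (List; []; _∷_; _∷ʳ_; [_]; length; replicate; cartesianProductWith; filter;
         allFin; tabulate; reverse)
  renaming (_++_ to _++ₗ_)
open import Data.List.Membership.Propositional using (_∈_)
import Data.List.Membership.Propositional.Properties as List
import Data.List.Properties as List
open import Data.List.Relation.Binary.Permutation.Propositional as ↭ using (_↭_)
import Data.List.Relation.Binary.Permutation.Propositional.Properties as ↭
import Data.List.Relation.Binary.Permutation.Setoid.Properties as ↭ₛ
open import Data.List.Relation.Binary.Pointwise as PW using (Pointwise; []; _∷_)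
open import Data.List.Relation.Unary.All as All using (All; []; _∷_)
import Data.List.Relation.Unary.All.Properties as All
open import Data.List.Relation.Unary.AllPairs using (AllPairs; []; _∷_)
open import Data.List.Relation.Unary.Any using (here; there)
open import Data.List.Relation.Unary.Linked using ([]; [-]; _∷_) renaming (Linked to Linkedₗ)
open import Data.List.Relation.Unary.Unique.Propositional using (Unique)
open import Data.List.Relation.Unary.Unique.Propositional.Properties using (allFin⁺)
open import Data.Nat.Base as ℕ
  using (ℕ; zero; suc; _≤_; _≥_; _<_; _∸_; _≤ᵇ_; _<ᵇ_; z≤n; s≤s)
open import Data.Nat.Divisibility using (_∣_; divides-refl; ∣m∣n⇒∣m+n; ∣-refl)
import Data.Nat.Properties as ℕ
import Data.Nat.Solver as ℕ
open import Data.Product.Base using (_×_; _,_; proj₁; proj₂; ∃-syntax; swap)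
open import Data.Sum.Base using (_⊎_; inj₁; inj₂)
open import Data.Sum.Function.Propositional using (_⊎-⇔_)
open import Data.Unit.Base using (tt)
open import Data.Vec.Base as Vec using (Vec; lookup)
import Data.Vec.Properties as Vec
import Data.Vec.Relation.Unary.All as VecAll
open import Data.Vec.Relation.Unary.All.Properties using (lookup⁺)
import Data.Vec.Relation.Unary.Linked as VecLinked
import Data.Vec.Relation.Unary.Linked.Properties as VecLinked
open import Function.Base using (_∘_; const)
open import Function.Bundles using (_⇔_; mk⇔; Equivalence)
open import Function.Properties.Equivalence using () renaming (trans to ⇔-trans)
open import Level using (Level; 0ℓ; _⊔_)
open import Relation.Binary.Definitions using (tri<; tri≈; tri>)
open import Relation.Binary.PropositionalEquality as ≡ using (_≡_; _≢_)
open import Relation.Nullary.Decidable using (Dec; does; yes; no; does-⇔; T?)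
open import Relation.Nullary.Negation using (¬_)

-- The differences a - y and b - z agree exactly when a + z = b + y. This coincidence is all that
-- can block both (a , y) and (b , z), and it is the balance condition itself. When the two sums
-- differ, induction yields two good lists that share their inner pairs but have outer pairs with
-- different sums. If there is an inner pair, it admits only one sum, so one of the lists must be of
-- a single parity, and this parity spreads. Each removal uses up one variable and two exponents and
-- leaves one outer pair around the same inner ones. So the claim is made for arbitrary decreasing
-- exponents, with one more pair than variables; at the bottom the alternant of (a , z) is (-1)^a -
-- (-1)^z. The common sum is s = w + N - 1 with N - 1 = 2r + 1, so odd width means even s, and this
-- is what makes b ↦ s - b preserve (-1)^b.

-- Alternating sums: expansion of a determinant along a row

module Expansion {c ℓ} (R : CommutativeRing c ℓ) where
  open CommutativeRing R
  open import Algebra.Properties.Ring ring public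
  open import Algebra.Properties.CommutativeSemigroup +-commutativeSemigroup
    using (interchange)
  open import Relation.Binary.Reasoning.Setoid setoid

  -- The alternating sum over the choices of an entry, h receiving the chosen
  -- entry and the remaining ones: the expansion of a determinant along a row.
  ex : ∀ {a} {A : Set a} → (A → List A → Carrier) → List A → Carrier
  ex h []       = 0#
  ex h (x ∷ xs) = h x xs - ex (λ y ys → h y (x ∷ ys)) xs

  private variable
    a b : Level
    A B : Set a

  -‿cong₂ : ∀ {x y u v} → x ≈ y → u ≈ v → x - u ≈ y - v
  -‿cong₂ p q = +-cong p (-‿cong q)

  0-0≈0 : 0# - 0# ≈ 0#
  0-0≈0 = -‿inverseʳ 0#

  -‿interchange : ∀ x y u v → (x + y) - (u + v) ≈ (x - u) + (y - v)
  -‿interchange x y u v = begin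
    (x + y) - (u + v)      ≈⟨ +-congˡ (-‿+-comm u v) ⟨
    (x + y) + (- u - v)    ≈⟨ interchange x y (- u) (- v) ⟩
    (x - u) + (y - v)      ∎

  -- The permutation passed to the hypothesis lets a property of all entries of `xs` be used for the
  -- chosen entry and for the remaining ones.
  ex-cong : {h k : A → List A → Carrier} (xs : List A) →
            (∀ y ys → y ∷ ys ↭ xs → h y ys ≈ k y ys) → ex h xs ≈ ex k xs
  ex-cong []       eq = refl
  ex-cong (x ∷ xs) eq =
    -‿cong₂ (eq x xs ↭.refl)
      (ex-cong xs λ y ys p → eq y (x ∷ ys) (↭.trans (↭.swap y x ↭.refl) (↭.prep x p)))

  ex-cong′ : {h k : A → List A → Carrier} (xs : List A) →
             (∀ y ys → h y ys ≈ k y ys) → ex h xs ≈ ex k xs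
  ex-cong′ xs eq = ex-cong xs λ y ys _ → eq y ys

  ex-const0 : (xs : List A) → ex (λ _ _ → 0#) xs ≈ 0#
  ex-const0 []       = refl
  ex-const0 (x ∷ xs) = trans (+-congˡ (-‿cong (ex-const0 xs))) 0-0≈0

  ex-zero : {h : A → List A → Carrier} (xs : List A) →
            (∀ y ys → y ∷ ys ↭ xs → h y ys ≈ 0#) → ex h xs ≈ 0#
  ex-zero xs eq = trans (ex-cong xs eq) (ex-const0 xs)

  ex-map : (f : A → B) (h : B → List B → Carrier) (xs : List A) →
           ex h (List.map f xs) ≡ ex (λ y ys → h (f y) (List.map f ys)) xs
  ex-map f h []       = ≡.refl
  ex-map f h (x ∷ xs) =
    ≡.cong (λ s → h (f x) (List.map f xs) - s) (ex-map f (λ y ys → h y (f x ∷ ys)) xs)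

  ex-+ : (h k : A → List A → Carrier) (xs : List A) →
         ex (λ y ys → h y ys + k y ys) xs ≈ ex h xs + ex k xs
  ex-+ h k []       = sym (+-identityˡ 0#)
  ex-+ h k (x ∷ xs) =
    trans (-‿cong₂ refl (ex-+ (λ y ys → h y (x ∷ ys)) (λ y ys → k y (x ∷ ys)) xs))
          (-‿interchange _ _ _ _)

  ex-* : ∀ α (h : A → List A → Carrier) (xs : List A) →
         ex (λ y ys → α * h y ys) xs ≈ α * ex h xs
  ex-* α h []       = sym (zeroʳ α)
  ex-* α h (x ∷ xs) =
    trans (-‿cong₂ refl (ex-* α (λ y ys → h y (x ∷ ys)) xs))
          (sym (x[y-z]≈xy-xz α _ _))

  ex-neg : (h : A → List A → Carrier) (xs : List A) →
           ex (λ y ys → - h y ys) xs ≈ - ex h xs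
  ex-neg h []       = sym -0#≈0#
  ex-neg h (x ∷ xs) =
    trans (-‿cong₂ refl (ex-neg (λ y ys → h y (x ∷ ys)) xs)) (-‿+-comm _ _)

  ex-sub : (h k : A → List A → Carrier) (xs : List A) →
           ex (λ y ys → h y ys - k y ys) xs ≈ ex h xs - ex k xs
  ex-sub h k xs = trans (ex-+ h (λ y ys → - k y ys) xs) (+-congˡ (ex-neg k xs))

  -- This is the exchange of two rows: the same two entries are chosen in the opposite order, and
  -- the second choice skips one entry more or less.
  ex-transpose : (H : A → A → List A → Carrier) (xs : List A) →
    ex (λ y → ex (λ z zs → H y z zs)) xs ≈ - ex (λ y → ex (λ z zs → H z y zs)) xs
  ex-transpose H []       = sym -0#≈0#
  ex-transpose H (x ∷ xs) = begin
    p - ex (λ y ys → H y x ys - ex (λ z zs → H y z (x ∷ zs)) ys) xs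
      ≈⟨ +-congˡ (-‿cong (ex-sub _ _ xs)) ⟩
    p - (q - s)      ≈⟨ +-congˡ (⁻¹-anti-homo‿- q s) ⟩
    p + (s - q)      ≈⟨ +-congˡ (+-congʳ (ex-transpose _ xs)) ⟩
    p + (- s′ - q)   ≈⟨ +-congˡ (+-comm _ _) ⟩
    p + (- q - s′)   ≈⟨ +-assoc _ _ _ ⟨
    (p - q) - s′     ≈⟨ +-congʳ (⁻¹-anti-homo‿- q p) ⟨
    - (q - p) - s′   ≈⟨ -‿+-comm _ _ ⟩
    - ((q - p) + s′) ≈⟨ -‿cong (+-assoc _ _ _) ⟩
    - (q + (- p + s′)) ≈⟨ -‿cong (+-congˡ (+-congˡ (-‿involutive s′))) ⟨
    - (q + (- p - - s′)) ≈⟨ -‿cong (+-congˡ (-‿+-comm _ _)) ⟩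
    - (q - (p - s′)) ≈⟨ -‿cong (+-congˡ (-‿cong (ex-sub _ _ xs))) ⟨
    - (q - ex (λ y ys → H x y ys - ex (λ z zs → H z y (x ∷ zs)) ys) xs) ∎
    where
    p = ex (H x) xs
    q = ex (λ y ys → H y x ys) xs
    s = ex (λ y → ex (λ z zs → H y z (x ∷ zs))) xs
    s′ = ex (λ y → ex (λ z zs → H z y (x ∷ zs))) xs

  Alternating : (List A → Carrier) → Set _
  Alternating G = ∀ xs y z zs → G (xs ++ₗ y ∷ z ∷ zs) ≈ - G (xs ++ₗ z ∷ y ∷ zs)

  -- The terms choosing one of the two swapped entries change places with opposite signs; every
  -- other term keeps both entries and changes sign by the hypothesis.
  ex-alternating : {h : A → List A → Carrier} →
                   (∀ y → Alternating (h y)) → Alternating (ex h)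
  ex-alternating {h = h} alt [] y z zs = begin
    h y (z ∷ zs) - (h z (y ∷ zs) - ex (λ w ws → h w (y ∷ z ∷ ws)) zs)
      ≈⟨ +-congˡ (⁻¹-anti-homo‿- _ _) ⟩
    h y (z ∷ zs) + (ex (λ w ws → h w (y ∷ z ∷ ws)) zs - h z (y ∷ zs))
      ≈⟨ +-assoc _ _ _ ⟨
    (h y (z ∷ zs) + ex (λ w ws → h w (y ∷ z ∷ ws)) zs) - h z (y ∷ zs)
      ≈⟨ +-comm _ _ ⟩
    - h z (y ∷ zs) + (h y (z ∷ zs) + ex (λ w ws → h w (y ∷ z ∷ ws)) zs)
      ≈⟨ +-congˡ (+-congˡ (trans (ex-cong′ zs λ w ws → alt w [] y z ws) (ex-neg _ zs))) ⟩
    - h z (y ∷ zs) + (h y (z ∷ zs) - ex (λ w ws → h w (z ∷ y ∷ ws)) zs)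
      ≈⟨ +-congˡ (-‿involutive _) ⟨
    - h z (y ∷ zs) - - (h y (z ∷ zs) - ex (λ w ws → h w (z ∷ y ∷ ws)) zs)
      ≈⟨ -‿+-comm _ _ ⟩
    - (h z (y ∷ zs) - (h y (z ∷ zs) - ex (λ w ws → h w (z ∷ y ∷ ws)) zs)) ∎
  ex-alternating {h = h} alt (x ∷ xs) y z zs =
    trans (-‿cong₂ (alt x xs y z zs)
                   (ex-alternating (λ w ws → alt w (x ∷ ws)) xs y z zs))
          (-‿+-comm _ _)

  -- Only vanishing is transported, so the sign of the permutation is never computed. The prefix
  -- `ws` keeps track of the entries already passed.
  ↭-zero : (G : List A → Carrier) → Alternating G →
           ∀ ws {xs ys} → xs ↭ ys → G (ws ++ₗ xs) ≈ 0# → G (ws ++ₗ ys) ≈ 0#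
  ↭-zero G alt ws ↭.refl eq = eq
  ↭-zero G alt ws {x ∷ xs} {_ ∷ ys} (↭.prep x p) eq =
    ≡.subst (λ l → G l ≈ 0#) (List.++-assoc ws [ x ] ys)
      (↭-zero G alt (ws ∷ʳ x) p (≡.subst (λ l → G l ≈ 0#) (≡.sym (List.++-assoc ws [ x ] xs)) eq))
  ↭-zero G alt ws {x ∷ y ∷ xs} {_ ∷ _ ∷ ys} (↭.swap x y p) eq =
    ≡.subst (λ l → G l ≈ 0#) (List.++-assoc ws (y ∷ x ∷ []) ys)
      (↭-zero G alt (ws ++ₗ y ∷ x ∷ []) p
        (≡.subst (λ l → G l ≈ 0#) (≡.sym (List.++-assoc ws (y ∷ x ∷ []) xs))
          (trans (alt ws y x xs) (trans (-‿cong eq) -0#≈0#))))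
  ↭-zero G alt ws (↭.trans p q) eq = ↭-zero G alt ws q (↭-zero G alt ws p eq)

  signed : ℕ → Carrier → Carrier
  signed zero    x = x
  signed (suc n) x = - signed n x

  signed-cong : ∀ n {x y} → x ≈ y → signed n x ≈ signed n y
  signed-cong zero    eq = eq
  signed-cong (suc n) eq = -‿cong (signed-cong n eq)

  signed-* : ∀ n x y → signed n (x * y) ≈ signed n x * y
  signed-* zero    x y = refl
  signed-* (suc n) x y = trans (-‿cong (signed-* n x y)) (-‿distribˡ-* _ y)

  -- Only the choice of the last entry survives, and it is reached after one change of sign for each
  -- entry before it.
  ex-∷ʳ : {h : A → List A → Carrier} (xs : List A) (x : A) →
          All (λ y → ∀ ys → h y ys ≈ 0#) xs →
          ex h (xs ∷ʳ x) ≈ signed (List.length xs) (h x xs)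
  ex-∷ʳ {h = h} []       x [] = trans (+-congˡ -0#≈0#) (+-identityʳ _)
  ex-∷ʳ {h = h} (y ∷ ys) x (z ∷ zs) =
    trans (-‿cong₂ (z (ys ∷ʳ x)) (ex-∷ʳ ys x (All.map (λ w ws → w (y ∷ ws)) zs)))
          (+-identityˡ _)

  Linear : (List (Carrier → Carrier) → Carrier) → Set _
  Linear G = ∀ xs α y z zs →
    G (xs ++ₗ (λ t → α * y t + z t) ∷ zs) ≈ α * G (xs ++ₗ y ∷ zs) + G (xs ++ₗ z ∷ zs)

  ex-linear : {h : (Carrier → Carrier) → List (Carrier → Carrier) → Carrier} →
    (∀ y → Linear (h y)) →
    (∀ α y z zs → h (λ t → α * y t + z t) zs ≈ α * h y zs + h z zs) →
    Linear (ex h)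
  ex-linear {h} lin lin₁ [] α y z zs = begin
    h (λ t → α * y t + z t) zs - ex (λ w ws → h w ((λ t → α * y t + z t) ∷ ws)) zs
      ≈⟨ -‿cong₂ (lin₁ α y z zs)
           (trans (ex-cong′ zs λ w ws → lin w [] α y z ws)
             (trans (ex-+ _ _ zs) (+-congʳ (ex-* α _ zs)))) ⟩
    (α * h y zs + h z zs) - (α * ex (λ w ws → h w (y ∷ ws)) zs + ex (λ w ws → h w (z ∷ ws)) zs)
      ≈⟨ -‿interchange _ _ _ _ ⟩
    (α * h y zs - α * ex (λ w ws → h w (y ∷ ws)) zs) + (h z zs - ex (λ w ws → h w (z ∷ ws)) zs)
      ≈⟨ +-congʳ (x[y-z]≈xy-xz α _ _) ⟨
    α * (h y zs - ex (λ w ws → h w (y ∷ ws)) zs) + (h z zs - ex (λ w ws → h w (z ∷ ws)) zs) ∎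
  ex-linear {h} lin lin₁ (x ∷ xs) α y z zs = begin
    h x (xs ++ₗ (λ t → α * y t + z t) ∷ zs) - ex (λ w ws → h w (x ∷ ws)) (xs ++ₗ (λ t → α * y t + z t) ∷ zs)
      ≈⟨ -‿cong₂ (lin x xs α y z zs)
           (ex-linear (λ w ws → lin w (x ∷ ws)) (λ β u v ws → lin₁ β u v (x ∷ ws)) xs α y z zs) ⟩
    (α * h x (xs ++ₗ y ∷ zs) + h x (xs ++ₗ z ∷ zs)) - (α * ex (λ w ws → h w (x ∷ ws)) (xs ++ₗ y ∷ zs) + ex (λ w ws → h w (x ∷ ws)) (xs ++ₗ z ∷ zs))
      ≈⟨ -‿interchange _ _ _ _ ⟩
    _ ≈⟨ +-congʳ (x[y-z]≈xy-xz α _ _) ⟨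
    _ ∎

-- Interlacing partitions and the branching rule

betas : List ℕ → List ℕ
betas []       = []
betas (l ∷ ls) = (l ℕ.+ length ls) ∷ betas ls

-- μ ≺ λ when μ₁, …, μₙ₋₁ interlace λ₁, …, λₙ.
data _≺_ : List ℕ → List ℕ → Set where
  [] : ∀ {l} → [] ≺ (l ∷ [])
  step : ∀ {k l m ks ls} → m ≤ k → k ≤ l → ks ≺ (m ∷ ls) → (k ∷ ks) ≺ (l ∷ m ∷ ls)

≺-length : ∀ {ks l ls} → ks ≺ (l ∷ ls) → length ks ≡ length ls
≺-length []           = ≡.refl
≺-length (step _ _ p) = ≡.cong suc (≺-length p)

≺-sorted : ∀ {ks ls} → ks ≺ ls → Linkedₗ _≥_ ks
≺-sorted [] = []
≺-sorted (step _ _ []) = [-]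
≺-sorted (step m≤k _ (step p k′≤m q)) = ℕ.≤-trans k′≤m m≤k ∷ ≺-sorted (step p k′≤m q)

module Sums {c ℓ} (R : CommutativeRing c ℓ) where
  open CommutativeRing R
  open import Algebra.Properties.CommutativeSemigroup +-commutativeSemigroup
    using (interchange)
  open import Algebra.Properties.CommutativeSemigroup *-commutativeSemigroup
    using (x∙yz≈y∙xz)
  open import Algebra.Properties.Semiring.Exp semiring

  -- Σ_{i+j=n} f i j
  sum : ℕ → (ℕ → ℕ → Carrier) → Carrier
  sum zero    f = f 0 0
  sum (suc n) f = f 0 (suc n) + sum n (f ∘ suc)

  sum-cong : ∀ n {f g : ℕ → ℕ → Carrier} →
             (∀ i j → i ℕ.+ j ≡ n → f i j ≈ g i j) → sum n f ≈ sum n g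
  sum-cong zero    eq = eq 0 0 ≡.refl
  sum-cong (suc n) eq =
    +-cong (eq 0 (suc n) ≡.refl) (sum-cong n λ i j p → eq (suc i) j (≡.cong suc p))

  sum-* : ∀ n α (f : ℕ → ℕ → Carrier) → sum n (λ i j → α * f i j) ≈ α * sum n f
  sum-* zero    α f = refl
  sum-* (suc n) α f = trans (+-congˡ (sum-* n α (f ∘ suc))) (sym (distribˡ α _ _))

  sum-+ : ∀ n (f g : ℕ → ℕ → Carrier) → sum n (λ i j → f i j + g i j) ≈ sum n f + sum n g
  sum-+ zero    f g = refl
  sum-+ (suc n) f g = trans (+-congˡ (sum-+ n (f ∘ suc) (g ∘ suc))) (interchange _ _ _ _)

  sum-0 : ∀ n → sum n (λ _ _ → 0#) ≈ 0#
  sum-0 zero    = refl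
  sum-0 (suc n) = trans (+-congˡ (sum-0 n)) (+-identityˡ 0#)

  -- Σ_μ y^{|λ|-|μ|} g μ over the μ interlacing λ
  branch : Carrier → List ℕ → (List ℕ → Carrier) → Carrier
  branch y []           g = 0#
  branch y (l ∷ [])     g = y ^ l * g []
  branch y (l ∷ m ∷ ls) g =
    sum (l ∸ m) λ i j → y ^ j * branch y (m ∷ ls) λ ks → g ((m ℕ.+ i) ∷ ks)

  branch-cong : ∀ y {ls} {g h : List ℕ → Carrier} → Linkedₗ _≥_ ls →
                (∀ ks → ks ≺ ls → g ks ≈ h ks) → branch y ls g ≈ branch y ls h
  branch-cong y []  eq = refl
  branch-cong y [-] eq = *-congˡ (eq [] [])
  branch-cong y {l ∷ m ∷ ls} (l≥m ∷ p) eq =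
    sum-cong (l ∸ m) λ i j i+j → *-congˡ (branch-cong y p λ ks q →
      eq _ (step (ℕ.m≤m+n m i)
        (ℕ.≤-trans (ℕ.+-monoʳ-≤ m (ℕ.m+n≤o⇒m≤o i (ℕ.≤-reflexive i+j))) (ℕ.≤-reflexive (ℕ.m+[n∸m]≡n l≥m))) q))

  branch-* : ∀ y ls α (g : List ℕ → Carrier) →
             branch y ls (λ ks → α * g ks) ≈ α * branch y ls g
  branch-* y []           α g = sym (zeroʳ α)
  branch-* y (l ∷ [])     α g = x∙yz≈y∙xz _ _ _
  branch-* y (l ∷ m ∷ ls) α g =
    trans (sum-cong (l ∸ m) λ i j _ →
             trans (*-congˡ (branch-* y (m ∷ ls) α _)) (x∙yz≈y∙xz _ _ _))
          (sum-* (l ∸ m) α _)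

  -- The Schur polynomial in the variables xs, by its branching rule.
  schurᵇ : List Carrier → List ℕ → Carrier
  schurᵇ []       []       = 1#
  schurᵇ []       (_ ∷ _)  = 0#
  schurᵇ (x ∷ xs) ls       = branch x ls (schurᵇ xs)

-- Exchanging two equal columns only shows that a determinant is its own negative; this property
-- turns that into vanishing.
2-TorsionFree : ∀ {c ℓ} → CommutativeRing c ℓ → Set (c ⊔ ℓ)
2-TorsionFree R = ∀ x → x + x ≈ 0# → x ≈ 0#
  where open CommutativeRing R

-- The bialternant formula

module Bialternant {c ℓ} (R : CommutativeRing c ℓ) (torsionFree : 2-TorsionFree R) where
  open CommutativeRing R
  open Expansion R
  open Sums R
  open import Algebra.Properties.CommutativeSemigroup *-commutativeSemigroup
    using (x∙yz≈y∙xz; interchange)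
  open import Algebra.Properties.Semiring.Exp semiring
  open import Relation.Binary.Reasoning.Setoid setoid

  Fun : Set c
  Fun = Carrier → Carrier

  pow : ℕ → Fun
  pow n x = x ^ n

  -- The determinant of the matrix f_j(x_i), and 0 if it is not square. Columns are functions, so a
  -- column operation is made once for all rows.
  det : List Carrier → List Fun → Carrier
  det []       []      = 1#
  det []       (_ ∷ _) = 0#
  det (x ∷ xs) fs      = ex (λ f gs → f x * det xs gs) fs

  det-alternating : ∀ xs → Alternating (det xs)
  det-alternating []       []      f g hs = sym -0#≈0#
  det-alternating []       (_ ∷ _) f g hs = sym -0#≈0#
  det-alternating (x ∷ xs) =
    ex-alternating λ e fs f g hs →
      trans (*-congˡ (det-alternating xs fs f g hs)) (sym (-‿distribʳ-* _ _))

  det-linear : ∀ xs → Linear (det xs)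
  det-linear []       []      α f g hs = sym (trans (+-congʳ (zeroʳ α)) (+-identityˡ 0#))
  det-linear []       (_ ∷ _) α f g hs = sym (trans (+-congʳ (zeroʳ α)) (+-identityˡ 0#))
  det-linear (x ∷ xs) = ex-linear
    (λ e fs α f g hs → begin
      e x * det xs (fs ++ₗ (λ t → α * f t + g t) ∷ hs)
        ≈⟨ *-congˡ (det-linear xs fs α f g hs) ⟩
      e x * (α * det xs (fs ++ₗ f ∷ hs) + det xs (fs ++ₗ g ∷ hs))
        ≈⟨ distribˡ _ _ _ ⟩
      e x * (α * det xs (fs ++ₗ f ∷ hs)) + e x * det xs (fs ++ₗ g ∷ hs)
        ≈⟨ +-congʳ (x∙yz≈y∙xz _ _ _) ⟩
      α * (e x * det xs (fs ++ₗ f ∷ hs)) + e x * det xs (fs ++ₗ g ∷ hs) ∎)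
    (λ α f g hs → trans (distribʳ _ _ _) (+-congʳ (*-assoc _ _ _)))

  det-repeat : ∀ xs fs g hs → det xs (fs ++ₗ g ∷ g ∷ hs) ≈ 0#
  det-repeat xs fs g hs =
    torsionFree _ (trans (+-congˡ (det-alternating xs fs g g hs)) (-‿inverseʳ _))

  det-column : ∀ xs fs α g h hs →
    det xs (fs ++ₗ (λ t → α * h t + g t) ∷ h ∷ hs) ≈ det xs (fs ++ₗ g ∷ h ∷ hs)
  det-column xs fs α g h hs = begin
    _ ≈⟨ det-linear xs fs α h g (h ∷ hs) ⟩
    α * det xs (fs ++ₗ h ∷ h ∷ hs) + det xs (fs ++ₗ g ∷ h ∷ hs)
      ≈⟨ +-congʳ (trans (*-congˡ (det-repeat xs fs h hs)) (zeroʳ α)) ⟩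
    0# + det xs (fs ++ₗ g ∷ h ∷ hs) ≈⟨ +-identityˡ _ ⟩
    _ ∎

  ex-cong-pointwise : {h k : Fun → List Fun → Carrier} {fs gs : List Fun} →
    (∀ {f g fs gs} → (∀ x → f x ≈ g x) → Pointwise (λ f g → ∀ x → f x ≈ g x) fs gs →
     h f fs ≈ k g gs) →
    Pointwise (λ f g → ∀ x → f x ≈ g x) fs gs → ex h fs ≈ ex k gs
  ex-cong-pointwise eq []       = refl
  ex-cong-pointwise eq (p ∷ ps) =
    -‿cong₂ (eq p ps) (ex-cong-pointwise (λ q qs → eq q (p ∷ qs)) ps)

  det-cong : ∀ xs {fs gs} → Pointwise (λ f g → ∀ x → f x ≈ g x) fs gs → det xs fs ≈ det xs gs
  det-cong []       []      = refl
  det-cong []       (_ ∷ _) = refl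
  det-cong (x ∷ xs) ps      =
    ex-cong-pointwise (λ p qs → *-cong (p x) (det-cong xs qs)) ps

  prod : Fun → List Carrier → Carrier
  prod w = List.foldr (λ x p → w x * p) 1#

  det-scale : (w : Fun) → ∀ xs fs →
    det xs (List.map (λ f t → w t * f t) fs) ≈ prod w xs * det xs fs
  det-scale w []       []      = sym (*-identityˡ _)
  det-scale w []       (_ ∷ _) = sym (zeroʳ _)
  det-scale w (x ∷ xs) fs = begin
    ex (λ f gs → f x * det xs gs) (List.map (λ f t → w t * f t) fs)
      ≡⟨ ex-map _ _ fs ⟩
    ex (λ f gs → (w x * f x) * det xs (List.map (λ f t → w t * f t) gs)) fs
      ≈⟨ ex-cong′ fs (λ f gs → trans (*-congˡ (det-scale w xs gs)) (interchange _ _ _ _)) ⟩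
    ex (λ f gs → (w x * prod w xs) * (f x * det xs gs)) fs
      ≈⟨ ex-* _ _ fs ⟩
    (w x * prod w xs) * det (x ∷ xs) fs ∎

  module _ (y : Carrier) where

    last : ℕ → List ℕ → ℕ
    last l []       = l
    last l (m ∷ ls) = last m ls

    -- From each column its right neighbour is subtracted with the factor that makes the result
    -- vanish at `y`; the exponents of the two differ by `suc (l ∸ m)`. The last column has no
    -- neighbour and is left out here.
    reduced : ℕ → List ℕ → List Fun
    reduced l []       = []
    reduced l (m ∷ ls) =
      (λ t → - y ^ suc (l ∸ m) * pow (m ℕ.+ length ls) t + pow (l ℕ.+ suc (length ls)) t)
      ∷ reduced m ls

    -- The columns of `reduced` divided by `t - y`. The powers in the geometric sum are written with
    -- `m ℕ.+ i` because this will be a part of the interlacing partition, running from `m` to `l`.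
    quotients : ℕ → List ℕ → List Fun
    quotients l []       = []
    quotients l (m ∷ ls) =
      (λ t → sum (l ∸ m) λ i j → y ^ j * pow ((m ℕ.+ i) ℕ.+ length ls) t) ∷ quotients m ls

    length-reduced : ∀ l ls → length (reduced l ls) ≡ length ls
    length-reduced l []       = ≡.refl
    length-reduced l (m ∷ ls) = ≡.cong suc (length-reduced m ls)

    det-reduced : ∀ xs fs l ls →
      det xs (fs ++ₗ List.map pow (betas (l ∷ ls))) ≈
      det xs (fs ++ₗ reduced l ls ∷ʳ pow (last l ls))
    det-reduced xs fs l []       =
      reflexive (≡.cong (λ n → det xs (fs ++ₗ pow n ∷ [])) (ℕ.+-identityʳ l))
    det-reduced xs fs l (m ∷ ls) = begin
      _ ≈⟨ det-column xs fs (- y ^ suc (l ∸ m)) _ _ _ ⟨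
      det xs (fs ++ₗ f ∷ List.map pow (betas (m ∷ ls)))
        ≡⟨ ≡.cong (det xs) (List.++-assoc fs [ f ] _) ⟨
      det xs ((fs ∷ʳ f) ++ₗ List.map pow (betas (m ∷ ls)))
        ≈⟨ det-reduced xs (fs ∷ʳ f) m ls ⟩
      det xs ((fs ∷ʳ f) ++ₗ reduced m ls ∷ʳ pow (last m ls))
        ≡⟨ ≡.cong (det xs) (List.++-assoc fs [ f ] _) ⟩
      _ ∎
      where f = λ t → - y ^ suc (l ∸ m) * pow (m ℕ.+ length ls) t + pow (l ℕ.+ suc (length ls)) t

    difference-of-powers : ∀ t n →
      t ^ suc n - y ^ suc n ≈ (t - y) * sum n (λ i j → y ^ j * t ^ i)
    difference-of-powers t zero = begin
      t * 1# - y * 1#      ≈⟨ [y-z]x≈yx-zx 1# t y ⟨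
      (t - y) * 1#         ≈⟨ *-congˡ (*-identityˡ 1#) ⟨
      (t - y) * (1# * 1#)  ∎
    difference-of-powers t (suc n) = begin
      t * t ^ suc n - y * y ^ suc n
        ≈⟨ +-congʳ (trans (sym (+-identityʳ _)) (trans (+-congˡ (sym (-‿inverseˡ (t * y ^ suc n)))) (sym (+-assoc _ _ _)))) ⟩
      ((t * t ^ suc n - t * y ^ suc n) + t * y ^ suc n) - y * y ^ suc n
        ≈⟨ +-assoc _ _ _ ⟩
      (t * t ^ suc n - t * y ^ suc n) + (t * y ^ suc n - y * y ^ suc n)
        ≈⟨ +-cong (trans (sym (x[y-z]≈xy-xz t _ _)) (*-congˡ (difference-of-powers t n)))
                  (sym ([y-z]x≈yx-zx _ t y)) ⟩
      t * ((t - y) * sum n (λ i j → y ^ j * t ^ i)) + (t - y) * y ^ suc n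
        ≈⟨ +-comm _ _ ⟩
      (t - y) * y ^ suc n + t * ((t - y) * sum n (λ i j → y ^ j * t ^ i))
        ≈⟨ +-cong (*-congˡ (sym (*-identityʳ _)))
                  (trans (x∙yz≈y∙xz _ _ _) (*-congˡ (trans (sym (sum-* n t _)) (sum-cong n λ i j _ → x∙yz≈y∙xz _ _ _)))) ⟩
      (t - y) * (y ^ suc n * 1#) + (t - y) * sum n (λ i j → y ^ j * t ^ suc i)
        ≈⟨ distribˡ _ _ _ ⟨
      (t - y) * (y ^ suc n * 1# + sum n (λ i j → y ^ j * t ^ suc i)) ∎

    reduced≈quotient : ∀ {l m} n → l ≥ m → ∀ t →
      - y ^ suc (l ∸ m) * pow (m ℕ.+ n) t + pow (l ℕ.+ suc n) t ≈
      (t - y) * sum (l ∸ m) (λ i j → y ^ j * pow ((m ℕ.+ i) ℕ.+ n) t)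
    reduced≈quotient {l} {m} n l≥m t = begin
      - y ^ suc d * t ^ (m ℕ.+ n) + t ^ (l ℕ.+ suc n)
        ≈⟨ +-congˡ (trans (reflexive (≡.cong (t ^_) exponent)) (^-homo-* t (suc d) (m ℕ.+ n))) ⟩
      - y ^ suc d * t ^ (m ℕ.+ n) + t ^ suc d * t ^ (m ℕ.+ n)
        ≈⟨ distribʳ _ _ _ ⟨
      (- y ^ suc d + t ^ suc d) * t ^ (m ℕ.+ n)
        ≈⟨ *-congʳ (trans (+-comm _ _) (difference-of-powers t d)) ⟩
      ((t - y) * sum d (λ i j → y ^ j * t ^ i)) * t ^ (m ℕ.+ n)
        ≈⟨ *-assoc _ _ _ ⟩
      (t - y) * (sum d (λ i j → y ^ j * t ^ i) * t ^ (m ℕ.+ n))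
        ≈⟨ *-congˡ (trans (*-comm _ _) (sym (sum-* d _ _))) ⟩
      (t - y) * sum d (λ i j → t ^ (m ℕ.+ n) * (y ^ j * t ^ i))
        ≈⟨ *-congˡ (sum-cong d λ i j _ → trans (x∙yz≈y∙xz _ _ _) (*-congˡ
             (trans (sym (^-homo-* t (m ℕ.+ n) i)) (reflexive (≡.cong (t ^_) (exponent′ i)))))) ⟩
      _ ∎
      where
      d = l ∸ m
      open import Data.Nat.Solver
      open +-*-Solver
      exponent : l ℕ.+ suc n ≡ suc d ℕ.+ (m ℕ.+ n)
      exponent = ≡.trans (≡.cong (ℕ._+ suc n) (≡.sym (ℕ.m∸n+n≡m l≥m)))
        (solve 3 (λ d m n → d :+ m :+ (con 1 :+ n) := con 1 :+ d :+ (m :+ n)) ≡.refl d m n)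
      exponent′ : ∀ i → (m ℕ.+ n) ℕ.+ i ≡ (m ℕ.+ i) ℕ.+ n
      exponent′ i = solve 3 (λ m n i → m :+ n :+ i := m :+ i :+ n) ≡.refl m n i

    reduced≈quotients : ∀ l {ls} → Linkedₗ _≥_ (l ∷ ls) →
      Pointwise (λ f g → ∀ x → f x ≈ g x)
        (reduced l ls) (List.map (λ f t → (t - y) * f t) (quotients l ls))
    reduced≈quotients l [-]       = []
    reduced≈quotients l {m ∷ ls} (l≥m ∷ p) =
      reduced≈quotient (length ls) l≥m ∷ reduced≈quotients m p

    reduced-vanishes : ∀ l {ls} → Linkedₗ _≥_ (l ∷ ls) → All (λ f → f y ≈ 0#) (reduced l ls)
    reduced-vanishes l [-]       = []
    reduced-vanishes l {m ∷ ls} (l≥m ∷ p) =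
      trans (reduced≈quotient (length ls) l≥m y) (trans (*-congʳ (-‿inverseʳ y)) (zeroˡ _))
      ∷ reduced-vanishes m p

    det-sum : ∀ xs fs n (u : ℕ → ℕ → Carrier) (g : ℕ → ℕ → Fun) hs →
      det xs (fs ++ₗ (λ t → sum n λ i j → u i j * g i j t) ∷ hs) ≈
      sum n λ i j → u i j * det xs (fs ++ₗ g i j ∷ hs)
    det-sum xs fs zero    u g hs = begin
      det xs (fs ++ₗ (λ t → u 0 0 * g 0 0 t) ∷ hs)
        ≈⟨ det-cong xs (PW.++⁺ (PW.refl λ _ → refl) ((λ _ → sym (+-identityʳ _)) ∷ PW.refl λ _ → refl)) ⟩
      det xs (fs ++ₗ (λ t → u 0 0 * g 0 0 t + 0#) ∷ hs)
        ≈⟨ det-linear xs fs _ _ _ hs ⟩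
      u 0 0 * det xs (fs ++ₗ g 0 0 ∷ hs) + det xs (fs ++ₗ (λ _ → 0#) ∷ hs)
        ≈⟨ +-congˡ (det-zero xs fs hs) ⟩
      u 0 0 * det xs (fs ++ₗ g 0 0 ∷ hs) + 0# ≈⟨ +-identityʳ _ ⟩
      _ ∎
      where
      det-zero : ∀ xs fs hs → det xs (fs ++ₗ (λ _ → 0#) ∷ hs) ≈ 0#
      det-zero xs fs hs = +-identityʳ-unique _ _ (sym (begin
        det xs (fs ++ₗ (λ _ → 0#) ∷ hs)
          ≈⟨ det-cong xs (PW.++⁺ (PW.refl λ _ → refl) ((λ _ → sym (trans (+-congʳ (zeroʳ 1#)) (+-identityʳ _))) ∷ PW.refl λ _ → refl)) ⟩
        det xs (fs ++ₗ (λ _ → 1# * 0# + 0#) ∷ hs)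
          ≈⟨ det-linear xs fs 1# (λ _ → 0#) (λ _ → 0#) hs ⟩
        1# * det xs (fs ++ₗ (λ _ → 0#) ∷ hs) + det xs (fs ++ₗ (λ _ → 0#) ∷ hs)
          ≈⟨ +-congʳ (*-identityˡ _) ⟩
        _ ∎))
    det-sum xs fs (suc n) u g hs =
      trans (det-linear xs fs _ _ _ hs)
            (+-congˡ (det-sum xs fs n (u ∘ suc) (g ∘ suc) hs))

    -- By multilinearity, choosing one power in each column is choosing an interlacing partition.
    -- The factor in front is the contribution of the last part, which the smaller partition lacks.
    det-quotients : ∀ xs fs l {ls} → Linkedₗ _≥_ (l ∷ ls) →
      y ^ last l ls * det xs (fs ++ₗ quotients l ls) ≈
      branch y (l ∷ ls) (λ ks → det xs (fs ++ₗ List.map pow (betas ks)))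
    det-quotients xs fs l [-] = refl
    det-quotients xs fs l {m ∷ ls} (l≥m ∷ p) = begin
      z * det xs (fs ++ₗ (λ t → sum (l ∸ m) λ i j → y ^ j * h i t) ∷ quotients m ls)
        ≈⟨ *-congˡ (det-sum xs fs (l ∸ m) _ _ _) ⟩
      z * sum (l ∸ m) (λ i j → y ^ j * det xs (fs ++ₗ h i ∷ quotients m ls))
        ≈⟨ sum-* (l ∸ m) z _ ⟨
      sum (l ∸ m) (λ i j → z * (y ^ j * det xs (fs ++ₗ h i ∷ quotients m ls)))
        ≈⟨ sum-cong (l ∸ m) (λ i j _ → trans (x∙yz≈y∙xz _ _ _) (*-congˡ (rest i))) ⟩
      _ ∎
      where
      z = y ^ last m ls
      h : ℕ → Fun
      h i = pow ((m ℕ.+ i) ℕ.+ length ls)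
      rest : ∀ i → z * det xs (fs ++ₗ h i ∷ quotients m ls) ≈
             branch y (m ∷ ls) (λ ks → det xs (fs ++ₗ List.map pow (betas ((m ℕ.+ i) ∷ ks))))
      rest i = begin
        z * det xs (fs ++ₗ h i ∷ quotients m ls)
          ≡⟨ ≡.cong (λ e → z * det xs e) (List.++-assoc fs [ h i ] _) ⟨
        z * det xs ((fs ∷ʳ h i) ++ₗ quotients m ls)
          ≈⟨ det-quotients xs (fs ∷ʳ h i) m p ⟩
        branch y (m ∷ ls) (λ ks → det xs ((fs ∷ʳ h i) ++ₗ List.map pow (betas ks)))
          ≈⟨ branch-cong y p (λ ks q → reflexive (≡.cong (det xs)
               (≡.trans (List.++-assoc fs [ h i ] _)
                 (≡.cong (λ n → fs ++ₗ pow ((m ℕ.+ i) ℕ.+ n) ∷ List.map pow (betas ks)) (≡.sym (≺-length q)))))) ⟩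
        _ ∎

    -- After the column operations the row of `y` is zero except in the last column. Expanding along
    -- it leaves columns divisible by `t - y`, and these factors are collected row by row.
    det-branch : ∀ xs l {ls} → Linkedₗ _≥_ (l ∷ ls) →
      det (y ∷ xs) (List.map pow (betas (l ∷ ls))) ≈
      signed (length ls) (prod (_- y) xs *
        branch y (l ∷ ls) (λ ks → det xs (List.map pow (betas ks))))
    det-branch xs l {ls} p = begin
      det (y ∷ xs) (List.map pow (betas (l ∷ ls)))
        ≈⟨ det-reduced (y ∷ xs) [] l ls ⟩
      ex (λ f gs → f y * det xs gs) (reduced l ls ∷ʳ pow (last l ls))
        ≈⟨ ex-∷ʳ (reduced l ls) _ (All.map (λ eq gs → trans (*-congʳ eq) (zeroˡ _)) (reduced-vanishes l p)) ⟩
      signed (length (reduced l ls)) (y ^ last l ls * det xs (reduced l ls))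
        ≡⟨ ≡.cong (λ n → signed n (y ^ last l ls * det xs (reduced l ls))) (length-reduced l ls) ⟩
      signed (length ls) (y ^ last l ls * det xs (reduced l ls))
        ≈⟨ signed-cong (length ls) (begin
             y ^ last l ls * det xs (reduced l ls)
               ≈⟨ *-congˡ (trans (det-cong xs (reduced≈quotients l p)) (det-scale (_- y) xs _)) ⟩
             y ^ last l ls * (prod (_- y) xs * det xs (quotients l ls))
               ≈⟨ x∙yz≈y∙xz _ _ _ ⟩
             prod (_- y) xs * (y ^ last l ls * det xs (quotients l ls))
               ≈⟨ *-congˡ (det-quotients xs [] l p) ⟩
             _ ∎) ⟩
      _ ∎

  -- The sign turns every factor `y - x` into `x - y`, so this is the product of x_i - x_j over i <
  -- j.
  vandermonde : List Carrier → Carrier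
  vandermonde []       = 1#
  vandermonde (x ∷ xs) = signed (length xs) (prod (_- x) xs) * vandermonde xs

  -- Both sides branch in the same way; the smaller product of differences does not depend on the
  -- interlacing partition, so it leaves the sum.
  bialternant : ∀ xs {ls} → length ls ≡ length xs → Linkedₗ _≥_ ls →
    det xs (List.map pow (betas ls)) ≈ vandermonde xs * schurᵇ xs ls
  bialternant []       {[]}     eq p = sym (*-identityˡ 1#)
  bialternant (x ∷ xs) {l ∷ ls} eq p = begin
    _ ≈⟨ det-branch x xs l p ⟩
    signed (length ls) (prod (_- x) xs * branch x (l ∷ ls) (λ ks → det xs (List.map pow (betas ks))))
      ≈⟨ signed-cong (length ls) (*-congˡ (trans (branch-cong x p λ ks q →
           bialternant xs (≡.trans (≺-length q) (ℕ.suc-injective eq)) (≺-sorted q)) (branch-* x (l ∷ ls) _ _))) ⟩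
    signed (length ls) (prod (_- x) xs * (vandermonde xs * branch x (l ∷ ls) (schurᵇ xs)))
      ≈⟨ signed-* (length ls) _ _ ⟩
    signed (length ls) (prod (_- x) xs) * (vandermonde xs * branch x (l ∷ ls) (schurᵇ xs))
      ≡⟨ ≡.cong (λ n → signed n (prod (_- x) xs) * (vandermonde xs * branch x (l ∷ ls) (schurᵇ xs))) (ℕ.suc-injective eq) ⟩
    signed (length xs) (prod (_- x) xs) * (vandermonde xs * branch x (l ∷ ls) (schurᵇ xs))
      ≈⟨ *-assoc _ _ _ ⟨
    _ ∎

-- Sums over tableaux and the removal of the largest letter

increasing : List ℕ → Bool
increasing []          = true
increasing (a ∷ [])    = true
increasing (a ∷ b ∷ v) = (a ≤ᵇ b) ∧ increasing (b ∷ v)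

-- An overhanging lower row is rejected; without this the relation would not be transitive through
-- short rows.
above : List ℕ → List ℕ → Bool
above u       []      = true
above []      (_ ∷ _) = false
above (a ∷ u) (b ∷ v) = (a <ᵇ b) ∧ above u v

≤ᵇ-true : ∀ {m n} → m ≤ n → (m ≤ᵇ n) ≡ true
≤ᵇ-true p = Equivalence.to Bool.T-≡ (ℕ.≤⇒≤ᵇ p)

≤ᵇ-false : ∀ {m n} → n < m → (m ≤ᵇ n) ≡ false
≤ᵇ-false {m} {n} p with m ≤ᵇ n in eq
... | false = ≡.refl
... | true  = ⊥-elim (ℕ.<⇒≱ p (ℕ.≤ᵇ⇒≤ m n (≡.subst T (≡.sym eq) _)))

-- The condition on a first row, which has nothing above it.
any : List ℕ → Bool
any _ = true

-- The form of every weakly increasing row in letters up to `n`: the smaller letters of `v`, then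
-- all copies of `n`.
pad : ℕ → ℕ → List ℕ → List ℕ
pad n u v = v ++ₗ replicate u n

increasing-replicate : ∀ n u → increasing (replicate u n) ≡ true
increasing-replicate n zero          = ≡.refl
increasing-replicate n (suc zero)    = ≡.refl
increasing-replicate n (suc (suc u)) =
  ≡.cong₂ _∧_ (≤ᵇ-true (ℕ.≤-refl {n})) (increasing-replicate n (suc u))

increasing-pad : ∀ {n v} u → All (_< n) v → increasing (pad n u v) ≡ increasing v
increasing-pad u       []           = increasing-replicate _ u
increasing-pad zero    (p ∷ [])     = ≡.refl
increasing-pad (suc u) (p ∷ [])     =
  ≡.cong₂ _∧_ (≤ᵇ-true (ℕ.<⇒≤ p)) (increasing-replicate _ (suc u))
increasing-pad {v = a ∷ b ∷ v} u (p ∷ q ∷ ps) =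
  ≡.cong ((a ≤ᵇ b) ∧_) (increasing-pad u (q ∷ ps))

increasing-∷ : ∀ a v → increasing v ≡ false → increasing (a ∷ v) ≡ false
increasing-∷ a (b ∷ v) eq = ≡.trans (≡.cong ((a ≤ᵇ b) ∧_) eq) (Bool.∧-zeroʳ _)

-- The next row must end below letters smaller than n.
above-pad : ∀ {n v w} u s → All (_< n) v → All (_< n) w →
            above (pad n u v) (pad n s w) ≡ (length w ℕ.+ s ≤ᵇ length v) ∧ above v w
above-pad u       zero    []       []       = ≡.refl
above-pad zero    (suc s) []       []       = ≡.refl
above-pad {n} (suc u) (suc s) []   []       =
  ≡.cong (_∧ above (replicate u n) (replicate s n)) (≤ᵇ-false (ℕ.n<1+n n))
above-pad {n} {v} {[]} u zero (p ∷ ps) []   = ≡.refl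
above-pad {n} {a ∷ v} {[]} u (suc s) (p ∷ ps) [] =
  ≡.trans (≡.cong₂ _∧_ (≤ᵇ-true p) (above-pad u s ps [])) (suc-lemma s)
  where
  suc-lemma : ∀ s → (s ≤ᵇ length v) ∧ true ≡ (s <ᵇ suc (length v)) ∧ true
  suc-lemma zero    = ≡.refl
  suc-lemma (suc s) = ≡.refl
above-pad zero    s [] (q ∷ qs) = ≡.refl
above-pad {n} {[]} {b ∷ w} (suc u) s [] (q ∷ qs) =
  ≡.cong (_∧ above (replicate u n) (pad n s w)) (≤ᵇ-false (ℕ.≤-trans q (ℕ.n≤1+n n)))
above-pad {v = a ∷ v} {b ∷ w} u s (p ∷ ps) (q ∷ qs) =
  ≡.trans (≡.cong ((a <ᵇ b) ∧_) (above-pad u s ps qs))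
  (≡.trans (Bool.∧-comm (a <ᵇ b) _) (≡.trans (Bool.∧-assoc (length w ℕ.+ s ≤ᵇ length v) _ _)
    (≡.cong₂ _∧_ (suc-lemma (length w ℕ.+ s)) (Bool.∧-comm (above v w) _))))
  where
  suc-lemma : ∀ k → (k ≤ᵇ length v) ≡ (k <ᵇ suc (length v))
  suc-lemma zero    = ≡.refl
  suc-lemma (suc k) = ≡.refl

module Tableaux {c ℓ} (R : CommutativeRing c ℓ) (X : ℕ → CommutativeRing.Carrier R) where
  open CommutativeRing R
  open Sums R
  open import Algebra.Properties.CommutativeSemigroup *-commutativeSemigroup
    using (x∙yz≈y∙xz; interchange)
  open import Algebra.Properties.Semiring.Exp semiring
  open import Relation.Binary.Reasoning.Setoid setoid

  ⟦_⟧ : Bool → Carrier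
  ⟦ b ⟧ = if b then 1# else 0#

  ⟦∧⟧ : ∀ a b → ⟦ a ∧ b ⟧ ≈ ⟦ a ⟧ * ⟦ b ⟧
  ⟦∧⟧ true  b = sym (*-identityˡ _)
  ⟦∧⟧ false b = sym (zeroˡ _)

  Σ< : ℕ → (ℕ → Carrier) → Carrier
  Σ< zero    f = 0#
  Σ< (suc n) f = Σ< n f + f n

  Σ<-cong : ∀ n {f g : ℕ → Carrier} → (∀ a → a < n → f a ≈ g a) → Σ< n f ≈ Σ< n g
  Σ<-cong zero    eq = refl
  Σ<-cong (suc n) eq = +-cong (Σ<-cong n λ a p → eq a (ℕ.m<n⇒m<1+n p)) (eq n (ℕ.n<1+n n))

  Σ<-zero : ∀ n {f : ℕ → Carrier} → (∀ a → a < n → f a ≈ 0#) → Σ< n f ≈ 0#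
  Σ<-zero zero    eq = refl
  Σ<-zero (suc n) eq =
    trans (+-cong (Σ<-zero n λ a p → eq a (ℕ.m<n⇒m<1+n p)) (eq n (ℕ.n<1+n n))) (+-identityˡ 0#)

  Σ<-* : ∀ n α (f : ℕ → Carrier) → Σ< n (λ a → α * f a) ≈ α * Σ< n f
  Σ<-* zero    α f = sym (zeroʳ α)
  Σ<-* (suc n) α f = trans (+-congʳ (Σ<-* n α f)) (sym (distribˡ α _ _))

  Σ<-sum : ∀ n m (f : ℕ → ℕ → ℕ → Carrier) →
           Σ< n (λ a → sum m (f a)) ≈ sum m (λ i j → Σ< n λ a → f a i j)
  Σ<-sum zero    m f = sym (sum-0 m)
  Σ<-sum (suc n) m f = trans (+-congʳ (Σ<-sum n m f)) (sym (sum-+ m _ _))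

  Σʷ : ℕ → ℕ → (List ℕ → Carrier) → Carrier
  Σʷ n zero    f = f []
  Σʷ n (suc k) f = Σ< n λ a → Σʷ n k λ v → f (a ∷ v)

  Σʷ-cong : ∀ n k {f g : List ℕ → Carrier} →
            (∀ v → All (_< n) v → length v ≡ k → f v ≈ g v) → Σʷ n k f ≈ Σʷ n k g
  Σʷ-cong n zero    eq = eq [] [] ≡.refl
  Σʷ-cong n (suc k) eq =
    Σ<-cong n λ a p → Σʷ-cong n k λ v q r → eq (a ∷ v) (p ∷ q) (≡.cong suc r)

  Σʷ-zero : ∀ n k {f : List ℕ → Carrier} → (∀ v → f v ≈ 0#) → Σʷ n k f ≈ 0#
  Σʷ-zero n zero    eq = eq []
  Σʷ-zero n (suc k) eq = Σ<-zero n λ a _ → Σʷ-zero n k λ v → eq (a ∷ v)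

  Σʷ-* : ∀ n k α (f : List ℕ → Carrier) → Σʷ n k (λ v → α * f v) ≈ α * Σʷ n k f
  Σʷ-* n zero    α f = refl
  Σʷ-* n (suc k) α f =
    trans (Σ<-cong n λ a _ → Σʷ-* n k α _) (Σ<-* n α _)

  Σʷ-sum : ∀ n k m (f : List ℕ → ℕ → ℕ → Carrier) →
           Σʷ n k (λ v → sum m (f v)) ≈ sum m (λ i j → Σʷ n k λ v → f v i j)
  Σʷ-sum n zero    m f = refl
  Σʷ-sum n (suc k) m f =
    trans (Σ<-cong n λ a _ → Σʷ-sum n k m _) (Σ<-sum n m _)

  -- After the largest letter, an increasing word can only repeat it.
  Σʷ-top : ∀ n k {f : List ℕ → Carrier} → (∀ v → increasing v ≡ false → f v ≈ 0#) →
           Σʷ (suc n) k (λ v → f (n ∷ v)) ≈ f (n ∷ replicate k n)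
  Σʷ-top n zero    van = refl
  Σʷ-top n (suc k) {f} van = trans
    (+-cong (Σ<-zero n λ a a<n → Σʷ-zero (suc n) k λ v → van _
                (≡.cong (_∧ increasing (a ∷ v)) (≤ᵇ-false a<n)))
            (Σʷ-top n k {λ v → f (n ∷ v)} λ v p → van (n ∷ v) (increasing-∷ n v p)))
    (+-identityˡ _)

  -- Only increasing words contribute, and in these all copies of the largest letter stand at the
  -- end: `t` counts the other letters and `u` the copies.
  Σʷ-peel : ∀ n k {f : List ℕ → Carrier} → (∀ v → increasing v ≡ false → f v ≈ 0#) →
            Σʷ (suc n) k f ≈ sum k (λ t u → Σʷ n t λ v → f (pad n u v))
  Σʷ-peel n zero    van = refl
  Σʷ-peel n (suc k) {f} van = begin
    Σ< n (λ a → Σʷ (suc n) k λ v → f (a ∷ v)) + Σʷ (suc n) k (λ v → f (n ∷ v))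
      ≈⟨ +-cong
           (trans (Σ<-cong n λ a _ → Σʷ-peel n k λ v p → van (a ∷ v) (increasing-∷ a v p))
                  (Σ<-sum n k _))
           (Σʷ-top n k van) ⟩
    sum k (λ t u → Σʷ n (suc t) λ v → f (pad n u v)) + f (n ∷ replicate k n)
      ≈⟨ +-comm _ _ ⟩
    _ ∎

  wordWeight : List ℕ → Carrier
  wordWeight = List.foldr (λ a p → X a * p) 1#

  wordWeight-pad : ∀ n u v → wordWeight (pad n u v) ≈ X n ^ u * wordWeight v
  wordWeight-pad n zero    []      = sym (*-identityˡ 1#)
  wordWeight-pad n (suc u) []      =
    trans (*-congˡ (wordWeight-pad n u [])) (sym (*-assoc _ _ _))
  wordWeight-pad n u       (a ∷ v) =
    trans (*-congˡ (wordWeight-pad n u v)) (x∙yz≈y∙xz _ _ _)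

  -- The generating function of tableaux, summed one row at a time. All that a row needs to know of
  -- the rows above is carried by the predicate `ok`.
  Σᵗ : ℕ → (List ℕ → Bool) → List ℕ → Carrier
  Σᵗ n ok []       = 1#
  Σᵗ n ok (l ∷ ls) =
    Σʷ n l λ v → ⟦ increasing v ⟧ * (⟦ ok v ⟧ * (wordWeight v * Σᵗ n (above v) ls))

  Σᵗ-guard : ∀ n b ok l ls →
    Σᵗ n (λ v → b ∧ ok v) (l ∷ ls) ≈ ⟦ b ⟧ * Σᵗ n ok (l ∷ ls)
  Σᵗ-guard n b ok l ls = trans
    (Σʷ-cong n l λ v _ _ → trans
      (*-congˡ (trans (*-congʳ (⟦∧⟧ b (ok v))) (*-assoc _ _ _))) (x∙yz≈y∙xz _ _ _))
    (Σʷ-* n l _ _)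

  -- The default 0 makes the lower bound on the last part vacuous.
  head₀ : List ℕ → ℕ
  head₀ []      = 0
  head₀ (l ∷ _) = l

  -- As branch, but the last part is kept and may take any value.
  branch₀ : Carrier → List ℕ → (List ℕ → Carrier) → Carrier
  branch₀ y []       g = g []
  branch₀ y (l ∷ ls) g =
    sum l λ t u → y ^ u * (⟦ head₀ ls ≤ᵇ t ⟧ * branch₀ y ls λ ks → g (t ∷ ks))

  branch₀-cong : ∀ y ls {g h : List ℕ → Carrier} →
    (∀ ks → length ks ≡ length ls → g ks ≈ h ks) → branch₀ y ls g ≈ branch₀ y ls h
  branch₀-cong y []       eq = eq [] ≡.refl
  branch₀-cong y (l ∷ ls) eq = sum-cong l λ t u _ →
    *-congˡ (*-congˡ (branch₀-cong y ls λ ks p → eq (t ∷ ks) (≡.cong suc p)))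

  branch₀-* : ∀ y ls α (g : List ℕ → Carrier) →
              branch₀ y ls (λ ks → α * g ks) ≈ α * branch₀ y ls g
  branch₀-* y []       α g = refl
  branch₀-* y (l ∷ ls) α g = trans
    (sum-cong l λ t u _ → trans
      (*-congˡ (trans (*-congˡ (branch₀-* y ls α _)) (x∙yz≈y∙xz _ _ _))) (x∙yz≈y∙xz _ _ _))
    (sum-* l α _)

  branch₀-Σʷ : ∀ y ls n k (f : List ℕ → List ℕ → Carrier) →
    Σʷ n k (λ v → branch₀ y ls (f v)) ≈ branch₀ y ls (λ ks → Σʷ n k λ v → f v ks)
  branch₀-Σʷ y []       n k f = refl
  branch₀-Σʷ y (l ∷ ls) n k f = trans (Σʷ-sum n k l _)
    (sum-cong l λ t u _ → trans (Σʷ-* n k _ _)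
      (*-congˡ (trans (Σʷ-* n k _ _) (*-congˡ (branch₀-Σʷ y ls n k _)))))

  -- The copies of the largest letter form a horizontal strip: every cell of the next row lies under
  -- a letter smaller than `n`, so that row is no longer than the `t` letters remaining here. `ok′`
  -- is what `ok` demands of a row once its padding is removed.
  Σᵗ-peel : ∀ n (ok ok′ : List ℕ → Bool) l ls →
    (∀ u v → All (_< n) v → length v ℕ.+ u ≡ l → ok (pad n u v) ≡ ok′ v) →
    Σᵗ (suc n) ok (l ∷ ls) ≈ branch₀ (X n) (l ∷ ls) (Σᵗ n ok′)
  Σᵗ-peel n ok ok′ l ls compat = begin
    Σᵗ (suc n) ok (l ∷ ls)
      ≈⟨ Σʷ-peel n l (λ v p → trans (*-congʳ (reflexive (≡.cong ⟦_⟧ p))) (zeroˡ _)) ⟩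
    sum l (λ t u → Σʷ n t λ v → ⟦ increasing (pad n u v) ⟧ * (⟦ ok (pad n u v) ⟧ *
      (wordWeight (pad n u v) * Σᵗ (suc n) (above (pad n u v)) ls)))
      ≈⟨ sum-cong l row ⟩
    _ ∎
    where
    y = X n

    rest : ∀ t u v → All (_< n) v → length v ≡ t → ∀ ls →
      Σᵗ (suc n) (above (pad n u v)) ls ≈
      ⟦ head₀ ls ≤ᵇ t ⟧ * branch₀ y ls (Σᵗ n (above v))
    rest t u v p q []       = sym (*-identityˡ 1#)
    -- By `above-pad` the condition on the next row splits into `m ≤ᵇ t`, which is the same for all
    -- its fillings and comes out as a factor, and a condition on its smaller letters.
    rest t u v p q (m ∷ ms) = begin
      Σᵗ (suc n) (above (pad n u v)) (m ∷ ms)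
        ≈⟨ Σᵗ-peel n _ (λ w → (m ≤ᵇ t) ∧ above v w) m ms (λ s w r e → ≡.trans
             (above-pad u s p r) (≡.cong₂ (λ a b → (a ≤ᵇ b) ∧ above v w) e q)) ⟩
      branch₀ y (m ∷ ms) (Σᵗ n (λ w → (m ≤ᵇ t) ∧ above v w))
        ≈⟨ branch₀-cong y (m ∷ ms) {Σᵗ n λ w → (m ≤ᵇ t) ∧ above v w} {λ ks → ⟦ m ≤ᵇ t ⟧ * Σᵗ n (above v) ks} (λ { (k ∷ ks) _ → Σᵗ-guard n (m ≤ᵇ t) (above v) k ks }) ⟩
      branch₀ y (m ∷ ms) (λ ks → ⟦ m ≤ᵇ t ⟧ * Σᵗ n (above v) ks)
        ≈⟨ branch₀-* y (m ∷ ms) _ (Σᵗ n (above v)) ⟩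
      _ ∎

    row : ∀ t u → t ℕ.+ u ≡ l →
      Σʷ n t (λ v → ⟦ increasing (pad n u v) ⟧ * (⟦ ok (pad n u v) ⟧ *
        (wordWeight (pad n u v) * Σᵗ (suc n) (above (pad n u v)) ls))) ≈
      y ^ u * (⟦ head₀ ls ≤ᵇ t ⟧ * branch₀ y ls (λ ks → Σᵗ n ok′ (t ∷ ks)))
    row t u t+u = begin
      _ ≈⟨ Σʷ-cong n t (λ v p q → begin
             ⟦ increasing (pad n u v) ⟧ * (⟦ ok (pad n u v) ⟧ *
               (wordWeight (pad n u v) * Σᵗ (suc n) (above (pad n u v)) ls))
               ≈⟨ *-cong (reflexive (≡.cong ⟦_⟧ (increasing-pad u p)))
                   (*-cong (reflexive (≡.cong ⟦_⟧ (compat u v p (≡.trans (≡.cong (ℕ._+ u) q) t+u))))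
                     (*-cong (wordWeight-pad n u v) (rest t u v p q ls))) ⟩
             ⟦ increasing v ⟧ * (⟦ ok′ v ⟧ * ((y ^ u * wordWeight v) * (α t * branch₀ y ls (Σᵗ n (above v)))))
               ≈⟨ *-congˡ (*-congˡ (trans (interchange _ _ _ _) (*-assoc _ _ _))) ⟩
             ⟦ increasing v ⟧ * (⟦ ok′ v ⟧ * (y ^ u * (α t * (wordWeight v * branch₀ y ls (Σᵗ n (above v))))))
               ≈⟨ *-congˡ (trans (x∙yz≈y∙xz _ _ _) (*-congˡ (x∙yz≈y∙xz _ _ _))) ⟩
             ⟦ increasing v ⟧ * (y ^ u * (α t * (⟦ ok′ v ⟧ * (wordWeight v * branch₀ y ls (Σᵗ n (above v))))))
               ≈⟨ trans (x∙yz≈y∙xz _ _ _) (*-congˡ (x∙yz≈y∙xz _ _ _)) ⟩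
             y ^ u * (α t * (⟦ increasing v ⟧ * (⟦ ok′ v ⟧ * (wordWeight v * branch₀ y ls (Σᵗ n (above v))))))
               ≈⟨ *-congˡ (*-congˡ (trans (*-congˡ (trans (*-congˡ (sym (branch₀-* y ls _ _))) (sym (branch₀-* y ls _ _)))) (sym (branch₀-* y ls _ _)))) ⟩
             y ^ u * (α t * branch₀ y ls (λ ks → ⟦ increasing v ⟧ * (⟦ ok′ v ⟧ * (wordWeight v * Σᵗ n (above v) ks)))) ∎) ⟩
      Σʷ n t (λ v → y ^ u * (α t * branch₀ y ls (λ ks → ⟦ increasing v ⟧ * (⟦ ok′ v ⟧ * (wordWeight v * Σᵗ n (above v) ks)))))
        ≈⟨ trans (Σʷ-* n t _ _) (*-congˡ (Σʷ-* n t _ _)) ⟩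
      y ^ u * (α t * Σʷ n t (λ v → branch₀ y ls (λ ks → ⟦ increasing v ⟧ * (⟦ ok′ v ⟧ * (wordWeight v * Σᵗ n (above v) ks)))))
        ≈⟨ *-congˡ (*-congˡ (branch₀-Σʷ y ls n t _)) ⟩
      _ ∎
      where
      α : ℕ → Carrier
      α t = ⟦ head₀ ls ≤ᵇ t ⟧

  Σᵗ-∷ʳ0 : ∀ n ok ls → ok [] ≡ true → Σᵗ n ok (ls ∷ʳ 0) ≈ Σᵗ n ok ls
  Σᵗ-∷ʳ0 n ok [] eq = begin
    1# * (⟦ ok [] ⟧ * (1# * 1#)) ≡⟨ ≡.cong (λ b → 1# * (⟦ b ⟧ * (1# * 1#))) eq ⟩
    1# * (1# * (1# * 1#))        ≈⟨ trans (*-identityˡ _) (trans (*-identityˡ _) (*-identityˡ 1#)) ⟩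
    1# ∎
  Σᵗ-∷ʳ0 n ok (l ∷ ls) eq =
    Σʷ-cong n l λ v _ _ → *-congˡ (*-congˡ (*-congˡ (Σᵗ-∷ʳ0 n (above v) ls ≡.refl)))

  -- The part just above `p` must keep at least `p` cells, so every surviving argument of `g` again
  -- has a positive part, one place higher than `p` was.
  branch₀-vanishes : ∀ y (g : List ℕ → Carrier) l ls p ps → 0 < p →
    (∀ ks k qs → length ks ≡ length ls → 0 < k → g (ks ++ₗ k ∷ qs) ≈ 0#) →
    branch₀ y (l ∷ ls ++ₗ p ∷ ps) g ≈ 0#
  branch₀-vanishes y g l [] p ps 0<p van = trans (sum-cong l λ t u _ → trans (*-congˡ (lemma t)) (zeroʳ _)) (sum-0 l)
    where
    lemma : ∀ t → ⟦ p ≤ᵇ t ⟧ * branch₀ y (p ∷ ps) (λ ks → g (t ∷ ks)) ≈ 0#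
    lemma zero    = trans (*-congʳ (reflexive (≡.cong ⟦_⟧ (≤ᵇ-false 0<p)))) (zeroˡ _)
    lemma (suc t) = trans (*-congˡ (trans
      (branch₀-cong y (p ∷ ps) {λ ks → g (suc t ∷ ks)} {λ _ → 0# * 0#} (λ ks _ → trans (van [] (suc t) ks ≡.refl (s≤s z≤n)) (sym (zeroˡ _))))
      (trans (branch₀-* y (p ∷ ps) 0# (λ _ → 0#)) (zeroˡ _)))) (zeroʳ _)
  branch₀-vanishes y g l (m ∷ ls) p ps 0<p van = trans
    (sum-cong l λ t u _ → trans (*-congˡ (trans
      (*-congˡ (branch₀-vanishes y (λ ks → g (t ∷ ks)) m ls p ps 0<p λ ks k qs e → van (t ∷ ks) k qs (≡.cong suc e)))
      (zeroʳ _))) (zeroʳ _))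
    (sum-0 l)

  Σᵗ-vanishes₀ : ∀ ok ls p ps → 0 < p → Σᵗ 0 ok (ls ++ₗ p ∷ ps) ≈ 0#
  Σᵗ-vanishes₀ ok []           (suc p) ps _   = refl
  Σᵗ-vanishes₀ ok (zero ∷ ls)  p       ps 0<p = trans (*-congˡ (trans
    (*-congˡ (trans (*-congˡ (Σᵗ-vanishes₀ _ ls p ps 0<p)) (zeroʳ _))) (zeroʳ _))) (zeroʳ _)
  Σᵗ-vanishes₀ ok (suc l ∷ ls) p       ps _   = refl

  Σᵗ-branch : ∀ n l ls → Σᵗ (suc n) any (l ∷ ls) ≈ branch₀ (X n) (l ∷ ls) (Σᵗ n any)
  Σᵗ-branch n l ls = Σᵗ-peel n any any l ls λ _ _ _ _ → ≡.refl

  -- A strictly increasing column in `n` letters has at most `n` cells. Removing a letter moves the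
  -- offending positive part up by one row.
  Σᵗ-vanishes : ∀ n ls p ps → n ≤ length ls → 0 < p → Σᵗ n any (ls ++ₗ p ∷ ps) ≈ 0#
  Σᵗ-vanishes zero    ls       p ps _        0<p = Σᵗ-vanishes₀ any ls p ps 0<p
  Σᵗ-vanishes (suc n) (l ∷ ls) p ps (s≤s n≤) 0<p = trans
    (Σᵗ-branch n l (ls ++ₗ p ∷ ps))
    (branch₀-vanishes (X n) (Σᵗ n any) l ls p ps 0<p λ ks k qs e 0<k →
      Σᵗ-vanishes n ks k qs (ℕ.≤-trans n≤ (ℕ.≤-reflexive (≡.sym e))) 0<k)

  sum-first : ∀ n {f : ℕ → ℕ → Carrier} → (∀ i j → 0 < i → f i j ≈ 0#) → sum n f ≈ f 0 n
  sum-first zero    van = refl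
  sum-first (suc n) van = trans
    (+-congˡ (trans (sum-cong n λ i j _ → van (suc i) j (s≤s z≤n)) (sum-0 n))) (+-identityʳ _)

  sum-guard : ∀ m d (f : ℕ → ℕ → Carrier) →
    sum (m ℕ.+ d) (λ i j → ⟦ m ≤ᵇ i ⟧ * f i j) ≈ sum d (λ i j → f (m ℕ.+ i) j)
  sum-guard zero    d f = sum-cong d λ i j _ → *-identityˡ _
  sum-guard (suc m) d f = trans
    (+-cong (zeroˡ _)
      (trans (sum-cong (m ℕ.+ d) λ i j _ → *-congʳ (reflexive (≡.cong ⟦_⟧ (<ᵇ-suc m i))))
             (sum-guard m d (λ i → f (suc i)))))
    (+-identityˡ _)
    where
    <ᵇ-suc : ∀ m i → (m <ᵇ suc i) ≡ (m ≤ᵇ i)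
    <ᵇ-suc zero    i = ≡.refl
    <ᵇ-suc (suc m) i = ≡.refl

  branch₀≈branch : ∀ y l ls {g : List ℕ → Carrier} → Linkedₗ _≥_ (l ∷ ls) →
    (∀ ks → length ks ≡ length ls → g (ks ∷ʳ 0) ≈ g ks) →
    (∀ ks k → length ks ≡ length ls → 0 < k → g (ks ∷ʳ k) ≈ 0#) →
    branch₀ y (l ∷ ls) g ≈ branch y (l ∷ ls) g
  branch₀≈branch y l [] {g} _ drop van = trans
    (sum-first l λ i j 0<i → trans (*-congˡ (trans (*-congˡ (van [] i ≡.refl 0<i)) (zeroʳ _))) (zeroʳ _))
    (*-congˡ (trans (*-identityˡ _) (drop [] ≡.refl)))
  branch₀≈branch y l (m ∷ ls) {g} (l≥m ∷ p) drop van = begin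
    sum l (λ t u → y ^ u * (⟦ m ≤ᵇ t ⟧ * branch₀ y (m ∷ ls) λ ks → g (t ∷ ks)))
      ≈⟨ sum-cong l (λ t u _ → trans (x∙yz≈y∙xz _ _ _) (*-congˡ (*-congˡ
           (branch₀≈branch y m ls p
             (λ ks e → drop (t ∷ ks) (≡.cong suc e))
             (λ ks k e → van (t ∷ ks) k (≡.cong suc e)))))) ⟩
    sum l (λ t u → ⟦ m ≤ᵇ t ⟧ * (y ^ u * branch y (m ∷ ls) λ ks → g (t ∷ ks)))
      ≡⟨ ≡.cong (λ n → sum n (λ t u → ⟦ m ≤ᵇ t ⟧ * (y ^ u * branch y (m ∷ ls) λ ks → g (t ∷ ks)))) (≡.sym (ℕ.m+[n∸m]≡n l≥m)) ⟩
    sum (m ℕ.+ (l ∸ m)) (λ t u → ⟦ m ≤ᵇ t ⟧ * (y ^ u * branch y (m ∷ ls) λ ks → g (t ∷ ks)))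
      ≈⟨ sum-guard m (l ∸ m) _ ⟩
    _ ∎

  -- The largest letter comes first, since `schurᵇ` peels from the front. Hence the coordinates of
  -- the point later appear in reverse.
  variables : ℕ → List Carrier
  variables zero    = []
  variables (suc n) = X n ∷ variables n

  Σᵗ≈schurᵇ : ∀ n ls → length ls ≡ n → Linkedₗ _≥_ ls → Σᵗ n any ls ≈ schurᵇ (variables n) ls
  Σᵗ≈schurᵇ zero    []       eq p = refl
  Σᵗ≈schurᵇ (suc n) (l ∷ ls) eq p = begin
    Σᵗ (suc n) any (l ∷ ls)              ≈⟨ Σᵗ-branch n l ls ⟩
    branch₀ (X n) (l ∷ ls) (Σᵗ n any)
      ≈⟨ branch₀≈branch (X n) l ls p
           (λ ks _ → Σᵗ-∷ʳ0 n any ks ≡.refl)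
           (λ ks k e → Σᵗ-vanishes n ks k [] (ℕ.≤-reflexive (≡.trans (≡.sym (ℕ.suc-injective eq)) (≡.sym e)))) ⟩
    branch (X n) (l ∷ ls) (Σᵗ n any)
      ≈⟨ branch-cong (X n) p (λ ks q → Σᵗ≈schurᵇ n ks (≡.trans (≺-length q) (ℕ.suc-injective eq)) (≺-sorted q)) ⟩
    _ ∎

-- The Boolean test against the definition of semistandard fillings

letters : ∀ {n k} → Vec (Fin n) k → List ℕ
letters v = Vec.toList (Vec.map toℕ v)

increasing⇔ : ∀ {n k} (v : Vec (Fin n) k) →
  T (increasing (letters v)) ⇔ (∀ c d → c Fin.≤ d → lookup v c Fin.≤ lookup v d)
increasing⇔ v = mk⇔ (to v) (from v)
  where
  to : ∀ {n k} (v : Vec (Fin n) k) → T (increasing (letters v)) →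
       ∀ c d → c Fin.≤ d → lookup v c Fin.≤ lookup v d
  to (a Vec.∷ v)           t Fin.zero    Fin.zero    _ = ℕ.≤-refl
  to (a Vec.∷ b Vec.∷ v) t Fin.zero    (Fin.suc d) _ =
    let a≤b , t′ = Equivalence.to Bool.T-∧ t in
    ℕ.≤-trans (ℕ.≤ᵇ⇒≤ (toℕ a) (toℕ b) a≤b) (to (b Vec.∷ v) t′ Fin.zero d z≤n)
  to (a Vec.∷ b Vec.∷ v) t (Fin.suc c) (Fin.suc d) (s≤s c≤d) =
    to (b Vec.∷ v) (proj₂ (Equivalence.to (Bool.T-∧ {toℕ a ≤ᵇ toℕ b}) t)) c d c≤d

  from : ∀ {n k} (v : Vec (Fin n) k) →
         (∀ c d → c Fin.≤ d → lookup v c Fin.≤ lookup v d) → T (increasing (letters v))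
  from Vec.[]              p = tt
  from (a Vec.∷ Vec.[])    p = tt
  from (a Vec.∷ b Vec.∷ v) p = Equivalence.from Bool.T-∧
    (ℕ.≤⇒≤ᵇ (p Fin.zero (Fin.suc Fin.zero) z≤n) ,
     from (b Vec.∷ v) λ c d c≤d → p (Fin.suc c) (Fin.suc d) (s≤s c≤d))

-- The bound `l ≤ k` serves the converse: `above` rejects overhanging cells, about which the right
-- side says nothing.
above⇔ : ∀ {n k l} (u : Vec (Fin n) k) (v : Vec (Fin n) l) → l ≤ k →
  T (above (letters u) (letters v)) ⇔ (∀ c d → toℕ c ≡ toℕ d → lookup u c Fin.< lookup v d)
above⇔ u v l≤k = mk⇔ (to u v) (from u v l≤k)
  where
  to : ∀ {n k l} (u : Vec (Fin n) k) (v : Vec (Fin n) l) →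
       T (above (letters u) (letters v)) → ∀ c d → toℕ c ≡ toℕ d → lookup u c Fin.< lookup v d
  to (a Vec.∷ u) (b Vec.∷ v) t Fin.zero    Fin.zero    eq =
    ℕ.<ᵇ⇒< (toℕ a) (toℕ b) (proj₁ (Equivalence.to Bool.T-∧ t))
  to (a Vec.∷ u) (b Vec.∷ v) t (Fin.suc c) (Fin.suc d) eq =
    to u v (proj₂ (Equivalence.to (Bool.T-∧ {toℕ a <ᵇ toℕ b}) t)) c d (ℕ.suc-injective eq)

  from : ∀ {n k l} (u : Vec (Fin n) k) (v : Vec (Fin n) l) → l ≤ k →
         (∀ c d → toℕ c ≡ toℕ d → lookup u c Fin.< lookup v d) → T (above (letters u) (letters v))
  from u           Vec.[]      _         p = tt
  from (a Vec.∷ u) (b Vec.∷ v) (s≤s l≤k) p = Equivalence.from Bool.T-∧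
    (ℕ.<⇒<ᵇ (p Fin.zero Fin.zero ≡.refl) ,
     from u v l≤k λ c d eq → p (Fin.suc c) (Fin.suc d) (≡.cong suc eq))

above-trans : ∀ u v w → T (above u v) → T (above v w) → T (above u w)
above-trans u       v       []      p q = tt
above-trans (a ∷ u) (b ∷ v) (c ∷ w) p q =
  let a<b , p′ = Equivalence.to (Bool.T-∧ {a <ᵇ b}) p
      b<c , q′ = Equivalence.to (Bool.T-∧ {b <ᵇ c}) q
  in Equivalence.from Bool.T-∧
    (ℕ.<⇒<ᵇ (ℕ.<-trans (ℕ.<ᵇ⇒< a b a<b) (ℕ.<ᵇ⇒< b c b<c)) , above-trans u v w p′ q′)

module _ {n : ℕ} where

  -- Only neighbouring rows are compared, which suits summation row by row; `above-trans` recovers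
  -- the comparison of all pairs of rows.
  tableau : (List ℕ → Bool) → ∀ {m} {shape : Vec ℕ m} → Filling n shape → Bool
  tableau ok VecAll.[]      = true
  tableau ok (v VecAll.∷ T) =
    increasing (letters v) ∧ (ok (letters v) ∧ tableau (above (letters v)) T)

  tableau-mono : ∀ {ok ok′ : List ℕ → Bool} → (∀ v → T (ok v) → T (ok′ v)) →
    ∀ {m} {shape : Vec ℕ m} (F : Filling n shape) → T (tableau ok F) → T (tableau ok′ F)
  tableau-mono imp VecAll.[]      t = tt
  tableau-mono imp (v VecAll.∷ F) t =
    let i , t′ = Equivalence.to (Bool.T-∧ {increasing (letters v)}) t
        o , t″ = Equivalence.to (Bool.T-∧ {_} {tableau (above (letters v)) F}) t′
    in Equivalence.from Bool.T-∧ (i , Equivalence.from Bool.T-∧ (imp _ o , t″))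

  -- For `ok = above u` the closure hypothesis is transitivity, which carries the condition down
  -- from the first row to all rows.
  tableau-rows : ∀ (ok : List ℕ → Bool) → (∀ u v → T (ok u) → T (above u v) → T (ok v)) →
    ∀ {m} {shape : Vec ℕ m} (F : Filling n shape) → T (tableau ok F) →
    ∀ i → T (ok (letters (lookup⁺ F i)))
  tableau-rows ok closed (v VecAll.∷ F) t i =
    let _ , t′ = Equivalence.to (Bool.T-∧ {increasing (letters v)}) t
        o , t″ = Equivalence.to (Bool.T-∧ {ok (letters v)} {tableau (above (letters v)) F}) t′
    in rows o t″ i
    where
    rows : T (ok (letters v)) → T (tableau (above (letters v)) F) →
           ∀ i → T (ok (letters (lookup⁺ (v VecAll.∷ F) i)))
    rows o t Fin.zero    = o
    rows o t (Fin.suc i) = tableau-rows ok closed F (tableau-mono (λ w → closed (letters v) w o) F t) i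

  partition-head : ∀ {m l} {shape : Vec ℕ m} → IsPartition (l Vec.∷ shape) → ∀ i → lookup shape i ≤ l
  partition-head p i = VecLinked.lookup⁺ (λ j≤i k≤j → ℕ.≤-trans k≤j j≤i) {i = Fin.zero} {j = Fin.suc i} p (s≤s z≤n)

  semistandard⇔ : ∀ {m} {shape : Vec ℕ m} → IsPartition shape → (F : Filling n shape) →
                  T (tableau any F) ⇔ Semistandard F
  semistandard⇔ p F = mk⇔ (λ t → rows p F t , columns p F t) (λ (r , c) → from p F r c)
    where
    rows : ∀ {m} {shape : Vec ℕ m} → IsPartition shape → (F : Filling n shape) →
           T (tableau any F) → RowsWeaklyIncrease F
    rows p (v VecAll.∷ F) t Fin.zero =
      Equivalence.to (increasing⇔ v) (proj₁ (Equivalence.to Bool.T-∧ t))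
    rows p (v VecAll.∷ F) t (Fin.suc i) = rows (VecLinked.tail p) F
      (tableau-mono (λ _ _ → tt) F (proj₂ (Equivalence.to (Bool.T-∧ {increasing (letters v)}) t))) i

    columns : ∀ {m} {shape : Vec ℕ m} → IsPartition shape → (F : Filling n shape) →
              T (tableau any F) → ColumnsStrictlyIncrease F
    columns p (v VecAll.∷ F) t Fin.zero (Fin.suc j) c d _ =
      Equivalence.to (above⇔ v (lookup⁺ F j) (partition-head p j))
        (tableau-rows (above (letters v)) (above-trans (letters v)) F
          (proj₂ (Equivalence.to (Bool.T-∧ {increasing (letters v)}) t)) j) c d
    columns p (v VecAll.∷ F) t (Fin.suc i) (Fin.suc j) c d (s≤s i<j) =
      columns (VecLinked.tail p) F
        (tableau-mono (λ _ _ → tt) F (proj₂ (Equivalence.to (Bool.T-∧ {increasing (letters v)}) t))) i j c d i<j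

    from : ∀ {m} {shape : Vec ℕ m} → IsPartition shape → (F : Filling n shape) →
           RowsWeaklyIncrease F → ColumnsStrictlyIncrease F → T (tableau any F)
    from p VecAll.[] r c = tt
    from p (v VecAll.∷ F) r c = Equivalence.from Bool.T-∧
      (Equivalence.from (increasing⇔ v) (r Fin.zero) ,
       restrict p F c (from (VecLinked.tail p) F (λ i → r (Fin.suc i))
         λ i j c′ d i<j → c (Fin.suc i) (Fin.suc j) c′ d (s≤s i<j)))
      where
      restrict : ∀ {m l} {shape : Vec ℕ m} {v : Vec (Fin n) l} → IsPartition (l Vec.∷ shape) →
                 (F : Filling n shape) → ColumnsStrictlyIncrease (v VecAll.∷ F) →
                 T (tableau any F) → T (tableau (above (letters v)) F)
      restrict p VecAll.[] c t = tt
      restrict {v = v} (l≥m VecLinked.∷ p) (w VecAll.∷ F) c t =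
        let i , t′ = Equivalence.to (Bool.T-∧ {increasing (letters w)}) t in
        Equivalence.from Bool.T-∧ (i , Equivalence.from Bool.T-∧
          (Equivalence.from (above⇔ v w l≥m) (λ c′ d → c Fin.zero (Fin.suc Fin.zero) c′ d (s≤s z≤n)) , t′))

toList-sorted : ∀ {m} {shape : Vec ℕ m} → IsPartition shape → Linkedₗ _≥_ (Vec.toList shape)
toList-sorted VecLinked.[]  = []
toList-sorted VecLinked.[-] = [-]
toList-sorted {shape = _ Vec.∷ _ Vec.∷ _} (q VecLinked.∷ p) = q ∷ toList-sorted p

-- The Schur polynomial as an iterated sum over rows

module SchurPolynomial {c ℓ} (R : CommutativeRing c ℓ) where
  open CommutativeRing R
  open Sums R
  open import Relation.Binary.Reasoning.Setoid setoid
  open import Algebra.Properties.CommutativeSemigroup *-commutativeSemigroup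
    using (x∙yz≈y∙xz)

  -- Total, with junk value 0# beyond the end.
  at : ∀ {n} → Vec Carrier n → ℕ → Carrier
  at Vec.[]      _       = 0#
  at (x Vec.∷ v) zero    = x
  at (x Vec.∷ v) (suc i) = at v i

  at-toℕ : ∀ {n} (v : Vec Carrier n) i → at v (toℕ i) ≡ lookup v i
  at-toℕ (x Vec.∷ v) Fin.zero    = ≡.refl
  at-toℕ (x Vec.∷ v) (Fin.suc i) = at-toℕ v i

  variables-∷ : ∀ X n → Tableaux.variables R X (suc n) ≡ Tableaux.variables R (X ∘ suc) n ∷ʳ X 0
  variables-∷ X zero    = ≡.refl
  variables-∷ X (suc n) = ≡.cong (X (suc n) ∷_) (variables-∷ X n)

  Σₗ : ∀ {a} {A : Set a} → List A → (A → Carrier) → Carrier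
  Σₗ xs f = List.foldr (λ x s → f x + s) 0# xs

  module _ {a} {A : Set a} where

    Σₗ-cong : ∀ (xs : List A) {f g : A → Carrier} → (∀ x → f x ≈ g x) → Σₗ xs f ≈ Σₗ xs g
    Σₗ-cong []       eq = refl
    Σₗ-cong (x ∷ xs) eq = +-cong (eq x) (Σₗ-cong xs eq)

    Σₗ-++ : ∀ (xs ys : List A) (f : A → Carrier) → Σₗ (xs ++ₗ ys) f ≈ Σₗ xs f + Σₗ ys f
    Σₗ-++ []       ys f = sym (+-identityˡ _)
    Σₗ-++ (x ∷ xs) ys f = trans (+-congˡ (Σₗ-++ xs ys f)) (sym (+-assoc _ _ _))

    Σₗ-* : ∀ (xs : List A) α (f : A → Carrier) → Σₗ xs (λ x → α * f x) ≈ α * Σₗ xs f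
    Σₗ-* []       α f = sym (zeroʳ α)
    Σₗ-* (x ∷ xs) α f = trans (+-congˡ (Σₗ-* xs α f)) (sym (distribˡ α _ _))

    Σₗ-map : ∀ {b} {B : Set b} (h : A → B) xs (f : B → Carrier) → Σₗ (List.map h xs) f ≡ Σₗ xs (f ∘ h)
    Σₗ-map h []       f = ≡.refl
    Σₗ-map h (x ∷ xs) f = ≡.cong (λ s → f (h x) + s) (Σₗ-map h xs f)

    Σₗ-filter : ∀ {p} {P : A → Set p} (P? : ∀ x → Dec (P x)) (b : A → Bool) →
      (∀ x → does (P? x) ≡ b x) → ∀ xs (f : A → Carrier) →
      Σₗ (filter P? xs) f ≈ Σₗ xs (λ x → (if b x then 1# else 0#) * f x)
    Σₗ-filter P? b eq []       f = refl
    Σₗ-filter P? b eq (x ∷ xs) f with does (P? x) | eq x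
    ... | true  | e = +-cong (trans (sym (*-identityˡ _)) (*-congʳ (reflexive (≡.cong (if_then 1# else 0#) e))))
                             (Σₗ-filter P? b eq xs f)
    ... | false | e = trans (Σₗ-filter P? b eq xs f) (trans (sym (+-identityˡ _))
                        (+-congʳ (trans (sym (zeroˡ _)) (*-congʳ (reflexive (≡.cong (if_then 1# else 0#) e))))))

  Σₗ-product : ∀ {a b d} {A : Set a} {B : Set b} {D : Set d} (h : A → B → D) xs ys (f : D → Carrier) →
    Σₗ (cartesianProductWith h xs ys) f ≈ Σₗ xs (λ x → Σₗ ys (λ y → f (h x y)))
  Σₗ-product h []       ys f = refl
  Σₗ-product h (x ∷ xs) ys f = trans (Σₗ-++ (List.map (h x) ys) _ f)
    (+-cong (reflexive (Σₗ-map (h x) ys f)) (Σₗ-product h xs ys f))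

  module _ {n} (x : Vec Carrier n) where
    open Tableaux R (at x)

    Σ<-suc : ∀ n (f : ℕ → Carrier) → Σ< (suc n) f ≈ f 0 + Σ< n (f ∘ suc)
    Σ<-suc zero    f = +-comm _ _
    Σ<-suc (suc n) f = trans (+-congʳ (Σ<-suc n f)) (+-assoc _ _ _)

    Σₗ-allFin : ∀ n (f : ℕ → Carrier) → Σₗ (allFin n) (f ∘ toℕ) ≈ Σ< n f
    Σₗ-allFin n f = go n (λ i → i) f (λ _ → ≡.refl)
      where
      go : ∀ m {n} (h : Fin m → Fin n) (g : ℕ → Carrier) → (∀ i → f (toℕ (h i)) ≡ g (toℕ i)) →
           Σₗ (tabulate h) (f ∘ toℕ) ≈ Σ< m g
      go zero    h g eq = refl
      go (suc m) h g eq = trans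
        (+-cong (reflexive (eq Fin.zero)) (go m (h ∘ Fin.suc) (g ∘ suc) (eq ∘ Fin.suc)))
        (sym (Σ<-suc m g))

    Σₗ-words : ∀ k (f : List ℕ → Carrier) → Σₗ (words n k) (f ∘ letters) ≈ Σʷ n k f
    Σₗ-words zero    f = +-identityʳ _
    Σₗ-words (suc k) f = begin
      Σₗ (words n (suc k)) (f ∘ letters)
        ≈⟨ Σₗ-product Vec._∷_ (allFin n) (words n k) _ ⟩
      Σₗ (allFin n) (λ a → Σₗ (words n k) (λ v → f (toℕ a ∷ letters v)))
        ≈⟨ Σₗ-cong (allFin n) (λ a → Σₗ-words k (λ v → f (toℕ a ∷ v))) ⟩
      Σₗ (allFin n) (λ a → Σʷ n k (λ v → f (toℕ a ∷ v)))
        ≈⟨ Σₗ-allFin n _ ⟩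
      _ ∎

    wordWeight-letters : ∀ {k} (v : Vec (Fin n) k) →
      Vec.foldr′ (λ a p → lookup x a * p) 1# v ≡ wordWeight (letters v)
    wordWeight-letters Vec.[]      = ≡.refl
    wordWeight-letters (a Vec.∷ v) = ≡.cong₂ _*_ (≡.sym (at-toℕ x a)) (wordWeight-letters v)

    Σₗ-fillings : ∀ ok {m} (shape : Vec ℕ m) →
      Σₗ (fillings n shape) (λ F → ⟦ tableau ok F ⟧ * weight rawRing x F) ≈ Σᵗ n ok (Vec.toList shape)
    Σₗ-fillings ok Vec.[]          = trans (+-identityʳ _) (*-identityˡ 1#)
    Σₗ-fillings ok (k Vec.∷ shape) = begin
      _ ≈⟨ Σₗ-product VecAll._∷_ (words n k) (fillings n shape) _ ⟩
      Σₗ (words n k) (λ v → Σₗ (fillings n shape) λ F →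
        ⟦ tableau ok (v VecAll.∷ F) ⟧ * weight rawRing x (v VecAll.∷ F))
        ≈⟨ Σₗ-cong (words n k) (λ v → begin
             _ ≈⟨ Σₗ-cong (fillings n shape) (λ F → term v F) ⟩
             Σₗ (fillings n shape) (λ F → ⟦ increasing (letters v) ⟧ * (⟦ ok (letters v) ⟧ *
               (wordWeight (letters v) * (⟦ tableau (above (letters v)) F ⟧ * weight rawRing x F))))
               ≈⟨ trans (Σₗ-* (fillings n shape) _ _) (*-congˡ
                    (trans (Σₗ-* (fillings n shape) _ _) (*-congˡ
                      (trans (Σₗ-* (fillings n shape) _ _) (*-congˡ
                        (Σₗ-fillings (above (letters v)) shape)))))) ⟩
             ⟦ increasing (letters v) ⟧ * (⟦ ok (letters v) ⟧ *
               (wordWeight (letters v) * Σᵗ n (above (letters v)) (Vec.toList shape))) ∎) ⟩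
      Σₗ (words n k) (λ v → ⟦ increasing (letters v) ⟧ * (⟦ ok (letters v) ⟧ *
        (wordWeight (letters v) * Σᵗ n (above (letters v)) (Vec.toList shape))))
        ≈⟨ Σₗ-words k _ ⟩
      _ ∎
      where
      term : ∀ (v : Vec (Fin n) k) (F : Filling n shape) →
        ⟦ tableau ok (v VecAll.∷ F) ⟧ * weight rawRing x (v VecAll.∷ F) ≈
        ⟦ increasing (letters v) ⟧ * (⟦ ok (letters v) ⟧ *
          (wordWeight (letters v) * (⟦ tableau (above (letters v)) F ⟧ * weight rawRing x F)))
      term v F = begin
        _ ≈⟨ *-cong (trans (⟦∧⟧ (increasing (letters v)) _) (*-congˡ (⟦∧⟧ (ok (letters v)) _)))
                    (*-congʳ (reflexive (wordWeight-letters v))) ⟩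
        (⟦ increasing (letters v) ⟧ * (⟦ ok (letters v) ⟧ * ⟦ tableau (above (letters v)) F ⟧)) *
          (wordWeight (letters v) * weight rawRing x F)
          ≈⟨ trans (*-assoc _ _ _) (*-congˡ (*-assoc _ _ _)) ⟩
        _ ≈⟨ *-congˡ (*-congˡ (x∙yz≈y∙xz _ _ _)) ⟩
        _ ∎

    schur≈schurᵇ : (shape : Vec ℕ n) → IsPartition shape →
      schur rawRing shape x ≈ schurᵇ (variables n) (Vec.toList shape)
    schur≈schurᵇ shape p = begin
      schur rawRing shape x
        ≈⟨ Σₗ-filter semistandard? (tableau any)
             (λ F → does-⇔ {_} {_} (mk⇔ (Equivalence.from (semistandard⇔ p F)) (Equivalence.to (semistandard⇔ p F))) (semistandard? F) (T? (tableau any F)))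
             (fillings n shape) (weight rawRing x) ⟩
      Σₗ (fillings n shape) (λ F → ⟦ tableau any F ⟧ * weight rawRing x F)
        ≈⟨ Σₗ-fillings any shape ⟩
      Σᵗ n any (Vec.toList shape)
        ≈⟨ Σᵗ≈schurᵇ n (Vec.toList shape) (Vec.length-toList shape) (toList-sorted p) ⟩
      _ ∎

-- The ring of Laurent polynomials

infixl 6 _+ᵥ_ _-ᵥ_

_+ᵥ_ _-ᵥ_ : ∀ {r} → Vec ℤ r → Vec ℤ r → Vec ℤ r
_+ᵥ_ = Vec.zipWith ℤ._+_
_-ᵥ_ = Vec.zipWith ℤ._-_

-ᵥ-adjoint : ∀ {r} (d f e : Vec ℤ r) → d +ᵥ f ≡ e ⇔ f ≡ e -ᵥ d
-ᵥ-adjoint d f e = mk⇔ (to d f e) (from d f e)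
  where
  open ℤ.+-*-Solver
  to : ∀ {r} (d f e : Vec ℤ r) → d +ᵥ f ≡ e → f ≡ e -ᵥ d
  to Vec.[]      Vec.[]      Vec.[] _      = ≡.refl
  to (x Vec.∷ d) (y Vec.∷ f) _ ≡.refl =
    ≡.cong₂ Vec._∷_ (solve 2 (λ x y → y := x :+ y :- x) ≡.refl x y) (to d f _ ≡.refl)
  from : ∀ {r} (d f e : Vec ℤ r) → f ≡ e -ᵥ d → d +ᵥ f ≡ e
  from Vec.[]      Vec.[] Vec.[] _ = ≡.refl
  from (x Vec.∷ d) _ (z Vec.∷ e) ≡.refl =
    ≡.cong₂ Vec._∷_ (solve 2 (λ x z → x :+ (z :- x) := z) ≡.refl x z) (from d _ e ≡.refl)

module _ {r : ℕ} where

  private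
    _≟ᵥ_ = Vec.≡-dec {n = r} ℤ._≟_

  -- The linear extension of `φ` from monomials. Ring laws are checked on all such functionals,
  -- where repeated terms do no harm, and `δ` recovers the coefficients.
  linear : Laurent r → (Vec ℤ r → ℤ) → ℤ
  linear p φ = List.foldr (λ (a , d) s → a ℤ.* φ d ℤ.+ s) 0ℤ p

  δ : Vec ℤ r → Vec ℤ r → ℤ
  δ e d = if does (d ≟ᵥ e) then 1ℤ else 0ℤ

  coeff-linear : ∀ p e → coeff p e ≡ linear p (δ e)
  coeff-linear []            e = ≡.refl
  coeff-linear ((a , d) ∷ p) e = ≡.cong₂ ℤ._+_ (lemma (does (d ≟ᵥ e))) (coeff-linear p e)
    where
    lemma : ∀ b → (if b then a else 0ℤ) ≡ a ℤ.* (if b then 1ℤ else 0ℤ)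
    lemma true  = ≡.sym (ℤ.*-identityʳ a)
    lemma false = ≡.sym (ℤ.*-zeroʳ a)

  linear-cong : ∀ p {φ ψ : Vec ℤ r → ℤ} → (∀ d → φ d ≡ ψ d) → linear p φ ≡ linear p ψ
  linear-cong []            eq = ≡.refl
  linear-cong ((a , d) ∷ p) eq = ≡.cong₂ (λ x y → a ℤ.* x ℤ.+ y) (eq d) (linear-cong p eq)

  linear-++ : ∀ p q φ → linear (p ++ₗ q) φ ≡ linear p φ ℤ.+ linear q φ
  linear-++ []            q φ = ≡.sym (ℤ.+-identityˡ _)
  linear-++ ((a , d) ∷ p) q φ =
    ≡.trans (≡.cong (ℤ._+_ (a ℤ.* φ d)) (linear-++ p q φ)) (≡.sym (ℤ.+-assoc (a ℤ.* φ d) _ _))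

  linear-zero : ∀ p → linear p (λ _ → 0ℤ) ≡ 0ℤ
  linear-zero []            = ≡.refl
  linear-zero ((a , d) ∷ p) = ≡.cong₂ ℤ._+_ (ℤ.*-zeroʳ a) (linear-zero p)

  linear-+ : ∀ p φ ψ → linear p (λ d → φ d ℤ.+ ψ d) ≡ linear p φ ℤ.+ linear p ψ
  linear-+ []            φ ψ = ≡.refl
  linear-+ ((a , d) ∷ p) φ ψ = ≡.trans (≡.cong (ℤ._+_ (a ℤ.* (φ d ℤ.+ ψ d))) (linear-+ p φ ψ))
    (solve 5 (λ a x y u v → a :* (x :+ y) :+ (u :+ v) := (a :* x :+ u) :+ (a :* y :+ v)) ≡.refl a (φ d) (ψ d) _ _)
    where open ℤ.+-*-Solver

  linear-* : ∀ p a φ → linear p (λ d → a ℤ.* φ d) ≡ a ℤ.* linear p φ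
  linear-* []            a φ = ≡.sym (ℤ.*-zeroʳ a)
  linear-* ((b , d) ∷ p) a φ = ≡.trans (≡.cong (ℤ._+_ (b ℤ.* (a ℤ.* φ d))) (linear-* p a φ))
    (solve 4 (λ a b x u → b :* (a :* x) :+ a :* u := a :* (b :* x :+ u)) ≡.refl a b (φ d) _)
    where open ℤ.+-*-Solver

  linear-swap : ∀ p q (ψ : Vec ℤ r → Vec ℤ r → ℤ) →
    linear p (λ d → linear q (ψ d)) ≡ linear q (λ f → linear p (λ d → ψ d f))
  linear-swap []            q ψ = ≡.sym (linear-zero q)
  linear-swap ((a , d) ∷ p) q ψ = ≡.trans
    (≡.cong₂ ℤ._+_ (≡.sym (linear-* q a (ψ d))) (linear-swap p q ψ))
    (≡.sym (linear-+ q _ _))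

  open RawRing (laurentRing r) using (_+_; _*_; -_; 1#)

  linear-product : ∀ p q φ → linear (p * q) φ ≡ linear p (λ d → linear q (λ f → φ (d +ᵥ f)))
  linear-product []            q φ = ≡.refl
  linear-product ((a , d) ∷ p) q φ = ≡.trans (linear-++ (List.map _ q) _ φ)
    (≡.cong₂ ℤ._+_ (row q) (linear-product p q φ))
    where
    row : ∀ q → linear (List.map (λ (b , f) → a ℤ.* b , d +ᵥ f) q) φ ≡ a ℤ.* linear q (λ f → φ (d +ᵥ f))
    row []            = ≡.sym (ℤ.*-zeroʳ a)
    row ((b , f) ∷ q) = ≡.trans (≡.cong (ℤ._+_ ((a ℤ.* b) ℤ.* φ (d +ᵥ f))) (row q))
      (solve 4 (λ a b x u → (a :* b) :* x :+ a :* u := a :* (b :* x :+ u)) ≡.refl a b (φ (d +ᵥ f)) _)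
      where open ℤ.+-*-Solver

  coeff-++ : ∀ p q e → coeff (p ++ₗ q) e ≡ coeff p e ℤ.+ coeff q e
  coeff-++ []            q e = ≡.sym (ℤ.+-identityˡ _)
  coeff-++ ((a , d) ∷ p) q e = ≡.trans (≡.cong (ℤ._+_ (if does (d ≟ᵥ e) then a else 0ℤ)) (coeff-++ p q e)) (≡.sym (ℤ.+-assoc (if does (d ≟ᵥ e) then a else 0ℤ) _ _))

  coeff-neg : ∀ p e → coeff (- p) e ≡ ℤ.- coeff p e
  coeff-neg []            e = ≡.refl
  coeff-neg ((a , d) ∷ p) e = ≡.trans (≡.cong₂ ℤ._+_ (lemma (does (d ≟ᵥ e))) (coeff-neg p e)) (≡.sym (ℤ.neg-distrib-+ (if does (d ≟ᵥ e) then a else 0ℤ) _))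
    where
    lemma : ∀ b → (if b then ℤ.- a else 0ℤ) ≡ ℤ.- (if b then a else 0ℤ)
    lemma true  = ≡.refl
    lemma false = ≡.refl

  -- The right side sees `q` only through its coefficients, which is why multiplication respects
  -- `≈ᴸ`.
  coeff-* : ∀ p q e → coeff (p * q) e ≡ linear p (λ d → coeff q (e -ᵥ d))
  coeff-* p q e = ≡.trans (coeff-linear (p * q) e) (≡.trans (linear-product p q (δ e))
    (linear-cong p λ d → ≡.trans
      (linear-cong q λ f → ≡.cong (if_then 1ℤ else 0ℤ) (does-⇔ (-ᵥ-adjoint d f e) ((d +ᵥ f) ≟ᵥ e) (f ≟ᵥ (e -ᵥ d))))
      (≡.sym (coeff-linear q (e -ᵥ d)))))

  linear⇒≈ : ∀ {p q : Laurent r} → (∀ φ → linear p φ ≡ linear q φ) → p ≈ᴸ q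
  linear⇒≈ {p} {q} eq e = ≡.trans (coeff-linear p e) (≡.trans (eq (δ e)) (≡.sym (coeff-linear q e)))

  *-comm-≈ : ∀ p q → p * q ≈ᴸ q * p
  *-comm-≈ p q = linear⇒≈ {p * q} {q * p} λ φ → ≡.trans (linear-product p q φ)
    (≡.trans (linear-swap p q _) (≡.trans
      (linear-cong q λ f → linear-cong p λ d → ≡.cong φ (Vec.zipWith-comm ℤ.+-comm d f))
      (≡.sym (linear-product q p φ))))

  *-congˡ-≈ : ∀ p {q q′} → q ≈ᴸ q′ → p * q ≈ᴸ p * q′
  *-congˡ-≈ p {q} {q′} eq e = ≡.trans (coeff-* p q e)
    (≡.trans (linear-cong p λ d → eq (e -ᵥ d)) (≡.sym (coeff-* p q′ e)))

laurentIsCommutativeRing : ∀ r → let open RawRing (laurentRing r) in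
  IsCommutativeRing _≈_ _+_ _*_ -_ 0# 1#
laurentIsCommutativeRing r = record
  { isRing = record
    { +-isAbelianGroup = record
      { isGroup = record
        { isMonoid = record
          { isSemigroup = record
            { isMagma = record
              { isEquivalence = record
                { refl = λ _ → ≡.refl ; sym = λ p e → ≡.sym (p e) ; trans = λ p q e → ≡.trans (p e) (q e) }
              ; ∙-cong = λ {p} {p′} {q} {q′} eq eq′ e → ≡.trans (coeff-++ p q e)
                  (≡.trans (≡.cong₂ ℤ._+_ (eq e) (eq′ e)) (≡.sym (coeff-++ p′ q′ e)))
              }
            ; assoc = λ p q s e → ≡.cong (λ l → coeff l e) (List.++-assoc p q s)
            }
          ; identity = (λ _ _ → ≡.refl) , λ p e → ≡.cong (λ l → coeff l e) (List.++-identityʳ p)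
          }
        ; inverse =
            (λ p e → ≡.trans (coeff-++ (- p) p e) (≡.trans (≡.cong (ℤ._+ coeff p e) (coeff-neg p e)) (ℤ.+-inverseˡ (coeff p e))))
          , (λ p e → ≡.trans (coeff-++ p (- p) e) (≡.trans (≡.cong (ℤ._+_ (coeff p e)) (coeff-neg p e)) (ℤ.+-inverseʳ (coeff p e))))
        ; ⁻¹-cong = λ {p} {q} eq e → ≡.trans (coeff-neg p e) (≡.trans (≡.cong ℤ.-_ (eq e)) (≡.sym (coeff-neg q e)))
        }
      ; comm = λ p q e → ≡.trans (coeff-++ p q e) (≡.trans (ℤ.+-comm (coeff p e) _) (≡.sym (coeff-++ q p e)))
      }
    ; *-cong = λ {p} {p′} {q} {q′} eq eq′ e → ≡.trans (*-congˡ-≈ p eq′ e)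
        (≡.trans (*-comm-≈ p q′ e) (≡.trans (*-congˡ-≈ q′ eq e) (*-comm-≈ q′ p′ e)))
    ; *-assoc = λ p q s → linear⇒≈ {p = (p * q) * s} {p * (q * s)} λ φ → ≡.trans (linear-product (p * q) s φ)
        (≡.trans (linear-product p q _) (≡.trans
          (linear-cong p λ d → ≡.trans (linear-cong q λ f → linear-cong s λ g →
            ≡.cong φ (Vec.zipWith-assoc ℤ.+-assoc d f g)) (≡.sym (linear-product q s _)))
          (≡.sym (linear-product p (q * s) φ))))
    ; *-identity = identityˡ , λ p e → ≡.trans (*-comm-≈ p 1# e) (identityˡ p e)
    ; distrib = distribˡ , λ p q s e → ≡.trans (*-comm-≈ (q + s) p e) (≡.trans (distribˡ p q s e)
        (≡.trans (coeff-++ (p * q) (p * s) e) (≡.trans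
          (≡.cong₂ ℤ._+_ (*-comm-≈ p q e) (*-comm-≈ p s e)) (≡.sym (coeff-++ (q * p) (s * p) e)))))
    }
  ; *-comm = *-comm-≈
  }
  where
  open RawRing (laurentRing r)
  identityˡ : ∀ p → 1# * p ≈ᴸ p
  identityˡ p = linear⇒≈ {p = 1# * p} {p} λ φ → ≡.trans (linear-product 1# p φ)
    (≡.trans (ℤ.+-identityʳ _) (≡.trans (ℤ.*-identityˡ _)
      (linear-cong p λ d → ≡.cong φ (Vec.zipWith-identityˡ ℤ.+-identityˡ d))))
  distribˡ : ∀ p q s → p * (q + s) ≈ᴸ (p * q) + (p * s)
  distribˡ p q s = linear⇒≈ {p = p * (q + s)} {(p * q) + (p * s)} λ φ → ≡.trans (linear-product p (q + s) φ)
    (≡.trans (linear-cong p λ d → linear-++ q s _) (≡.trans (linear-+ p _ _)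
      (≡.trans (≡.cong₂ ℤ._+_ (≡.sym (linear-product p q φ)) (≡.sym (linear-product p s φ)))
        (≡.sym (linear-++ (p * q) (p * s) φ)))))

laurentCommutativeRing : ℕ → CommutativeRing 0ℓ 0ℓ
laurentCommutativeRing r = record { isCommutativeRing = laurentIsCommutativeRing r }

double≡0 : ∀ i → i ℤ.+ i ≡ 0ℤ → i ≡ 0ℤ
double≡0 i eq = ℤ.*-cancelˡ-≡ (+ 2) i 0ℤ (≡.trans (solve 1 (λ i → con (+ 2) :* i := i :+ i) ≡.refl i) eq)
  where open ℤ.+-*-Solver

-- Non-zero-divisors among differences of monomials

module NonZeroDivisors {c ℓ} (R : CommutativeRing c ℓ) where
  open CommutativeRing R
  open import Algebra.Properties.Ring ring

  NonZeroDivisor : Carrier → Set (c ⊔ ℓ)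
  NonZeroDivisor p = ∀ q → p * q ≈ 0# → q ≈ 0#

  1-nonZeroDivisor : NonZeroDivisor 1#
  1-nonZeroDivisor q eq = trans (sym (*-identityˡ q)) eq

  *-nonZeroDivisor : ∀ {p q} → NonZeroDivisor p → NonZeroDivisor q → NonZeroDivisor (p * q)
  *-nonZeroDivisor {p} {q} np nq s eq = nq s (np (q * s) (trans (sym (*-assoc p q s)) eq))

  neg-nonZeroDivisor : ∀ {p} → NonZeroDivisor p → NonZeroDivisor (- p)
  neg-nonZeroDivisor {p} np q eq =
    np q (trans (sym (-‿involutive (p * q))) (trans (-‿cong (trans (-‿distribˡ-* p q) eq)) -0#≈0#))

  [u-v]q≈0⇒uq≈vq : ∀ u v q → (u - v) * q ≈ 0# → u * q ≈ v * q
  [u-v]q≈0⇒uq≈vq u v q eq = x∙y⁻¹≈ε⇒x≈y _ _ (trans (sym ([y-z]x≈yx-zx q u v)) eq)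

module Monomials (r : ℕ) where
  open CommutativeRing (laurentCommutativeRing r)
  open NonZeroDivisors (laurentCommutativeRing r)

  torsionFree : 2-TorsionFree (laurentCommutativeRing r)
  torsionFree p eq e = double≡0 (coeff p e) (≡.trans (≡.sym (coeff-++ p p e)) (eq e))

  monomial : ℤ → Vec ℤ r → Laurent r
  monomial a d = (a , d) ∷ []

  coeff-monomial-* : ∀ a d p e → coeff (monomial a d * p) e ≡ a ℤ.* coeff p (e -ᵥ d)
  coeff-monomial-* a d p e = ≡.trans (coeff-* (monomial a d) p e) (ℤ.+-identityʳ _)

  -- A bound for the exponents of the i-th variable.
  degree : Fin r → Laurent r → ℕ
  degree i = List.foldr (λ (a , d) n → ∣ lookup d i ∣ ℕ.+ n) 0

  coeff-beyond-degree : ∀ i p e → degree i p < ∣ lookup e i ∣ → coeff p e ≡ 0ℤ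
  coeff-beyond-degree i []            e _   = ≡.refl
  coeff-beyond-degree i ((a , d) ∷ p) e lt with Vec.≡-dec ℤ._≟_ d e
  ... | yes ≡.refl = ⊥-elim (ℕ.<⇒≱ lt (ℕ.m≤m+n _ _))
  ... | no _       = ≡.trans (ℤ.+-identityˡ _)
                       (coeff-beyond-degree i p e (ℕ.≤-trans (s≤s (ℕ.m≤n+m _ _)) lt))

  -- If (a z^d - b z^f) q = 0 then |coeff q| is invariant under translation by
  -- d - f, hence zero, since q has finite support.
  difference-nonZeroDivisor : ∀ {a b} d f i → ∣ a ∣ ≡ 1 → ∣ b ∣ ≡ 1 → lookup d i ≢ lookup f i →
    NonZeroDivisor (monomial a d - monomial b f)
  difference-nonZeroDivisor {a} {b} d f i ∣a∣ ∣b∣ d≢f q eq g =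
    ℤ.∣i∣≡0⇒i≡0 (≡.trans (invariant n g) (≡.cong ∣_∣ (coeff-beyond-degree i q (translate n g) far)))
    where
    open ℤ.+-*-Solver

    translate : ℕ → Vec ℤ r → Vec ℤ r
    translate zero    g = g
    translate (suc n) g = (translate n g +ᵥ d) -ᵥ f

    lookup-translate : ∀ n g → lookup (translate n g) i ≡ lookup g i ℤ.+ + n ℤ.* (lookup d i ℤ.- lookup f i)
    lookup-translate zero    g = ≡.sym (≡.trans (≡.cong (ℤ._+_ (lookup g i)) (ℤ.*-zeroˡ (lookup d i ℤ.- lookup f i))) (ℤ.+-identityʳ _))
    lookup-translate (suc n) g = ≡.trans (Vec.lookup-zipWith ℤ._-_ i (translate n g +ᵥ d) f)
      (≡.trans (≡.cong (ℤ._- lookup f i) (≡.trans (Vec.lookup-zipWith ℤ._+_ i (translate n g) d) (≡.cong (ℤ._+ lookup d i) (lookup-translate n g))))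
        (solve 4 (λ g n d f → g :+ n :* (d :- f) :+ d :- f := g :+ (con 1ℤ :+ n) :* (d :- f)) ≡.refl
          (lookup g i) (+ n) (lookup d i) (lookup f i)))

    +-then-- : ∀ (g d : Vec ℤ r) → (g +ᵥ d) -ᵥ d ≡ g
    +-then-- g d = ≡.sym (Equivalence.to (-ᵥ-adjoint d g (g +ᵥ d)) (Vec.zipWith-comm ℤ.+-comm d g))

    balance : monomial a d * q ≈ monomial b f * q
    balance = [u-v]q≈0⇒uq≈vq (monomial a d) (monomial b f) q eq

    unit : ∀ {a} x → ∣ a ∣ ≡ 1 → ∣ a ℤ.* x ∣ ≡ ∣ x ∣
    unit {a} x eq = ≡.trans (ℤ.abs-* a x) (≡.trans (≡.cong (ℕ._* ∣ x ∣) eq) (ℕ.*-identityˡ _))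

    invariant₁ : ∀ g → ∣ coeff q g ∣ ≡ ∣ coeff q ((g +ᵥ d) -ᵥ f) ∣
    invariant₁ g = ≡.trans (≡.cong (λ h → ∣ coeff q h ∣) (≡.sym (+-then-- g d)))
      (≡.trans (≡.sym (unit {a} (coeff q ((g +ᵥ d) -ᵥ d)) ∣a∣)) (≡.trans
        (≡.cong ∣_∣ (≡.trans (≡.sym (coeff-monomial-* a d q (g +ᵥ d))) (≡.trans (balance (g +ᵥ d)) (coeff-monomial-* b f q (g +ᵥ d)))))
        (unit {b} (coeff q ((g +ᵥ d) -ᵥ f)) ∣b∣)))

    invariant : ∀ n g → ∣ coeff q g ∣ ≡ ∣ coeff q (translate n g) ∣
    invariant zero    g = ≡.refl
    invariant (suc n) g = ≡.trans (invariant n g) (invariant₁ (translate n g))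

    t = lookup d i ℤ.- lookup f i

    -- Each translation moves the exponent by `t`, with `∣ t ∣` at least 1, so this many of them
    -- outweigh the starting exponent and pass the degree bound.
    n = suc (degree i q ℕ.+ ∣ lookup g i ∣)

    t≢0 : ∣ t ∣ ≢ 0
    t≢0 eq = d≢f (ℤ.i-j≡0⇒i≡j (lookup d i) (lookup f i) (ℤ.∣i∣≡0⇒i≡0 eq))

    far : degree i q < ∣ lookup (translate n g) i ∣
    far = ℕ.+-cancelʳ-< ∣ lookup g i ∣ _ _ (begin-strict
      degree i q ℕ.+ ∣ lookup g i ∣  <⟨ ℕ.n<1+n _ ⟩
      n                              ≤⟨ ℕ.m≤m*n n ∣ t ∣ {{ℕ.≢-nonZero t≢0}} ⟩
      n ℕ.* ∣ t ∣                    ≡⟨ ℤ.abs-* (+ n) t ⟨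
      ∣ + n ℤ.* t ∣                  ≡⟨ ≡.cong ∣_∣ (solve 2 (λ g s → s := g :+ s :- g) ≡.refl (lookup g i) (+ n ℤ.* t)) ⟩
      ∣ lookup g i ℤ.+ + n ℤ.* t ℤ.- lookup g i ∣  ≡⟨ ≡.cong (λ x → ∣ x ℤ.- lookup g i ∣) (lookup-translate n g) ⟨
      ∣ lookup (translate n g) i ℤ.- lookup g i ∣ ≤⟨ ℤ.∣i-j∣≤∣i∣+∣j∣ (lookup (translate n g) i) (lookup g i) ⟩
      ∣ lookup (translate n g) i ∣ ℕ.+ ∣ lookup g i ∣ ∎)
      where open ℕ.≤-Reasoning

-- Signs and the coefficients of the alternant

sg : ℕ → ℤ
sg zero    = 1ℤ
sg (suc n) = ℤ.- sg n

sg-+ : ∀ m n → sg (m ℕ.+ n) ≡ sg m ℤ.* sg n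
sg-+ zero    n = ≡.sym (ℤ.*-identityˡ _)
sg-+ (suc m) n = ≡.trans (≡.cong ℤ.-_ (sg-+ m n)) (ℤ.neg-distribˡ-* (sg m) (sg n))

sg-cases : ∀ n → sg n ≡ 1ℤ ⊎ sg n ≡ -1ℤ
sg-cases zero    = inj₁ ≡.refl
sg-cases (suc n) with sg-cases n
... | inj₁ eq = inj₂ (≡.cong ℤ.-_ eq)
... | inj₂ eq = inj₁ (≡.cong ℤ.-_ eq)

sg-same⇒even : ∀ m n → sg m ≡ sg n → sg (m ℕ.+ n) ≡ 1ℤ
sg-same⇒even m n eq with sg-cases n
... | inj₁ p = ≡.trans (sg-+ m n) (≡.cong₂ ℤ._*_ (≡.trans eq p) p)
... | inj₂ p = ≡.trans (sg-+ m n) (≡.cong₂ ℤ._*_ (≡.trans eq p) p)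

even⇒sg-same : ∀ m n → sg (m ℕ.+ n) ≡ 1ℤ → sg m ≡ sg n
even⇒sg-same m n eq with sg-cases m | sg-cases n
... | inj₁ p | inj₁ q = ≡.trans p (≡.sym q)
... | inj₂ p | inj₂ q = ≡.trans p (≡.sym q)
... | inj₁ p | inj₂ q with () ← ≡.trans (≡.sym eq) (≡.trans (sg-+ m n) (≡.cong₂ ℤ._*_ p q))
... | inj₂ p | inj₁ q with () ← ≡.trans (≡.sym eq) (≡.trans (sg-+ m n) (≡.cong₂ ℤ._*_ p q))

-- The total is even, so the other two summands agree in parity as well. Every parity argument
-- against a second pair with the same difference goes through this.
sg-balance : ∀ a q p z → a ℕ.+ q ≡ p ℕ.+ z → sg a ≡ sg q → sg p ≡ sg z
sg-balance a q p z eq s =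
  even⇒sg-same p z (≡.trans (≡.cong sg (≡.sym eq)) (sg-same⇒even a q s))

open Expansion ℤ.+-*-commutativeRing
  using (ex; ex-cong; ex-cong′; ex-zero; ex-map; ex-*; ex-transpose; Alternating; ex-alternating; ↭-zero)

-- The determinant without rows: it is 1 only if all exponents have been used.
null : List ℕ → ℤ
null []      = 1ℤ
null (_ ∷ _) = 0ℤ

hit : ℤ → ℕ → ℕ → ℤ
hit k b c = if does (+ c ℤ.- + b ℤ.≟ k) then 1ℤ else 0ℤ

-- C (k₁ ∷ … ∷ kₘ) bs is the coefficient of z₁^k₁ ⋯ zₘ^kₘ in the alternant with
-- exponents bs at the point z₁^-1, z₁, …, zₘ^-1, zₘ, -1, 1.
C : List ℤ → List ℕ → ℤ
C []       = ex λ p → λ ps → sg p ℤ.* ex (λ q qs → null qs) ps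
C (k ∷ ks) = ex λ b → ex λ c cs → hit k b c ℤ.* C ks cs

*-alternating : ∀ {A : Set} α {G : List A → ℤ} → Alternating G → Alternating (λ xs → α ℤ.* G xs)
*-alternating α alt xs y z zs =
  ≡.trans (≡.cong (α ℤ.*_) (alt xs y z zs)) (≡.sym (ℤ.neg-distribʳ-* α _))

C-alternating : ∀ ks → Alternating (C ks)
C-alternating []       = ex-alternating λ p →
  *-alternating (sg p) {ex λ q qs → null qs} (ex-alternating {h = λ q qs → null qs} λ q → null-alternating)
  where
  null-alternating : Alternating null
  null-alternating []      y z zs = ≡.refl
  null-alternating (_ ∷ _) y z zs = ≡.refl
C-alternating (k ∷ ks) = ex-alternating λ b → ex-alternating λ c → *-alternating (hit k b c) {C ks} (C-alternating ks)

-- The two families of exponents for which all coefficients vanish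

i≡-i⇒i≡0 : ∀ {i} → i ≡ ℤ.- i → i ≡ 0ℤ
i≡-i⇒i≡0 {i} eq = double≡0 i (≡.trans (≡.cong (ℤ._+_ i) eq) (ℤ.+-inverseʳ i))

-- Once the constant sign is taken out, the rows of -1 and 1 coincide, and `ex-transpose` makes the
-- double sum its own negative. The rows of the variables only pass to sublists.
C-monochromatic : ∀ ks {bs} σ → All (λ b → sg b ≡ σ) bs → C ks bs ≡ 0ℤ
C-monochromatic [] {bs} σ same = begin
  C [] bs
    ≡⟨ ex-cong bs (λ p ps perm → ≡.cong (ℤ._* _) (All.head (↭.All-resp-↭ (↭.↭-sym perm) same))) ⟩
  ex (λ p ps → σ ℤ.* ex (λ q qs → null qs) ps) bs
    ≡⟨ ex-* σ _ bs ⟩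
  σ ℤ.* ex (λ p → ex (λ q qs → null qs)) bs
    ≡⟨ ≡.cong (σ ℤ.*_) (i≡-i⇒i≡0 (ex-transpose (λ p q qs → null qs) bs)) ⟩
  σ ℤ.* 0ℤ ≡⟨ ℤ.*-zeroʳ σ ⟩
  0ℤ ∎
  where open ≡.≡-Reasoning
C-monochromatic (k ∷ ks) {bs} σ same =
  ex-zero bs λ b cs perm → ex-zero cs λ c ds perm′ →
    ≡.trans (≡.cong (hit k b c ℤ.*_) (C-monochromatic ks σ
      (All.tail (↭.All-resp-↭ (↭.↭-sym perm′) (All.tail (↭.All-resp-↭ (↭.↭-sym perm) same))))))
      (ℤ.*-zeroʳ (hit k b c))

module _ {s : ℕ} (even : sg s ≡ 1ℤ) where

  sg-∸ : ∀ {n} → n ≤ s → sg (s ∸ n) ≡ sg n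
  sg-∸ {n} n≤s = even⇒sg-same (s ∸ n) n (≡.trans (≡.cong sg (ℕ.m∸n+n≡m n≤s)) even)

  hit-∸ : ∀ k {b c} → b ≤ s → c ≤ s → hit k (s ∸ b) (s ∸ c) ≡ hit k c b
  hit-∸ k {b} {c} b≤s c≤s = ≡.cong (λ i → if does (i ℤ.≟ k) then 1ℤ else 0ℤ) (begin
    + (s ∸ c) ℤ.- + (s ∸ b)                    ≡⟨ ≡.cong₂ ℤ._-_ (∸≡- c≤s) (∸≡- b≤s) ⟩
    (+ s ℤ.- + c) ℤ.- (+ s ℤ.- + b)  ≡⟨ solve 3 (λ s b c → (s :- c) :- (s :- b) := b :- c) ≡.refl (+ s) (+ b) (+ c) ⟩
    + b ℤ.- + c ∎)
    where
    open ≡.≡-Reasoning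
    open ℤ.+-*-Solver
    ∸≡- : ∀ {n} → n ≤ s → + (s ∸ n) ≡ + s ℤ.- + n
    ∸≡- {n} n≤s = ≡.trans (≡.sym (ℤ.⊖-≥ n≤s)) (≡.sym (ℤ.m-n≡m⊖n s n))

  -- Reflection turns c - b into b - c, which exchanges the rows of a variable and its inverse: one
  -- sign for each variable. The row of -1 is unchanged because `s` is even.
  C-reflect : ∀ ks {bs} → All (_≤ s) bs → C ks (List.map (s ∸_) bs) ≡ sg (length ks) ℤ.* C ks bs
  C-reflect [] {bs} bounds = begin
    C [] (List.map (s ∸_) bs)
      ≡⟨ ex-map (s ∸_) _ bs ⟩
    ex (λ p ps → sg (s ∸ p) ℤ.* ex (λ q qs → null qs) (List.map (s ∸_) ps)) bs
      ≡⟨ ex-cong bs (λ p ps perm → ≡.cong₂ ℤ._*_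
           (sg-∸ (All.head (↭.All-resp-↭ (↭.↭-sym perm) bounds)))
           (≡.trans (ex-map (s ∸_) _ ps) (ex-cong′ ps λ q qs → null-map qs))) ⟩
    C [] bs         ≡⟨ ℤ.*-identityˡ _ ⟨
    1ℤ ℤ.* C [] bs  ∎
    where
    open ≡.≡-Reasoning
    null-map : ∀ qs → null (List.map (s ∸_) qs) ≡ null qs
    null-map []      = ≡.refl
    null-map (_ ∷ _) = ≡.refl
  C-reflect (k ∷ ks) {bs} bounds = begin
    C (k ∷ ks) (List.map (s ∸_) bs)
      ≡⟨ ex-map (s ∸_) _ bs ⟩
    ex (λ b cs → ex (λ c ds → hit k (s ∸ b) c ℤ.* C ks ds) (List.map (s ∸_) cs)) bs
      ≡⟨ ex-cong bs (λ b cs perm → ≡.trans (ex-map (s ∸_) _ cs) (ex-cong cs λ c ds perm′ →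
           let bs′ = ↭.All-resp-↭ (↭.↭-sym perm) bounds
               cs′ = ↭.All-resp-↭ (↭.↭-sym perm′) (All.tail bs′) in
           ≡.trans (≡.cong₂ ℤ._*_ (hit-∸ k (All.head bs′) (All.head cs′)) (C-reflect ks (All.tail cs′)))
             (x∙yz≈y∙xz (hit k c b) (sg (length ks)) (C ks ds)))) ⟩
    ex (λ b → ex (λ c ds → sg (length ks) ℤ.* (hit k c b ℤ.* C ks ds))) bs
      ≡⟨ ≡.trans (ex-cong′ bs λ b cs → ex-* (sg (length ks)) (λ c ds → hit k c b ℤ.* C ks ds) cs)
           (ex-* (sg (length ks)) (λ b → ex λ c ds → hit k c b ℤ.* C ks ds) bs) ⟩
    sg (length ks) ℤ.* ex (λ b → ex (λ c ds → hit k c b ℤ.* C ks ds)) bs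
      ≡⟨ ≡.cong (sg (length ks) ℤ.*_) (ex-transpose _ bs) ⟩
    sg (length ks) ℤ.* ℤ.- C (k ∷ ks) bs
      ≡⟨ ≡.trans (≡.sym (ℤ.neg-distribʳ-* (sg (length ks)) _)) (ℤ.neg-distribˡ-* (sg (length ks)) _) ⟩
    ℤ.- sg (length ks) ℤ.* C (k ∷ ks) bs ∎
    where
    open ≡.≡-Reasoning
    open import Algebra.Properties.CommutativeSemigroup ℤ.*-commutativeSemigroup using (x∙yz≈y∙xz)

-- The exponents are arranged as pairs (a , z), (b , y), … with a > b > … > y > z.
flatten : List (ℕ × ℕ) → List ℕ
flatten []            = []
flatten ((a , z) ∷ S) = a ∷ z ∷ flatten S

flatten-swap : ∀ {G : List ℕ → ℤ} → Alternating G → ∀ xs S →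
  G (xs ++ₗ flatten (List.map swap S)) ≡ sg (length S) ℤ.* G (xs ++ₗ flatten S)
flatten-swap alt xs [] = ≡.sym (ℤ.*-identityˡ _)
flatten-swap {G} alt xs ((a , z) ∷ S) = begin
  G (xs ++ₗ z ∷ a ∷ flatten (List.map swap S))
    ≡⟨ alt xs z a _ ⟩
  ℤ.- G (xs ++ₗ a ∷ z ∷ flatten (List.map swap S))
    ≡⟨ ≡.cong (ℤ.-_ ∘ G) (List.++-assoc xs (a ∷ z ∷ []) _) ⟨
  ℤ.- G ((xs ++ₗ a ∷ z ∷ []) ++ₗ flatten (List.map swap S))
    ≡⟨ ≡.cong ℤ.-_ (flatten-swap {G} alt (xs ++ₗ a ∷ z ∷ []) S) ⟩
  ℤ.- (sg (length S) ℤ.* G ((xs ++ₗ a ∷ z ∷ []) ++ₗ flatten S))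
    ≡⟨ ≡.cong (λ l → ℤ.- (sg (length S) ℤ.* G l)) (List.++-assoc xs (a ∷ z ∷ []) _) ⟩
  ℤ.- (sg (length S) ℤ.* G (xs ++ₗ a ∷ z ∷ flatten S))
    ≡⟨ ℤ.neg-distribˡ-* (sg (length S)) _ ⟩
  _ ∎
  where open ≡.≡-Reasoning

Balanced : ℕ → List (ℕ × ℕ) → Set
Balanced s = All λ (a , z) → a ℕ.+ z ≡ s

-- Reflecting the exponents inverts z₁, …, zₘ, which contributes the sign (-1)ᵐ,
-- and swaps the m + 1 pairs.
C-balanced : ∀ ks {S s} → suc (length ks) ≡ length S → sg s ≡ 1ℤ → Balanced s S → C ks (flatten S) ≡ 0ℤ
C-balanced ks {S} {s} len even bal = cancel (begin
  sg (length ks) ℤ.* C ks (flatten S)        ≡⟨ C-reflect even ks (bounds bal) ⟨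
  C ks (List.map (s ∸_) (flatten S))         ≡⟨ ≡.cong (C ks) (reflect bal) ⟩
  C ks (flatten (List.map swap S))           ≡⟨ flatten-swap {C ks} (C-alternating ks) [] S ⟩
  sg (length S) ℤ.* C ks (flatten S)         ≡⟨ ≡.cong (λ n → sg n ℤ.* C ks (flatten S)) len ⟨
  sg (suc (length ks)) ℤ.* C ks (flatten S)  ∎)
  where
  open ≡.≡-Reasoning
  bounds : ∀ {S} → Balanced s S → All (_≤ s) (flatten S)
  bounds []             = []
  bounds (≡.refl ∷ bal) = ℕ.m≤m+n _ _ ∷ ℕ.m≤n+m _ _ ∷ bounds bal
  reflect : ∀ {S} → Balanced s S → List.map (s ∸_) (flatten S) ≡ flatten (List.map swap S)
  reflect [] = ≡.refl
  reflect {(a , z) ∷ S} (≡.refl ∷ bal) =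
    ≡.cong₂ _∷_ (ℕ.m+n∸m≡n a z) (≡.cong₂ _∷_ (ℕ.m+n∸n≡m a z) (reflect bal))
  cancel : ∀ {x} → sg (length ks) ℤ.* x ≡ ℤ.- sg (length ks) ℤ.* x → x ≡ 0ℤ
  cancel {x} eq with sg-cases (length ks)
  ... | inj₁ p rewrite p = i≡-i⇒i≡0 (≡.trans (≡.sym (ℤ.*-identityˡ x)) (≡.trans eq (ℤ.-1*i≡-i x)))
  ... | inj₂ p rewrite p = i≡-i⇒i≡0 (≡.trans (≡.sym (ℤ.*-identityˡ x)) (≡.trans (≡.sym eq) (ℤ.-1*i≡-i x)))

-- Removing a pair of exponents with a unique difference

-- The pair (a , z) is determined in L by the difference a - z.
UniqueDifference : List ℕ → ℕ → ℕ → Set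
UniqueDifference L a z = ∀ {p q} → p ∈ L → q ∈ L → a ℕ.+ q ≡ p ℕ.+ z → p ≡ a × q ≡ z

hit-self : ∀ a z → hit (+ z ℤ.- + a) a z ≡ 1ℤ
hit-self a z with + z ℤ.- + a ℤ.≟ + z ℤ.- + a
... | yes _ = ≡.refl
... | no ¬p = ⊥-elim (¬p ≡.refl)

-- In the expansion along the first two rows, uniqueness leaves only the choice of `a` and then `z`.
-- Both stand in front, so the sign is positive; the distinctness hypotheses exclude further copies
-- of them.
C-unique-pair : ∀ ks {a z bs} → UniqueDifference (a ∷ z ∷ bs) a z → a ≢ z →
  All (a ≢_) bs → All (z ≢_) bs → C ((+ z ℤ.- + a) ∷ ks) (a ∷ z ∷ bs) ≡ C ks bs
C-unique-pair ks {a} {z} {bs} unique a≢z a∉ z∉ = begin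
  (hit k a z ℤ.* C ks bs ℤ.- ex (λ c cs → hit k a c ℤ.* C ks (z ∷ cs)) bs)
    ℤ.- ex (λ b cs → ex (λ c ds → hit k b c ℤ.* C ks ds) (a ∷ cs)) (z ∷ bs)
    ≡⟨ ≡.cong₂ ℤ._-_ (≡.cong₂ ℤ._-_ (≡.trans (≡.cong (ℤ._* C ks bs) (hit-self a z)) (ℤ.*-identityˡ _)) inner) outer ⟩
  (C ks bs ℤ.- 0ℤ) ℤ.- 0ℤ
    ≡⟨ ≡.trans (ℤ.+-identityʳ _) (ℤ.+-identityʳ _) ⟩
  C ks bs ∎
  where
  open ≡.≡-Reasoning
  k = + z ℤ.- + a
  member : ∀ {x : ℕ} {xs ys} → x ∷ xs ↭ ys → x ∈ ys
  member perm = ↭.∈-resp-↭ perm (here ≡.refl)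
  miss : ∀ {p q} x → ¬ (p ≡ a × q ≡ z) → p ∈ (a ∷ z ∷ bs) → q ∈ (a ∷ z ∷ bs) → hit k p q ℤ.* x ≡ 0ℤ
  miss {p} {q} x ≢ p∈ q∈ with + q ℤ.- + p ℤ.≟ k
  ... | no  _  = ≡.refl
  ... | yes eq = ⊥-elim (≢ (unique p∈ q∈ (ℤ.+-injective (begin
    + a ℤ.+ + q  ≡⟨ solve 3 (λ a q p → a :+ q := p :+ (a :+ (q :- p))) ≡.refl (+ a) (+ q) (+ p) ⟩
    + p ℤ.+ (+ a ℤ.+ (+ q ℤ.- + p)) ≡⟨ ≡.cong (λ i → + p ℤ.+ (+ a ℤ.+ i)) eq ⟩
    + p ℤ.+ (+ a ℤ.+ (+ z ℤ.- + a)) ≡⟨ solve 3 (λ a z p → p :+ (a :+ (z :- a)) := p :+ z) ≡.refl (+ a) (+ z) (+ p) ⟩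
    + p ℤ.+ + z ∎))))
    where open ℤ.+-*-Solver
  inner : ex (λ c cs → hit k a c ℤ.* C ks (z ∷ cs)) bs ≡ 0ℤ
  inner = ex-zero {h = λ c cs → hit k a c ℤ.* C ks (z ∷ cs)} bs λ c cs perm → miss (C ks (z ∷ cs))
    (λ (_ , c≡z) → All.lookup z∉ (member perm) (≡.sym c≡z)) (here ≡.refl) (there (there (member perm)))
  outer : ex (λ b cs → ex (λ c ds → hit k b c ℤ.* C ks ds) (a ∷ cs)) (z ∷ bs) ≡ 0ℤ
  outer = ex-zero {h = λ b cs → ex (λ c ds → hit k b c ℤ.* C ks ds) (a ∷ cs)} (z ∷ bs) λ b cs perm →
    ex-zero {h = λ c ds → hit k b c ℤ.* C ks ds} (a ∷ cs) λ c ds perm′ → miss (C ks ds)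
    (λ (b≡a , _) → All.lookup (a≢z ∷ a∉) (member perm) (≡.sym b≡a)) (there (member perm))
    (↭.∈-resp-↭ (↭.trans (↭.swap b a ↭.refl) (↭.prep a perm)) (there (member perm′)))

-- There are 2m + 2 exponents for m variables, that is one pair more than variables.
Vanishing : List (ℕ × ℕ) → Set
Vanishing S = ∀ ks → suc (length ks) ≡ length S → C ks (flatten S) ≡ 0ℤ

-- Any coefficient for `S′` is a coefficient for `S`, with the exponent z - a for the variable that
-- is split off.
remove-pair : ∀ {S S′ a z} → flatten S ↭ a ∷ z ∷ flatten S′ → length S ≡ suc (length S′) →
  UniqueDifference (a ∷ z ∷ flatten S′) a z → a ≢ z → All (a ≢_) (flatten S′) → All (z ≢_) (flatten S′) →
  Vanishing S → Vanishing S′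
remove-pair {S} {S′} {a} {z} perm len unique a≢z a∉ z∉ van ks eq =
  ≡.trans (≡.sym (C-unique-pair ks unique a≢z a∉ z∉))
    (↭-zero (C ((+ z ℤ.- + a) ∷ ks)) (C-alternating ((+ z ℤ.- + a) ∷ ks)) [] perm
      (van ((+ z ℤ.- + a) ∷ ks) (≡.trans (≡.cong suc eq) (≡.sym len))))

-- z < … < y < b < … < a with the pairs (b , y), … in S
data Nested (a z : ℕ) : List (ℕ × ℕ) → Set where
  []   : z < a → Nested a z []
  step : ∀ {b y S} → b < a → z < y → Nested b y S → Nested a z ((b , y) ∷ S)

Nested⇒< : ∀ {a z S} → Nested a z S → z < a
Nested⇒< ([] z<a)           = z<a
Nested⇒< (step b<a z<y nest) = ℕ.<-trans z<y (ℕ.<-trans (Nested⇒< nest) b<a)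

Nested-widen : ∀ {a z b y S} → b ≤ a → z ≤ y → Nested b y S → Nested a z S
Nested-widen b≤a z≤y ([] y<b)             = [] (ℕ.≤-<-trans z≤y (ℕ.<-≤-trans y<b b≤a))
Nested-widen b≤a z≤y (step c<b y<x nest) =
  step (ℕ.<-≤-trans c<b b≤a) (ℕ.≤-<-trans z≤y y<x) nest

Nested⇒inside : ∀ {a z S} → Nested a z S → All (λ p → z < p × p < a) (flatten S)
Nested⇒inside ([] _) = []
Nested⇒inside (step b<a z<y nest) =
  (ℕ.<-trans z<y (Nested⇒< nest) , b<a) ∷ (z<y , ℕ.<-trans (Nested⇒< nest) b<a) ∷
  All.map (λ (y<p , p<b) → ℕ.<-trans z<y y<p , ℕ.<-trans p<b b<a) (Nested⇒inside nest)

-- Vanishing forces one parity or constant even sums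

Monochromatic : List (ℕ × ℕ) → Set
Monochromatic S = ∃[ σ ] All (λ p → sg p ≡ σ) (flatten S)

-- Conditions (a) and (b) for the exponents: opposite exponents add up to the width plus the odd
-- number N - 1, so odd width becomes an even sum.
Good : List (ℕ × ℕ) → Set
Good S = Monochromatic S ⊎ (∃[ s ] (sg s ≡ 1ℤ × Balanced s S))

good-head : ∀ {a z S} → Good ((a , z) ∷ S) → sg a ≡ sg z
good-head (inj₁ (σ , p ∷ q ∷ _)) = ≡.trans p (≡.sym q)
good-head {a} {z} (inj₂ (s , even , p ∷ _)) = even⇒sg-same a z (≡.trans (≡.cong sg p) even)

-- If both lists were balanced, a pair of `S` would give both the same sum. So unless `S` is empty,
-- one of them has a single parity; the agreement of `a` and `a′` identifies it as that of `a`.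
good-unbalanced : ∀ {a z a′ z′ S} → Good ((a , z) ∷ S) → Good ((a′ , z′) ∷ S) →
  a ℕ.+ z ≢ a′ ℕ.+ z′ → sg a ≡ sg a′ → All (λ p → sg p ≡ sg a) (flatten S)
good-unbalanced (inj₁ (σ , p ∷ _ ∷ ps)) _ _ _ = All.map (λ q → ≡.trans q (≡.sym p)) ps
good-unbalanced (inj₂ _) (inj₁ (σ , p ∷ _ ∷ ps)) _ a≡a′ =
  All.map (λ q → ≡.trans q (≡.trans (≡.sym p) (≡.sym a≡a′))) ps
good-unbalanced {S = []} (inj₂ _) (inj₂ _) _ _ = []
good-unbalanced {S = _ ∷ _} (inj₂ (s , _ , p ∷ q ∷ _)) (inj₂ (t , _ , p′ ∷ q′ ∷ _)) ≢ _ =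
  ⊥-elim (≢ (≡.trans p (≡.trans (≡.sym q) (≡.trans q′ (≡.sym p′)))))

-- Among such `p` and `q` the difference p - q is largest only at p = a, q = z.
extreme-pair : ∀ {a z p q} → p ≤ a → z ≤ q → a ℕ.+ q ≡ p ℕ.+ z → p ≡ a × q ≡ z
extreme-pair {a} {z} {p} {q} p≤a z≤q eq = p≡a , ℕ.+-cancelˡ-≡ a q z (≡.trans eq (≡.cong (ℕ._+ z) p≡a))
  where
  p≡a : p ≡ a
  p≡a = ℕ.≤-antisym p≤a (ℕ.+-cancelʳ-≤ z a p
    (ℕ.≤-trans (ℕ.+-monoʳ-≤ a z≤q) (ℕ.≤-reflexive eq)))

module Step {a z b y : ℕ} {S : List (ℕ × ℕ)} (b<a : b < a) (z<y : z < y) (nest : Nested b y S)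
            (van : Vanishing ((a , z) ∷ (b , y) ∷ S)) where

  private
    F = flatten S

    y<b : y < b
    y<b = Nested⇒< nest

    inner : All (λ p → y < p × p < b) F
    inner = Nested⇒inside nest

    z<b : z < b
    z<b = ℕ.<-trans z<y y<b

    y<a : y < a
    y<a = ℕ.<-trans y<b b<a

    z<a : z < a
    z<a = ℕ.<-trans z<y y<a

    ≢> : ∀ {m n} → n < m → m ≢ n
    ≢> n<m ≡.refl = ℕ.<-irrefl ≡.refl n<m

  data Position (p : ℕ) : Set where
    =a : p ≡ a → Position p
    =z : p ≡ z → Position p
    in-by : y ≤ p → p ≤ b → p ∈ (b ∷ y ∷ F) → Position p

  position : ∀ {p} → p ∈ (a ∷ z ∷ b ∷ y ∷ F) → Position p
  position (here eq)                      = =a eq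
  position (there (here eq))              = =z eq
  position (there (there p∈@(here ≡.refl))) = in-by (ℕ.<⇒≤ y<b) ℕ.≤-refl p∈
  position (there (there p∈@(there (here ≡.refl)))) = in-by ℕ.≤-refl (ℕ.<⇒≤ y<b) p∈
  position (there (there p∈@(there (there p∈F)))) =
    in-by (ℕ.<⇒≤ (proj₁ (All.lookup inner p∈F))) (ℕ.<⇒≤ (proj₂ (All.lookup inner p∈F))) p∈

  private
    upper : ∀ {p} → Position p → p ≡ a ⊎ p ≤ b
    upper (=a eq)         = inj₁ eq
    upper (=z ≡.refl)     = inj₂ (ℕ.<⇒≤ z<b)
    upper (in-by _ p≤b _) = inj₂ p≤b

    lower : ∀ {p} → Position p → p ≡ z ⊎ y ≤ p
    lower (=a ≡.refl)     = inj₂ (ℕ.<⇒≤ y<a)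
    lower (=z eq)         = inj₁ eq
    lower (in-by y≤p _ _) = inj₂ y≤p

    p≤a : ∀ {p} → Position p → p ≤ a
    p≤a p with upper p
    ... | inj₁ ≡.refl = ℕ.≤-refl
    ... | inj₂ p≤b    = ℕ.≤-trans p≤b (ℕ.<⇒≤ b<a)

    z≤p : ∀ {p} → Position p → z ≤ p
    z≤p p with lower p
    ... | inj₁ ≡.refl = ℕ.≤-refl
    ... | inj₂ y≤p    = ℕ.≤-trans (ℕ.<⇒≤ z<y) y≤p

  remove-az : Vanishing ((b , y) ∷ S)
  remove-az = remove-pair ↭.refl ≡.refl
    (λ p∈ q∈ → extreme-pair (p≤a (position p∈)) (z≤p (position q∈)))
    (≢> z<a) (≢> b<a ∷ ≢> y<a ∷ All.map (λ (_ , p<b) → ≢> (ℕ.<-trans p<b b<a)) inner)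
    (≡.≢-sym (≢> z<b) ∷ ≡.≢-sym (≢> z<y) ∷ All.map (λ (y<p , _) → ≡.≢-sym (≢> (ℕ.<-trans z<y y<p))) inner) van

  -- `UniqueDifference` stated through `Position`, hence independent of the order in which the
  -- exponents are listed.
  DeterminedPair : ℕ → ℕ → Set
  DeterminedPair c x = ∀ {p q} → Position p → Position q → c ℕ.+ q ≡ p ℕ.+ x → p ≡ c × q ≡ x

  private
    transfer : ∀ {L c x} → a ∷ z ∷ b ∷ y ∷ F ↭ L → DeterminedPair c x → UniqueDifference L c x
    transfer perm u p∈ q∈ = u (position (back p∈)) (position (back q∈))
      where
      back : ∀ {p} → p ∈ _ → p ∈ (a ∷ z ∷ b ∷ y ∷ F)
      back = ↭.∈-resp-↭ (↭.↭-sym perm)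

  remove-ay : DeterminedPair a y → Vanishing ((b , z) ∷ S)
  remove-ay u = remove-pair perm ≡.refl (transfer perm u) (≢> y<a)
    (≢> b<a ∷ ≢> z<a ∷ All.map (λ (_ , p<b) → ≢> (ℕ.<-trans p<b b<a)) inner)
    (≡.≢-sym (≢> y<b) ∷ ≢> z<y ∷ All.map (λ (y<p , _) → ≡.≢-sym (≢> y<p)) inner) van
    where
    perm : a ∷ z ∷ b ∷ y ∷ F ↭ a ∷ y ∷ b ∷ z ∷ F
    perm = ↭.prep a (↭.trans (↭.prep z (↭.swap b y ↭.refl)) (↭.trans (↭.swap z y ↭.refl) (↭.prep y (↭.swap z b ↭.refl))))

  remove-bz : DeterminedPair b z → Vanishing ((a , y) ∷ S)
  remove-bz u = remove-pair perm ≡.refl (transfer perm u) (≢> z<b)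
    (≡.≢-sym (≢> b<a) ∷ ≢> y<b ∷ All.map (λ (_ , p<b) → ≢> p<b) inner)
    (≡.≢-sym (≢> z<a) ∷ ≡.≢-sym (≢> z<y) ∷ All.map (λ (y<p , _) → ≡.≢-sym (≢> (ℕ.<-trans z<y y<p))) inner) van
    where
    perm : a ∷ z ∷ b ∷ y ∷ F ↭ b ∷ z ∷ a ∷ y ∷ F
    perm = ↭.trans (↭.prep a (↭.swap z b ↭.refl)) (↭.trans (↭.swap a b ↭.refl) (↭.prep b (↭.swap a z ↭.refl)))

  remove-by : DeterminedPair b y → Vanishing ((a , z) ∷ S)
  remove-by u = remove-pair perm ≡.refl (transfer perm u) (≢> y<b)
    (≡.≢-sym (≢> b<a) ∷ ≢> z<b ∷ All.map (λ (_ , p<b) → ≢> p<b) inner)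
    (≡.≢-sym (≢> y<a) ∷ ≢> z<y ∷ All.map (λ (y<p , _) → ≡.≢-sym (≢> y<p)) inner) van
    where
    perm : a ∷ z ∷ b ∷ y ∷ F ↭ b ∷ y ∷ a ∷ z ∷ F
    perm = ↭.trans (↭.prep a (↭.swap z b ↭.refl)) (↭.trans (↭.swap a b ↭.refl)
      (↭.prep b (↭.trans (↭.prep a (↭.swap z y ↭.refl)) (↭.trans (↭.swap a y ↭.refl) ↭.refl))))

  -- If p is not `a` then p ≤ b, and p + y ≤ b + y < a + z ≤ a + q contradicts the equation.
  unique-ay : b ℕ.+ y < a ℕ.+ z → DeterminedPair a y
  unique-ay lt p q eq with upper p
  ... | inj₁ ≡.refl = ≡.refl , ℕ.+-cancelˡ-≡ a _ y eq
  ... | inj₂ p≤b    = ⊥-elim (ℕ.<⇒≱ (ℕ.<-≤-trans lt (ℕ.+-monoʳ-≤ a (z≤p q)))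
                        (ℕ.≤-trans (ℕ.≤-reflexive eq) (ℕ.+-monoˡ-≤ y p≤b)))

  -- The mirror image: if q is not `z` then y ≤ q, and p + z ≤ a + z < b + y ≤ b + q.
  unique-bz : a ℕ.+ z < b ℕ.+ y → DeterminedPair b z
  unique-bz lt {p} p∈ q∈ eq with lower q∈
  ... | inj₁ ≡.refl = ≡.sym (ℕ.+-cancelʳ-≡ z b p eq) , ≡.refl
  ... | inj₂ y≤q    = ⊥-elim (ℕ.<⇒≱ (ℕ.≤-<-trans (ℕ.+-monoˡ-≤ z (p≤a p∈)) lt)
                        (ℕ.≤-trans (ℕ.+-monoʳ-≤ b y≤q) (ℕ.≤-reflexive eq)))

  -- Here `a` alone has the other parity. A rival pair would have to start with `a`; then b + q = a
  -- + z excludes q = a by size, and otherwise forces `a` into the parity of `z`.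
  unique-bz-parity : (∀ {p} → p ∈ (b ∷ y ∷ F) → sg p ≡ sg b) → sg z ≡ sg b → sg a ≢ sg b → DeterminedPair b z
  unique-bz-parity same z~b a≁b p∈ q∈ eq with upper p∈
  ... | inj₂ p≤b    = extreme-pair p≤b (z≤p q∈) eq
  ... | inj₁ ≡.refl = ⊥-elim (impossible q∈ eq)
    where
    impossible : ∀ {q} → Position q → b ℕ.+ q ≢ a ℕ.+ z
    impossible {q} (=a ≡.refl)    eq = ≢> z<b (ℕ.+-cancelʳ-≡ a b z (≡.trans eq (ℕ.+-comm a z)))
    impossible {q} (=z ≡.refl)    eq = a≁b (≡.trans (sg-balance b q a z eq (≡.sym z~b)) z~b)
    impossible {q} (in-by _ _ q∈) eq = a≁b (≡.trans (sg-balance b q a z eq (≡.sym (same q∈))) z~b)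

  -- The mirror image, with `z` as the only exponent of the other parity: a rival pair would have to
  -- end in `z`.
  unique-ay-parity : (∀ {p} → p ∈ (b ∷ y ∷ F) → sg p ≡ sg y) → sg a ≡ sg y → sg z ≢ sg y → DeterminedPair a y
  unique-ay-parity same a~y z≁y p∈ q∈ eq with lower q∈
  ... | inj₂ y≤q    = extreme-pair (p≤a p∈) y≤q eq
  ... | inj₁ ≡.refl = ⊥-elim (impossible p∈ eq)
    where
    impossible : ∀ {p} → Position p → a ℕ.+ z ≢ p ℕ.+ y
    impossible {p} (=a ≡.refl)    eq = z≁y (≡.cong sg (ℕ.+-cancelˡ-≡ a z y eq))
    impossible {p} (=z ≡.refl)    eq = ≢> y<a (ℕ.+-cancelʳ-≡ z a y (≡.trans eq (ℕ.+-comm z y)))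
    impossible {p} (in-by _ _ p∈) eq =
      z≁y (≡.trans (≡.sym (sg-balance p y a z (≡.sym eq) (same p∈))) a~y)

  -- Here `a` and `z` are the only exponents of their parity, while b - y is even. So a rival pair
  -- is either inner, where b - y is the largest difference, or made of `a` and `z`, where the
  -- difference is too large, zero or negative.
  unique-by-parity : (∀ {p} → p ∈ (b ∷ y ∷ F) → sg p ≡ sg b) → sg a ≡ sg z → sg a ≢ sg b → DeterminedPair b y
  unique-by-parity same a~z a≁b {p} {q} p∈ q∈ eq = go p∈ q∈
    where
    y~b : sg y ≡ sg b
    y~b = same (there (here ≡.refl))
    outer-inner : ∀ {p q} → sg p ≡ sg a → q ∈ (b ∷ y ∷ F) → b ℕ.+ q ≢ p ℕ.+ y
    outer-inner {p} {q} p~a q∈ eq =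
      a≁b (≡.trans (≡.sym p~a) (≡.trans (sg-balance b q p y eq (≡.sym (same q∈))) y~b))
    inner-outer : ∀ {p q} → p ∈ (b ∷ y ∷ F) → sg q ≡ sg a → b ℕ.+ q ≢ p ℕ.+ y
    inner-outer {p} {q} p∈ q~a eq =
      a≁b (≡.trans (≡.sym q~a) (≡.sym (sg-balance p y b q (≡.sym eq) (≡.trans (same p∈) (≡.sym y~b)))))
    go : Position p → Position q → p ≡ b × q ≡ y
    go (in-by _ p≤b _) (in-by y≤q _ _) = extreme-pair p≤b y≤q eq
    go (=a ≡.refl)    (in-by _ _ q∈) = ⊥-elim (outer-inner ≡.refl q∈ eq)
    go (=z ≡.refl)    (in-by _ _ q∈) = ⊥-elim (outer-inner (≡.sym a~z) q∈ eq)
    go (in-by _ _ p∈) (=a ≡.refl)    = ⊥-elim (inner-outer p∈ ≡.refl eq)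
    go (in-by _ _ p∈) (=z ≡.refl)    = ⊥-elim (inner-outer p∈ (≡.sym a~z) eq)
    go (=a ≡.refl) (=a ≡.refl) = ⊥-elim (≢> y<b (ℕ.+-cancelʳ-≡ a b y (≡.trans eq (ℕ.+-comm a y))))
    go (=a ≡.refl) (=z ≡.refl) = ⊥-elim (ℕ.<-irrefl eq (ℕ.+-mono-< b<a z<y))
    go (=z ≡.refl) (=a ≡.refl) = ⊥-elim (ℕ.<-irrefl (≡.sym eq) (ℕ.+-mono-< z<b y<a))
    go (=z ≡.refl) (=z ≡.refl) = ⊥-elim (≢> y<b (ℕ.+-cancelʳ-≡ z b y (≡.trans eq (ℕ.+-comm z y))))

-- The recursion is on the inner pairs with the outer pair arbitrary, since removing any of the four
-- candidates leaves one outer pair around the same `S`.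
vanishing⇒good : ∀ {a z} S → Nested a z S → Vanishing ((a , z) ∷ S) → Good ((a , z) ∷ S)
vanishing⇒good {a} {z} [] _ van = inj₁ (sg z , ℤ.i-j≡0⇒i≡j (sg a) (sg z) (≡.trans (≡.sym (≡.cong₂ ℤ._-_ (ℤ.*-identityʳ (sg a))
  (≡.trans (ℤ.+-identityʳ _) (ℤ.*-identityʳ (sg z))))) (van [] ≡.refl)) ∷ ≡.refl ∷ [])
vanishing⇒good {a} {z} ((b , y) ∷ S) (step b<a z<y nest) van = by-comparison (ℕ.<-cmp (a ℕ.+ z) (b ℕ.+ y))
  where
  open Step b<a z<y nest van
  F = flatten S

  good-by : Good ((b , y) ∷ S)
  good-by = vanishing⇒good S nest remove-az

  good-bz : DeterminedPair b z → Good ((a , y) ∷ S)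
  good-bz u = vanishing⇒good S (Nested-widen (ℕ.<⇒≤ b<a) ℕ.≤-refl nest) (remove-bz u)

  good-ay : DeterminedPair a y → Good ((b , z) ∷ S)
  good-ay u = vanishing⇒good S (Nested-widen ℕ.≤-refl (ℕ.<⇒≤ z<y) nest) (remove-ay u)

  b~y : sg b ≡ sg y
  b~y = good-head good-by

  larger : b ℕ.+ y < a ℕ.+ z → Good ((a , z) ∷ (b , y) ∷ S)
  -- The removals of (a , z) and (a , y) leave (b , y) and (b , z), whose sums differ because z < y.
  -- So `b`, `y`, `z` and all of `S` share one parity, and only `a` remains in doubt.
  larger lt with sg a ℤ.≟ sg b
  ... | yes a~b = inj₁ (sg b , a~b ∷ ≡.sym b~z ∷ ≡.refl ∷ ≡.sym b~y ∷ same)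
    where
    b~z = good-head (good-ay (unique-ay lt))
    same = good-unbalanced good-by (good-ay (unique-ay lt)) (λ eq → ℕ.<-irrefl (≡.sym (ℕ.+-cancelˡ-≡ b y z eq)) z<y) ≡.refl
  -- With `a` as the only exception, (b , z) can be removed as well, and the remaining outer pair (a
  -- , y) ties `a` to the common parity after all.
  ... | no a≁b = ⊥-elim (a≁b (≡.trans (good-head (good-bz (unique-bz-parity
                   (All.lookup (≡.refl ∷ ≡.sym b~y ∷ same)) (≡.sym b~z) a≁b))) (≡.sym b~y)))
    where
    b~z = good-head (good-ay (unique-ay lt))
    same = good-unbalanced good-by (good-ay (unique-ay lt)) (λ eq → ℕ.<-irrefl (≡.sym (ℕ.+-cancelˡ-≡ b y z eq)) z<y) ≡.refl

  smaller : a ℕ.+ z < b ℕ.+ y → Good ((a , z) ∷ (b , y) ∷ S)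
  -- The mirror image: (b , y) and (a , y) remain with different sums, and only `z` is in doubt.
  smaller lt with sg z ℤ.≟ sg y
  ... | yes z~y = inj₁ (sg b , ≡.trans a~y (≡.sym b~y) ∷ ≡.trans z~y (≡.sym b~y) ∷ ≡.refl ∷ ≡.sym b~y ∷ same)
    where
    a~y = good-head (good-bz (unique-bz lt))
    same = good-unbalanced good-by (good-bz (unique-bz lt)) (λ eq → ℕ.<-irrefl (ℕ.+-cancelʳ-≡ y b a eq) b<a) (≡.trans b~y (≡.sym a~y))
  ... | no z≁y = ⊥-elim (z≁y (≡.trans (≡.sym (good-head (good-ay (unique-ay-parity
                   (All.lookup (b~y ∷ ≡.refl ∷ All.map (λ p → ≡.trans p b~y) same)) a~y z≁y)))) b~y))
    where
    a~y = good-head (good-bz (unique-bz lt))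
    same = good-unbalanced good-by (good-bz (unique-bz lt)) (λ eq → ℕ.<-irrefl (ℕ.+-cancelʳ-≡ y b a eq) b<a) (≡.trans b~y (≡.sym a~y))

  equal : a ℕ.+ z ≡ b ℕ.+ y → Good ((b , y) ∷ S) → Good ((a , z) ∷ (b , y) ∷ S)
  -- The common sum of the inner list extends to (a , z) by the equality at hand.
  equal eq (inj₂ (s , even , p ∷ ps)) = inj₂ (s , even , ≡.trans eq p ∷ p ∷ ps)
  equal eq (inj₁ (σ , p ∷ q ∷ ps)) with sg a ℤ.≟ sg b
  ... | yes a~b = inj₁ (σ , ≡.trans a~b p ∷ ≡.trans (≡.sym a~z) (≡.trans a~b p) ∷ p ∷ q ∷ ps)
    where
    a~z = sg-balance b y a z (≡.sym eq) b~y
  -- Now `a` and `z` agree with each other and differ from all the rest, so (b , y) can be removed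
  -- and (a , z) stays around `S`.
  ... | no a≁b = balanced S ps (vanishing⇒good S (Nested-widen (ℕ.<⇒≤ b<a) (ℕ.<⇒≤ z<y) nest)
                   (remove-by (unique-by-parity (All.lookup (All.map (λ r → ≡.trans r (≡.sym p)) (p ∷ q ∷ ps))) a~z a≁b)))
    where
    a~z = sg-balance b y a z (≡.sym eq) b~y
    balanced : ∀ S → All (λ p → sg p ≡ σ) (flatten S) → Good ((a , z) ∷ S) → Good ((a , z) ∷ (b , y) ∷ S)
    balanced S  _  (inj₂ (s , even , r ∷ rs)) = inj₂ (s , even , r ∷ ≡.trans (≡.sym eq) r ∷ rs)
    -- With `S` empty no third pair has to fit: the two equal sums suffice, and they are even
    -- because `a` and `z` agree in parity.
    balanced [] _  (inj₁ _) = inj₂ (a ℕ.+ z , sg-same⇒even a z a~z , ≡.refl ∷ ≡.sym eq ∷ [])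
    balanced (_ ∷ _) (r ∷ _) (inj₁ (τ , t ∷ _ ∷ u ∷ _)) =
      ⊥-elim (a≁b (≡.trans t (≡.trans (≡.sym u) (≡.trans r (≡.sym p)))))

  by-comparison : _ → Good ((a , z) ∷ (b , y) ∷ S)
  by-comparison (tri< lt _ _) = smaller lt
  by-comparison (tri≈ _ eq _) = equal eq good-by
  by-comparison (tri> _ _ gt) = larger gt

-- The product of differences is not a zero divisor

module VandermondeNonZeroDivisor {c ℓ} (R : CommutativeRing c ℓ) (torsionFree : 2-TorsionFree R) where
  open CommutativeRing R
  open NonZeroDivisors R
  open Expansion R using (signed)
  open Bialternant R torsionFree using (prod; vandermonde)

  signed-nonZeroDivisor : ∀ n {p} → NonZeroDivisor p → NonZeroDivisor (signed n p)
  signed-nonZeroDivisor zero    np = np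
  signed-nonZeroDivisor (suc n) np = neg-nonZeroDivisor (signed-nonZeroDivisor n np)

  prod-nonZeroDivisor : ∀ x {ys} → All (λ y → NonZeroDivisor (y - x)) ys → NonZeroDivisor (prod (_- x) ys)
  prod-nonZeroDivisor x []       = 1-nonZeroDivisor
  prod-nonZeroDivisor x (p ∷ ps) = *-nonZeroDivisor p (prod-nonZeroDivisor x ps)

  vandermonde-nonZeroDivisor : ∀ {xs} → AllPairs (λ x y → NonZeroDivisor (y - x)) xs →
                               NonZeroDivisor (vandermonde xs)
  vandermonde-nonZeroDivisor []                = 1-nonZeroDivisor
  vandermonde-nonZeroDivisor {x ∷ xs} (p ∷ ps) =
    *-nonZeroDivisor (signed-nonZeroDivisor (length xs) (prod-nonZeroDivisor x p))
                     (vandermonde-nonZeroDivisor ps)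

  -- The element is 2, so this is torsion-freeness.
  1--1-nonZeroDivisor : NonZeroDivisor (1# - - 1#)
  1--1-nonZeroDivisor q eq = torsionFree q (trans (sym (trans
    (*-congʳ (+-congˡ (-‿involutive 1#))) (trans (distribʳ q 1# 1#) (+-cong (*-identityˡ q) (*-identityˡ q))))) eq)
    where open import Algebra.Properties.Ring ring


-- The alternant at the given point and its coefficients

module Points (r : ℕ) where
  open CommutativeRing (laurentCommutativeRing r) using (_*_; -_; _-_; 1#)
  module L = CommutativeRing (laurentCommutativeRing r)
  open NonZeroDivisors (laurentCommutativeRing r) using (NonZeroDivisor)
  open Monomials r
  open VandermondeNonZeroDivisor (laurentCommutativeRing r) torsionFree
  open Bialternant (laurentCommutativeRing r) torsionFree using (det; pow)
  open SchurPolynomial (laurentCommutativeRing r) using (at; variables-∷)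
  open import Algebra.Properties.Semiring.Exp (CommutativeRing.semiring (laurentCommutativeRing r)) using (_^_)
  private
    module E = Expansion (laurentCommutativeRing r)
    module Z = Expansion ℤ.+-*-commutativeRing

  adjoin : Fin r → List (Laurent r) → List (Laurent r)
  adjoin i xs = z^ -1ℤ i ∷ z^ 1ℤ i ∷ xs

  points : List (Fin r) → List (Laurent r)
  points = List.foldr adjoin (- 1# ∷ 1# ∷ [])

  -- `variables` reads the coordinates backwards, hence the reversed indices and the inverse of each
  -- variable in front of it.
  variables-concat : ∀ k (f : Fin k → Fin r) xs →
    Tableaux.variables (laurentCommutativeRing r)
      (at (Vec.concat (Vec.tabulate λ i → z^ 1ℤ (f i) Vec.∷ z^ -1ℤ (f i) Vec.∷ Vec.[]))) (k ℕ.* 2) ++ₗ xs ≡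
    List.foldr adjoin xs (reverse (tabulate f))
  variables-concat zero    f xs = ≡.refl
  variables-concat (suc k) f xs = begin
    variables (suc (suc (k ℕ.* 2))) (at v) ++ₗ xs
      ≡⟨ ≡.cong (_++ₗ xs) (≡.trans (variables-∷ (at v) (suc (k ℕ.* 2)))
           (≡.cong (_∷ʳ a) (variables-∷ (at v ∘ suc) (k ℕ.* 2)))) ⟩
    ((variables (k ℕ.* 2) (at (Vec.concat (Vec.tabulate (g ∘ Fin.suc)))) ∷ʳ b) ∷ʳ a) ++ₗ xs
      ≡⟨ ≡.trans (List.++-assoc (vs ∷ʳ b) [ a ] xs) (List.++-assoc vs [ b ] (a ∷ xs)) ⟩
    variables (k ℕ.* 2) (at (Vec.concat (Vec.tabulate (g ∘ Fin.suc)))) ++ₗ adjoin (f Fin.zero) xs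
      ≡⟨ variables-concat k (f ∘ Fin.suc) _ ⟩
    List.foldr adjoin (adjoin (f Fin.zero) xs) (reverse (tabulate (f ∘ Fin.suc)))
      ≡⟨ List.foldr-∷ʳ adjoin xs (f Fin.zero) (reverse (tabulate (f ∘ Fin.suc))) ⟨
    List.foldr adjoin xs (reverse (tabulate (f ∘ Fin.suc)) ∷ʳ f Fin.zero)
      ≡⟨ ≡.cong (List.foldr adjoin xs) (List.unfold-reverse (f Fin.zero) (tabulate (f ∘ Fin.suc))) ⟨
    List.foldr adjoin xs (reverse (tabulate f)) ∎
    where
    open ≡.≡-Reasoning
    variables : ℕ → (ℕ → Laurent r) → List (Laurent r)
    variables n X = Tableaux.variables (laurentCommutativeRing r) X n
    g : Fin (suc k) → Vec (Laurent r) 2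
    g i = z^ 1ℤ (f i) Vec.∷ z^ -1ℤ (f i) Vec.∷ Vec.[]
    v = Vec.concat (Vec.tabulate g)
    vs = variables (k ℕ.* 2) (at (Vec.concat (Vec.tabulate (g ∘ Fin.suc))))
    a = z^ 1ℤ (f Fin.zero)
    b = z^ -1ℤ (f Fin.zero)

  indices : List (Fin r)
  indices = reverse (allFin r)

  variables-point : Tableaux.variables (laurentCommutativeRing r) (at (point r)) (2 ℕ.+ r ℕ.* 2) ≡ points indices
  variables-point = begin
    variables (2 ℕ.+ r ℕ.* 2) (at (point r))
      ≡⟨ ≡.trans (variables-∷ (at (point r)) (suc (r ℕ.* 2)))
           (≡.cong (_∷ʳ 1#) (variables-∷ (at (point r) ∘ suc) (r ℕ.* 2))) ⟩
    (vs ∷ʳ - 1#) ∷ʳ 1#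
      ≡⟨ List.++-assoc vs [ - 1# ] [ 1# ] ⟩
    vs ++ₗ - 1# ∷ 1# ∷ []
      ≡⟨ variables-concat r (λ i → i) _ ⟩
    points indices ∎
    where
    open ≡.≡-Reasoning
    variables : ℕ → (ℕ → Laurent r) → List (Laurent r)
    variables n X = Tableaux.variables (laurentCommutativeRing r) X n
    vs = variables (r ℕ.* 2) (at (Vec.concat (Vec.tabulate λ i → z^ 1ℤ i Vec.∷ z^ -1ℤ i Vec.∷ Vec.[])))

  -- The common shape of 1, -1 and the powers of the other variables. Subtracting a nonzero power of
  -- the i-th variable gives a binomial whose exponents differ at i.
  FreeOf : Fin r → Laurent r → Set
  FreeOf i p = ∃[ a ] ∃[ d ] (p ≡ monomial a d × ∣ a ∣ ≡ 1 × lookup d i ≡ 0ℤ)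

  lookup-exponent : ∀ i k → lookup (Vec.replicate r 0ℤ Vec.[ i ]≔ k) i ≡ k
  lookup-exponent i k = Vec.lookup∘updateAt i (Vec.replicate r 0ℤ)

  z^-freeOf : ∀ {i j} k → i ≢ j → FreeOf i (z^ k j)
  z^-freeOf {i} {j} k i≢j = 1ℤ , _ , ≡.refl , ≡.refl ,
    ≡.trans (Vec.lookup∘updateAt′ i j i≢j (Vec.replicate r 0ℤ)) (Vec.lookup-replicate i 0ℤ)

  points-freeOf : ∀ {i is} → All (i ≢_) is → All (FreeOf i) (points is)
  points-freeOf {i} [] =
    (-1ℤ , _ , ≡.refl , ≡.refl , Vec.lookup-replicate i 0ℤ) ∷
    (1ℤ , _ , ≡.refl , ≡.refl , Vec.lookup-replicate i 0ℤ) ∷ []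
  points-freeOf (p ∷ ps) = z^-freeOf -1ℤ p ∷ z^-freeOf 1ℤ p ∷ points-freeOf ps

  freeOf-nonZeroDivisor : ∀ {i k p} → k ≢ 0ℤ → FreeOf i p → NonZeroDivisor (p - z^ k i)
  freeOf-nonZeroDivisor {i} {k} k≢0 (a , d , ≡.refl , ∣a∣ , d≡0) =
    difference-nonZeroDivisor {a} {1ℤ} d _ i ∣a∣ ≡.refl
      λ eq → k≢0 (≡.trans (≡.sym (lookup-exponent i k)) (≡.trans (≡.sym eq) d≡0))

  points-differences : ∀ {is} → Unique is → AllPairs (λ x y → NonZeroDivisor (y - x)) (points is)
  points-differences [] = (1--1-nonZeroDivisor ∷ []) ∷ [] ∷ []
  points-differences {i ∷ is} (i∉ ∷ u) =
    (difference-nonZeroDivisor {1ℤ} {1ℤ} _ _ i ≡.refl ≡.refl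
       (λ eq → 1≢-1 (≡.trans (≡.sym (lookup-exponent i 1ℤ)) (≡.trans eq (lookup-exponent i -1ℤ))))
     ∷ All.map (freeOf-nonZeroDivisor λ ()) free) ∷
    All.map (freeOf-nonZeroDivisor λ ()) free ∷
    points-differences u
    where
    free = points-freeOf i∉
    1≢-1 : 1ℤ ≢ -1ℤ
    1≢-1 ()

  coeff-ex : ∀ (h : ℕ → List ℕ → Laurent r) bs e →
    coeff (E.ex h bs) e ≡ Z.ex (λ b cs → coeff (h b cs) e) bs
  coeff-ex h []       e = ≡.refl
  coeff-ex h (b ∷ bs) e = ≡.trans (coeff-++ (h b bs) _ e) (≡.cong (ℤ._+_ (coeff (h b bs) e))
    (≡.trans (coeff-neg (E.ex (λ c cs → h c (b ∷ cs)) bs) e) (≡.cong ℤ.-_ (coeff-ex _ bs e))))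

  coeff-z^-* : ∀ k i p e → coeff (z^ k i * p) e ≡ coeff p (e Vec.[ i ]%= (ℤ._- k))
  coeff-z^-* k i p e = ≡.trans (coeff-monomial-* 1ℤ (Vec.replicate r 0ℤ Vec.[ i ]≔ k) p e)
    (≡.trans (ℤ.*-identityˡ _) (≡.cong (coeff p) (shift e i)))
    where
    shift : ∀ {n} (e : Vec ℤ n) i → e -ᵥ (Vec.replicate n 0ℤ Vec.[ i ]≔ k) ≡ e Vec.[ i ]%= (ℤ._- k)
    shift (x Vec.∷ e) Fin.zero    = ≡.cong ((x ℤ.- k) Vec.∷_) (unchanged e)
      where
      unchanged : ∀ {n} (e : Vec ℤ n) → e -ᵥ Vec.replicate n 0ℤ ≡ e
      unchanged = Vec.zipWith-identityʳ ℤ.+-identityʳ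
    shift (x Vec.∷ e) (Fin.suc i) = ≡.cong₂ Vec._∷_ (ℤ.+-identityʳ x) (shift e i)

  coeff-z^-^-* : ∀ k i n p e → coeff ((z^ k i ^ n) * p) e ≡ coeff p (e Vec.[ i ]%= (ℤ._- (+ n ℤ.* k)))
  coeff-z^-^-* k i zero    p e = ≡.trans (L.*-identityˡ p e) (≡.cong (coeff p) (≡.sym
    (Vec.updateAt-id-local i e (≡.trans (≡.cong (λ x → lookup e i ℤ.- x) (ℤ.*-zeroˡ k)) (ℤ.+-identityʳ _)))))
  coeff-z^-^-* k i (suc n) p e = begin
    coeff ((z^ k i * (z^ k i ^ n)) * p) e
      ≡⟨ L.*-assoc (z^ k i) (z^ k i ^ n) p e ⟩
    coeff (z^ k i * ((z^ k i ^ n) * p)) e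
      ≡⟨ coeff-z^-* k i ((z^ k i ^ n) * p) e ⟩
    coeff ((z^ k i ^ n) * p) (e Vec.[ i ]%= (ℤ._- k))
      ≡⟨ coeff-z^-^-* k i n p _ ⟩
    coeff p (e Vec.[ i ]%= (ℤ._- k) Vec.[ i ]%= (ℤ._- (+ n ℤ.* k)))
      ≡⟨ ≡.cong (coeff p) (Vec.updateAt-updateAt-local i e
           (solve 3 (λ x n k → x :- k :- n :* k := x :- (con 1ℤ :+ n) :* k) ≡.refl (lookup e i) (+ n) k)) ⟩
    coeff p (e Vec.[ i ]%= (ℤ._- (+ suc n ℤ.* k))) ∎
    where
    open ≡.≡-Reasoning
    open ℤ.+-*-Solver

  -- 1 when e vanishes outside the listed coordinates, and 0 otherwise
  supported : List (Fin r) → Vec ℤ r → ℤ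
  supported []       e = coeff 1# e
  supported (i ∷ is) e = supported is (e Vec.[ i ]≔ 0ℤ)

  supported-zero : ∀ {i is} → All (i ≢_) is → ∀ e → lookup e i ≢ 0ℤ → supported is e ≡ 0ℤ
  supported-zero {i} [] e e≢0 with Vec.≡-dec ℤ._≟_ (Vec.replicate r 0ℤ) e
  ... | yes ≡.refl = ⊥-elim (e≢0 (Vec.lookup-replicate i 0ℤ))
  ... | no _       = ≡.refl
  supported-zero {i} {j ∷ is} (i≢j ∷ ps) e e≢0 =
    supported-zero ps (e Vec.[ j ]≔ 0ℤ) λ eq → e≢0 (≡.trans (≡.sym (Vec.lookup∘updateAt′ i j i≢j e)) eq)

  supported-one : ∀ is e → (∀ i → i ∈ is ⊎ lookup e i ≡ 0ℤ) → supported is e ≡ 1ℤ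
  supported-one [] e cover with Vec.≡-dec ℤ._≟_ (Vec.replicate r 0ℤ) e
  ... | yes _ = ≡.refl
  ... | no ¬p = ⊥-elim (¬p (≡.sym (≡.trans (≡.sym (Vec.tabulate∘lookup e)) (≡.trans
                  (Vec.tabulate-cong λ i → zero-at (cover i)) (≡.trans
                  (Vec.tabulate-cong λ i → ≡.sym (Vec.lookup-replicate i 0ℤ)) (Vec.tabulate∘lookup _))))))
    where
    zero-at : ∀ {i} → i ∈ [] ⊎ lookup e i ≡ 0ℤ → lookup e i ≡ 0ℤ
    zero-at (inj₂ eq) = eq
  supported-one (j ∷ is) e cover = supported-one is (e Vec.[ j ]≔ 0ℤ) λ i → covered i (cover i) (i Fin.≟ j)
    where
    covered : ∀ i → i ∈ (j ∷ is) ⊎ lookup e i ≡ 0ℤ → Dec (i ≡ j) → i ∈ is ⊎ lookup (e Vec.[ j ]≔ 0ℤ) i ≡ 0ℤ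
    covered i _                    (yes ≡.refl) = inj₂ (Vec.lookup∘updateAt i e)
    covered i (inj₁ (here ≡.refl)) (no i≢i)     = ⊥-elim (i≢i ≡.refl)
    covered i (inj₁ (there i∈))    (no _)       = inj₁ i∈
    covered i (inj₂ eq)            (no i≢j)     = inj₂ (≡.trans (Vec.lookup∘updateAt′ i j i≢j e) eq)

  map-lookup-update : ∀ {i is} (f : ℤ → ℤ) → All (i ≢_) is → ∀ (e : Vec ℤ r) →
    List.map (lookup (e Vec.[ i ]%= f)) is ≡ List.map (lookup e) is
  map-lookup-update {i} f i∉ e = List.map-cong-local
    (All.map (λ {j} i≢j → Vec.lookup∘updateAt′ j i (≡.≢-sym i≢j) e) i∉)

  -- What remains of the alternant is free of the i-th variable, so after dividing out z_i^(c-b) the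
  -- exponent e_i + b - c must be 0; this is what `hit` tests.
  supported-shift : ∀ {i is} → All (i ≢_) is → ∀ e b c →
    supported is (e Vec.[ i ]%= (λ x → x ℤ.- + b ℤ.* -1ℤ ℤ.- + c ℤ.* 1ℤ)) ≡
    hit (lookup e i) b c ℤ.* supported (i ∷ is) e
  supported-shift {i} {is} i∉ e b c with + c ℤ.- + b ℤ.≟ lookup e i
  ... | yes eq = ≡.trans (≡.cong (supported is) (Vec.updateAt-cong-local i e
                   (≡.trans (≡.cong (λ x → x ℤ.- + b ℤ.* -1ℤ ℤ.- + c ℤ.* 1ℤ) (≡.sym eq))
                     (solve 2 (λ b c → c :- b :- b :* con -1ℤ :- c :* con 1ℤ := con 0ℤ) ≡.refl (+ b) (+ c)))))
                   (≡.sym (ℤ.*-identityˡ _))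
    where open ℤ.+-*-Solver
  ... | no ≢ = ≡.trans (supported-zero i∉ _ λ eq → ≢ (ℤ.i-j≡0⇒i≡j (+ c ℤ.- + b) (lookup e i)
                 (≡.trans (solve 3 (λ b c x → c :- b :- x := :- (x :- b :* con -1ℤ :- c :* con 1ℤ)) ≡.refl (+ b) (+ c) (lookup e i))
                   (≡.cong ℤ.-_ (≡.trans (≡.sym (Vec.lookup∘updateAt i e)) eq)))))
                 (≡.sym (ℤ.*-zeroˡ (supported (i ∷ is) e)))
    where open ℤ.+-*-Solver

  alternant : List (Fin r) → List ℕ → Laurent r
  alternant is bs = det (points is) (List.map pow bs)

  coeff-det₂ : ∀ x y ps bs e →
    coeff (det (x ∷ y ∷ ps) (List.map pow bs)) e ≡
    Z.ex (λ b cs → coeff ((x ^ b) * E.ex (λ c ds → (y ^ c) * det ps (List.map pow ds)) cs) e) bs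
  coeff-det₂ x y ps bs e = ≡.trans
    (≡.cong (λ p → coeff p e) (E.ex-map pow (λ f gs → f x * det (y ∷ ps) gs) bs))
    (≡.trans (coeff-ex _ bs e) (Z.ex-cong′ bs λ b cs →
      ≡.cong (λ p → coeff ((x ^ b) * p) e) (E.ex-map pow (λ f gs → f y * det ps gs) cs)))

  -- `C` reads only the listed coordinates of `e`; the factor `supported` forces the others to be 0.
  -- It is independent of the chosen exponents and so can be taken out of the expansions.
  coeff-alternant : ∀ {is} → Unique is → ∀ bs e →
    coeff (alternant is bs) e ≡ supported is e ℤ.* C (List.map (lookup e) is) bs
  coeff-alternant [] bs e = begin
    coeff (alternant [] bs) e
      ≡⟨ coeff-det₂ (- 1#) 1# [] bs e ⟩
    Z.ex (λ p ps → coeff (((- 1#) ^ p) * E.ex (λ q qs → (1# ^ q) * det [] (List.map pow qs)) ps) e) bs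
      ≡⟨ Z.ex-cong′ bs (λ p ps → ≡.trans (coeff-sg p _) (≡.cong (sg p ℤ.*_) (begin
           coeff (E.ex (λ q qs → (1# ^ q) * det [] (List.map pow qs)) ps) e
             ≡⟨ coeff-ex _ ps e ⟩
           Z.ex (λ q qs → coeff ((1# ^ q) * det [] (List.map pow qs)) e) ps
             ≡⟨ Z.ex-cong′ ps (λ q qs → ≡.trans (coeff-1 q _) (coeff-null qs)) ⟩
           Z.ex (λ q qs → coeff 1# e ℤ.* null qs) ps
             ≡⟨ Z.ex-* (coeff 1# e) (λ q qs → null qs) ps ⟩
           coeff 1# e ℤ.* Z.ex (λ q qs → null qs) ps ∎))) ⟩
    Z.ex (λ p ps → sg p ℤ.* (coeff 1# e ℤ.* Z.ex (λ q qs → null qs) ps)) bs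
      ≡⟨ Z.ex-cong′ bs (λ p ps → solve 3 (λ s u x → s :* (u :* x) := u :* (s :* x)) ≡.refl
           (sg p) (coeff 1# e) (Z.ex (λ q qs → null qs) ps)) ⟩
    Z.ex (λ p ps → coeff 1# e ℤ.* (sg p ℤ.* Z.ex (λ q qs → null qs) ps)) bs
      ≡⟨ Z.ex-* (coeff 1# e) (λ p ps → sg p ℤ.* Z.ex (λ q qs → null qs) ps) bs ⟩
    coeff 1# e ℤ.* C [] bs ∎
    where
    open ≡.≡-Reasoning
    open ℤ.+-*-Solver
    coeff-sg : ∀ p q → coeff (((- 1#) ^ p) * q) e ≡ sg p ℤ.* coeff q e
    coeff-sg zero    q = ≡.trans (L.*-identityˡ q e) (≡.sym (ℤ.*-identityˡ _))
    coeff-sg (suc p) q = begin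
      coeff ((- 1# * ((- 1#) ^ p)) * q) e  ≡⟨ L.*-assoc (- 1#) ((- 1#) ^ p) q e ⟩
      coeff (- 1# * (((- 1#) ^ p) * q)) e  ≡⟨ -1*x≈-x (((- 1#) ^ p) * q) e ⟩
      coeff (- (((- 1#) ^ p) * q)) e       ≡⟨ coeff-neg (((- 1#) ^ p) * q) e ⟩
      ℤ.- coeff (((- 1#) ^ p) * q) e       ≡⟨ ≡.cong ℤ.-_ (coeff-sg p q) ⟩
      ℤ.- (sg p ℤ.* coeff q e)             ≡⟨ ℤ.neg-distribˡ-* (sg p) (coeff q e) ⟩
      ℤ.- sg p ℤ.* coeff q e ∎
      where open import Algebra.Properties.Ring L.ring using (-1*x≈-x)
    coeff-1 : ∀ n q → coeff ((1# ^ n) * q) e ≡ coeff q e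
    coeff-1 zero    q = L.*-identityˡ q e
    coeff-1 (suc n) q = ≡.trans (L.*-assoc 1# (1# ^ n) q e)
      (≡.trans (L.*-identityˡ ((1# ^ n) * q) e) (coeff-1 n q))
    coeff-null : ∀ qs → coeff (det [] (List.map pow qs)) e ≡ coeff 1# e ℤ.* null qs
    coeff-null []       = ≡.sym (ℤ.*-identityʳ (coeff 1# e))
    coeff-null (_ ∷ _)  = ≡.sym (ℤ.*-zeroʳ (coeff 1# e))
  coeff-alternant {i ∷ is} (i∉ ∷ u) bs e = begin
    coeff (alternant (i ∷ is) bs) e
      ≡⟨ coeff-det₂ (z^ -1ℤ i) (z^ 1ℤ i) (points is) bs e ⟩
    Z.ex (λ b cs → coeff ((z^ -1ℤ i ^ b) * E.ex (λ c ds → (z^ 1ℤ i ^ c) * alternant is ds) cs) e) bs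
      ≡⟨ Z.ex-cong′ bs (λ b cs → begin
           coeff ((z^ -1ℤ i ^ b) * E.ex (λ c ds → (z^ 1ℤ i ^ c) * alternant is ds) cs) e
             ≡⟨ coeff-z^-^-* -1ℤ i b _ e ⟩
           coeff (E.ex (λ c ds → (z^ 1ℤ i ^ c) * alternant is ds) cs) (e₁ b)
             ≡⟨ coeff-ex _ cs (e₁ b) ⟩
           Z.ex (λ c ds → coeff ((z^ 1ℤ i ^ c) * alternant is ds) (e₁ b)) cs
             ≡⟨ Z.ex-cong′ cs (λ c ds → term b c ds) ⟩
           Z.ex (λ c ds → S ℤ.* (hit k b c ℤ.* C ks ds)) cs
             ≡⟨ Z.ex-* S (λ c ds → hit k b c ℤ.* C ks ds) cs ⟩
           S ℤ.* Z.ex (λ c ds → hit k b c ℤ.* C ks ds) cs ∎) ⟩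
    Z.ex (λ b cs → S ℤ.* Z.ex (λ c ds → hit k b c ℤ.* C ks ds) cs) bs
      ≡⟨ Z.ex-* S (λ b → Z.ex λ c ds → hit k b c ℤ.* C ks ds) bs ⟩
    S ℤ.* C (k ∷ ks) bs ∎
    where
    open ≡.≡-Reasoning
    open ℤ.+-*-Solver
    S = supported (i ∷ is) e
    k = lookup e i
    ks = List.map (lookup e) is
    e₁ : ℕ → Vec ℤ r
    e₁ b = e Vec.[ i ]%= (ℤ._- (+ b ℤ.* -1ℤ))
    e₂ : ℕ → ℕ → Vec ℤ r
    e₂ b c = e Vec.[ i ]%= (λ x → x ℤ.- + b ℤ.* -1ℤ ℤ.- + c ℤ.* 1ℤ)
    term : ∀ b c ds → coeff ((z^ 1ℤ i ^ c) * alternant is ds) (e₁ b) ≡ S ℤ.* (hit k b c ℤ.* C ks ds)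
    term b c ds = begin
      coeff ((z^ 1ℤ i ^ c) * alternant is ds) (e₁ b)
        ≡⟨ coeff-z^-^-* 1ℤ i c (alternant is ds) (e₁ b) ⟩
      coeff (alternant is ds) (e₁ b Vec.[ i ]%= (ℤ._- (+ c ℤ.* 1ℤ)))
        ≡⟨ ≡.cong (coeff (alternant is ds)) (Vec.updateAt-updateAt i e) ⟩
      coeff (alternant is ds) (e₂ b c)
        ≡⟨ coeff-alternant u ds (e₂ b c) ⟩
      supported is (e₂ b c) ℤ.* C (List.map (lookup (e₂ b c)) is) ds
        ≡⟨ ≡.cong₂ ℤ._*_ (supported-shift i∉ e b c) (≡.cong (λ l → C l ds) (map-lookup-update (λ x → x ℤ.- + b ℤ.* -1ℤ ℤ.- + c ℤ.* 1ℤ) i∉ e)) ⟩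
      (hit k b c ℤ.* S) ℤ.* C ks ds
        ≡⟨ solve 3 (λ h s x → (h :* s) :* x := s :* (h :* x)) ≡.refl (hit k b c) S (C ks ds) ⟩
      S ℤ.* (hit k b c ℤ.* C ks ds) ∎

  -- Because the indices are distinct, their values can be prescribed freely, so every `C ks` does
  -- occur as a coefficient.
  exponents : ∀ {is} → Unique is → ∀ ks → length ks ≡ length is → ∃[ e ] List.map (lookup e) is ≡ ks
  exponents []       []       _  = Vec.replicate r 0ℤ , ≡.refl
  exponents {i ∷ is} (i∉ ∷ u) (k ∷ ks) eq with exponents u ks (ℕ.suc-injective eq)
  ... | e , p = e Vec.[ i ]≔ k ,
    ≡.cong₂ _∷_ (Vec.lookup∘updateAt i e) (≡.trans (map-lookup-update (const k) i∉ e) p)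

-- From the Schur polynomial to the integer coefficients

module VanishingOfSchur (r : ℕ) where
  open CommutativeRing (laurentCommutativeRing r) using (_≈_; _*_; 0#; trans; sym; *-congˡ; zeroʳ)
  open Points r
  open Monomials r using (torsionFree)
  open VandermondeNonZeroDivisor (laurentCommutativeRing r) torsionFree using (vandermonde-nonZeroDivisor)
  open Bialternant (laurentCommutativeRing r) torsionFree using (vandermonde; bialternant)
  open Sums (laurentCommutativeRing r) using (schurᵇ)
  open SchurPolynomial (laurentCommutativeRing r) using (schur≈schurᵇ)

  indices-unique : Unique indices
  indices-unique = ↭ₛ.Unique-resp-↭ (≡.setoid (Fin r)) (↭.↭⇒↭ₛ (↭.↭-sym (↭.↭-reverse (allFin r)))) (allFin⁺ r)

  length-indices : length indices ≡ r
  length-indices = ≡.trans (List.length-reverse (allFin r)) (List.length-tabulate {n = r} λ i → i)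

  length-points : ∀ is → length (points is) ≡ 2 ℕ.+ length is ℕ.* 2
  length-points []       = ≡.refl
  length-points (i ∷ is) = ≡.cong (suc ∘ suc) (length-points is)

  schur⇔alternant : (shape : Vec ℕ (2 ℕ.+ r ℕ.* 2)) → IsPartition shape →
    schur (laurentRing r) shape (point r) ≈ᴸ 0ᴸ ⇔ alternant indices (betas (Vec.toList shape)) ≈ᴸ 0ᴸ
  schur⇔alternant shape p = mk⇔
    (λ eq → trans {alternant indices (betas ls)} {Δ * s} {0#} formula
      (trans {Δ * s} {Δ * 0#} {0#} (*-congˡ {Δ} {s} {0#} (trans {s} {schur (laurentRing r) shape (point r)} {0#}
        (sym {schur (laurentRing r) shape (point r)} {s} s≈) eq)) (zeroʳ Δ)))
    (λ eq → trans {schur (laurentRing r) shape (point r)} {s} {0#} s≈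
      (vandermonde-nonZeroDivisor (points-differences indices-unique) s
        (trans {Δ * s} {alternant indices (betas ls)} {0#} (sym {alternant indices (betas ls)} {Δ * s} formula) eq)))
    where
    ls = Vec.toList shape
    Δ = vandermonde (points indices)
    s = schurᵇ (points indices) ls
    s≈ : schur (laurentRing r) shape (point r) ≈ s
    s≈ = ≡.subst (λ xs → schur (laurentRing r) shape (point r) ≈ schurᵇ xs ls) variables-point
           (schur≈schurᵇ (point r) shape p)
    formula : alternant indices (betas ls) ≈ Δ * s
    formula = bialternant (points indices)
      (≡.trans (Vec.length-toList shape) (≡.sym (≡.trans (length-points indices) (≡.cong (λ n → 2 ℕ.+ n ℕ.* 2) length-indices))))
      (toList-sorted p)

  alternant⇔C : ∀ bs → alternant indices bs ≈ᴸ 0ᴸ ⇔ (∀ ks → length ks ≡ r → C ks bs ≡ 0ℤ)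
  alternant⇔C bs = mk⇔ to from
    where
    to : alternant indices bs ≈ᴸ 0ᴸ → ∀ ks → length ks ≡ r → C ks bs ≡ 0ℤ
    to eq ks len with exponents indices-unique ks (≡.trans len (≡.sym length-indices))
    ... | e , ≡.refl = begin
      C ks bs                                ≡⟨ ℤ.*-identityˡ _ ⟨
      1ℤ ℤ.* C ks bs                         ≡⟨ ≡.cong (ℤ._* C ks bs) (supported-one indices e λ i →
                                                  inj₁ (↭.∈-resp-↭ (↭.↭-sym (↭.↭-reverse (allFin r))) (List.∈-allFin i))) ⟨
      supported indices e ℤ.* C ks bs        ≡⟨ coeff-alternant indices-unique bs e ⟨
      coeff (alternant indices bs) e         ≡⟨ eq e ⟩
      0ℤ ∎
      where open ≡.≡-Reasoning
    from : (∀ ks → length ks ≡ r → C ks bs ≡ 0ℤ) → alternant indices bs ≈ᴸ 0ᴸ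
    from van e = ≡.trans (coeff-alternant indices-unique bs e)
      (≡.trans (≡.cong (supported indices e ℤ.*_) (van (List.map (lookup e) indices) (≡.trans (List.length-map (lookup e) indices) length-indices)))
        (ℤ.*-zeroʳ (supported indices e)))

-- Pairing the exponents from the outside inwards

tabulate-fromℕ : ∀ {A : Set} n (f : Fin (suc n) → A) → tabulate f ≡ tabulate (f ∘ inject₁) ∷ʳ f (fromℕ n)
tabulate-fromℕ zero    f = ≡.refl
tabulate-fromℕ (suc n) f = ≡.cong (f Fin.zero ∷_) (tabulate-fromℕ n (f ∘ Fin.suc))

opposite-inject₁ : ∀ {n} (i : Fin n) → opposite (inject₁ i) ≡ Fin.suc (opposite i)
opposite-inject₁ Fin.zero    = ≡.refl
opposite-inject₁ (Fin.suc i) = ≡.cong inject₁ (opposite-inject₁ i)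

opposite-fromℕ : ∀ n → opposite (fromℕ n) ≡ Fin.zero
opposite-fromℕ zero    = ≡.refl
opposite-fromℕ (suc n) = ≡.cong inject₁ (opposite-fromℕ n)

shells : ∀ k → (Fin (k ℕ.* 2) → ℕ) → List (ℕ × ℕ)
shells zero    b = []
shells (suc k) b = (b Fin.zero , b (fromℕ _)) ∷ shells k (b ∘ Fin.suc ∘ inject₁)

length-shells : ∀ k b → length (shells k b) ≡ k
length-shells zero    b = ≡.refl
length-shells (suc k) b = ≡.cong suc (length-shells k _)

tabulate↭shells : ∀ k b → tabulate b ↭ flatten (shells k b)
tabulate↭shells zero    b = ↭.refl
tabulate↭shells (suc k) b = ↭.prep (b Fin.zero) (↭.trans
  (↭.↭-reflexive (tabulate-fromℕ (k ℕ.* 2) (b ∘ Fin.suc)))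
  (↭.trans (↭.↭-sym (↭.∷↭∷ʳ (b (fromℕ _)) _)) (↭.prep (b (fromℕ _)) (tabulate↭shells k _))))

Decreasing : ∀ {n} → (Fin n → ℕ) → Set
Decreasing b = ∀ i j → i Fin.< j → b j < b i

inner-decreasing : ∀ {n} {b : Fin (suc (suc n)) → ℕ} → Decreasing b → Decreasing (b ∘ Fin.suc ∘ inject₁)
inner-decreasing dec i j i<j =
  dec _ _ (s≤s (≡.subst₂ _<_ (≡.sym (Fin.toℕ-inject₁ i)) (≡.sym (Fin.toℕ-inject₁ j)) i<j))

shells-nested : ∀ k (b : Fin (suc k ℕ.* 2) → ℕ) → Decreasing b →
  Nested (b Fin.zero) (b (fromℕ _)) (shells k (b ∘ Fin.suc ∘ inject₁))
shells-nested zero    b dec = [] (dec Fin.zero (Fin.suc Fin.zero) (s≤s z≤n))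
shells-nested (suc k) b dec = step
  (dec Fin.zero (Fin.suc Fin.zero) (s≤s z≤n))
  (dec _ _ (s≤s (ℕ.≤-reflexive (≡.cong suc (Fin.toℕ-inject₁ (fromℕ (suc (k ℕ.* 2))))))))
  (shells-nested k (b ∘ Fin.suc ∘ inject₁) (inner-decreasing dec))

-- The pairs give the equation for the first half of the indices only; the second half follows by
-- exchanging the two summands.
balanced⇒ : ∀ {s} k b → Balanced s (shells k b) → ∀ i → b i ℕ.+ b (opposite i) ≡ s
balanced⇒ (suc k) b (p ∷ ps) Fin.zero    = p
balanced⇒ (suc k) b (p ∷ ps) (Fin.suc i) with view i
... | ‵fromℕ     = ≡.trans (≡.cong (λ j → b (fromℕ _) ℕ.+ b (inject₁ j)) (opposite-fromℕ (k ℕ.* 2)))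
                     (≡.trans (ℕ.+-comm (b (fromℕ _)) (b Fin.zero)) p)
... | ‵inject₁ j = ≡.trans (≡.cong (λ j′ → b (Fin.suc (inject₁ j)) ℕ.+ b (inject₁ j′)) (opposite-inject₁ j))
                     (balanced⇒ k _ ps j)

balanced⇐ : ∀ {s} k b → (∀ i → b i ℕ.+ b (opposite i) ≡ s) → Balanced s (shells k b)
balanced⇐ zero    b eq = []
balanced⇐ (suc k) b eq = eq Fin.zero ∷ balanced⇐ k _ λ j →
  ≡.trans (≡.cong (λ j′ → b (Fin.suc (inject₁ j)) ℕ.+ b (inject₁ j′)) (≡.sym (opposite-inject₁ j)))
    (eq (Fin.suc (inject₁ j)))

C-vanishes⇔ : ∀ r (b : Fin (2 ℕ.+ r ℕ.* 2) → ℕ) → Decreasing b →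
  (∀ ks → length ks ≡ r → C ks (tabulate b) ≡ 0ℤ) ⇔
  ((∃[ σ ] ∀ i → sg (b i) ≡ σ) ⊎ (∃[ s ] (sg s ≡ 1ℤ × ∀ i → b i ℕ.+ b (opposite i) ≡ s)))
C-vanishes⇔ r b dec = mk⇔ (λ van → to (vanishing⇒good _ (shells-nested r b dec) λ ks len →
    transport (tabulate↭shells (suc r) b) ks (van ks (≡.trans (ℕ.suc-injective len) (length-shells r _))))) from
  where
  transport : ∀ {bs cs} → bs ↭ cs → ∀ ks → C ks bs ≡ 0ℤ → C ks cs ≡ 0ℤ
  transport perm ks = ↭-zero (C ks) (C-alternating ks) [] perm
  to : Good (shells (suc r) b) → _
  to (inj₁ (σ , same)) = inj₁ (σ , All.tabulate⁻ {f = b} (↭.All-resp-↭ (↭.↭-sym (tabulate↭shells (suc r) b)) same))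
  to (inj₂ (s , even , bal)) = inj₂ (s , even , balanced⇒ (suc r) b bal)
  from : _ → ∀ ks → length ks ≡ r → C ks (tabulate b) ≡ 0ℤ
  from (inj₁ (σ , same)) ks len = C-monochromatic ks σ (All.tabulate⁺ {f = b} same)
  from (inj₂ (s , even , bal)) ks len = transport (↭.↭-sym (tabulate↭shells (suc r) b)) ks
    (C-balanced ks (≡.cong suc (≡.trans len (≡.sym (length-shells r _)))) even (balanced⇐ (suc r) b bal))

-- Translation to the parts of the partition

betas-tabulate : ∀ {n} (shape : Vec ℕ n) → betas (Vec.toList shape) ≡ tabulate (β shape)
betas-tabulate Vec.[]                    = ≡.refl
betas-tabulate {suc n} (l Vec.∷ shape) = ≡.cong₂ _∷_
  (≡.cong (l ℕ.+_) (≡.trans (Vec.length-toList shape) (≡.sym (Fin.toℕ-fromℕ n))))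
  (≡.trans (betas-tabulate shape) (List.tabulate-cong λ j →
    ≡.cong (lookup shape j ℕ.+_) (≡.sym (Fin.toℕ-inject₁ (opposite j)))))

β-decreasing : ∀ {n} (shape : Vec ℕ n) → IsPartition shape → Decreasing (β shape)
β-decreasing {n} shape p i j i<j = ℕ.+-mono-≤-<
  (VecLinked.lookup⁺ (λ j≤i k≤j → ℕ.≤-trans k≤j j≤i) {i = i} {j = j} p i<j)
  (≡.subst₂ _<_ (≡.sym (Fin.opposite-prop j)) (≡.sym (Fin.opposite-prop i))
    (ℕ.∸-monoʳ-< (s≤s i<j) (Fin.toℕ<n j)))

toℕ-opposite : ∀ {n} (i : Fin (suc n)) → toℕ i ℕ.+ toℕ (opposite i) ≡ n
toℕ-opposite i = ≡.trans (≡.cong (toℕ i ℕ.+_) (Fin.opposite-prop i)) (ℕ.m+[n∸m]≡n (Fin.toℕ≤pred[n] i))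

β-opposite : ∀ {n} (shape : Vec ℕ (suc n)) i →
  β shape i ℕ.+ β shape (opposite i) ≡ (lookup shape i ℕ.+ lookup shape (opposite i)) ℕ.+ n
β-opposite {n} shape i = begin
  (lookup shape i ℕ.+ toℕ (opposite i)) ℕ.+ (lookup shape (opposite i) ℕ.+ toℕ (opposite (opposite i)))
    ≡⟨ solve 4 (λ a b c d → (a :+ b) :+ (c :+ d) := (a :+ c) :+ (b :+ d)) ≡.refl
         (lookup shape i) (toℕ (opposite i)) (lookup shape (opposite i)) (toℕ (opposite (opposite i))) ⟩
  (lookup shape i ℕ.+ lookup shape (opposite i)) ℕ.+ (toℕ (opposite i) ℕ.+ toℕ (opposite (opposite i)))
    ≡⟨ ≡.cong ((lookup shape i ℕ.+ lookup shape (opposite i)) ℕ.+_) (toℕ-opposite (opposite i)) ⟩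
  (lookup shape i ℕ.+ lookup shape (opposite i)) ℕ.+ n ∎
  where
  open ≡.≡-Reasoning
  open ℕ.+-*-Solver

2∣⇒sg : ∀ {n} → 2 ∣ n → sg n ≡ 1ℤ
2∣⇒sg (divides-refl q) = double q
  where
  double : ∀ q → sg (q ℕ.* 2) ≡ 1ℤ
  double zero    = ≡.refl
  double (suc q) = ≡.trans (ℤ.neg-involutive _) (double q)

sg⇒2∣ : ∀ n → sg n ≡ 1ℤ → 2 ∣ n
sg⇒2∣ zero          _  = divides-refl 0
sg⇒2∣ (suc zero)    ()
sg⇒2∣ (suc (suc n)) eq = ∣m∣n⇒∣m+n ∣-refl (sg⇒2∣ n (≡.trans (≡.sym (ℤ.neg-involutive (sg n))) eq))

odd⇒sg : ∀ {n} → ¬ (2 ∣ n) → sg n ≡ -1ℤ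
odd⇒sg {n} odd with sg-cases n
... | inj₁ eq = ⊥-elim (odd (sg⇒2∣ n eq))
... | inj₂ eq = eq

sg⇒odd : ∀ {n} → sg n ≡ -1ℤ → ¬ (2 ∣ n)
sg⇒odd eq 2∣n with () ← ≡.trans (≡.sym eq) (2∣⇒sg 2∣n)

uniform-parity⇔ : ∀ {n} (b : Fin n → ℕ) →
  (∃[ σ ] ∀ i → sg (b i) ≡ σ) ⇔ ((∀ i → 2 ∣ b i) ⊎ (∀ i → ¬ (2 ∣ b i)))
uniform-parity⇔ {zero}  b = mk⇔ (λ _ → inj₁ λ ()) (λ _ → 1ℤ , λ ())
uniform-parity⇔ {suc n} b = mk⇔ to from
  where
  to : _ → _
  to (σ , same) with sg-cases (b Fin.zero)
  ... | inj₁ eq = inj₁ λ i → sg⇒2∣ (b i) (≡.trans (same i) (≡.trans (≡.sym (same Fin.zero)) eq))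
  ... | inj₂ eq = inj₂ λ i → sg⇒odd (≡.trans (same i) (≡.trans (≡.sym (same Fin.zero)) eq))
  from : _ → _
  from (inj₁ even) = 1ℤ , λ i → 2∣⇒sg (even i)
  from (inj₂ odd)  = -1ℤ , λ i → odd⇒sg (odd i)

-- By `β-opposite` the sums for β and for the partition differ by N - 1 = 2r + 1, which is odd and
-- exchanges even s with odd w.
self-complementary⇔ : ∀ r (shape : Vec ℕ (2 ℕ.+ r ℕ.* 2)) →
  (∃[ s ] (sg s ≡ 1ℤ × ∀ i → β shape i ℕ.+ β shape (opposite i) ≡ s)) ⇔
  (∃[ w ] (¬ (+ 2 ∣ℤ w) × ∀ i → + (lookup shape i ℕ.+ lookup shape (opposite i)) ≡ w))
self-complementary⇔ r shape = mk⇔ to from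
  where
  n = suc (r ℕ.* 2)
  λ+λ : Fin (suc n) → ℕ
  λ+λ i = lookup shape i ℕ.+ lookup shape (opposite i)
  sg-n : sg n ≡ -1ℤ
  sg-n = ≡.cong ℤ.-_ (2∣⇒sg (divides-refl r))
  to : _ → _
  to (s , even , eq) = + λ+λ Fin.zero ,
    sg⇒odd (≡.trans (even⇒sg-same (λ+λ Fin.zero) n (≡.trans (≡.cong sg (total Fin.zero)) even)) sg-n) ,
    λ i → ≡.cong +_ (ℕ.+-cancelʳ-≡ n (λ+λ i) (λ+λ Fin.zero) (≡.trans (total i) (≡.sym (total Fin.zero))))
    where
    total : ∀ i → λ+λ i ℕ.+ n ≡ s
    total i = ≡.trans (≡.sym (β-opposite shape i)) (eq i)
  from : _ → _
  from (w , odd , eq) = λ+λ Fin.zero ℕ.+ n ,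
    sg-same⇒even (λ+λ Fin.zero) n (≡.trans (odd⇒sg (≡.subst (λ v → ¬ (+ 2 ∣ℤ v)) (≡.sym (eq Fin.zero)) odd)) (≡.sym sg-n)) ,
    λ i → ≡.trans (β-opposite shape i)
      (≡.cong (ℕ._+ n) (ℤ.+-injective (≡.trans (eq i) (≡.sym (eq Fin.zero)))))

open import Data.Nat.Base using (_+_; _*_)

theorem8p6 : (r : ℕ) → 1 ≤ r → (shape : Vec ℕ (2 + r * 2)) → IsPartition shape →
    schur (laurentRing r) shape (point r) ≈ᴸ 0ᴸ
    ⇔
    (((∀ j → 2 ∣ β shape j) ⊎ (∀ j → ¬ (2 ∣ β shape j)))
     ⊎
     (∃[ w ] (¬ (+ 2 ∣ℤ w) × (∀ i → + (lookup shape i + lookup shape (opposite i)) ≡ w))))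
theorem8p6 r _ shape p =
  ⇔-trans (schur⇔alternant shape p)
  (⇔-trans (alternant⇔C (betas (Vec.toList shape)))
  (⇔-trans (≡.subst (λ bs → (∀ ks → length ks ≡ r → C ks (betas (Vec.toList shape)) ≡ 0ℤ) ⇔ (∀ ks → length ks ≡ r → C ks bs ≡ 0ℤ))
             (betas-tabulate shape) (mk⇔ (λ van → van) (λ van → van)))
  (⇔-trans (C-vanishes⇔ r (β shape) (β-decreasing shape p))
  (uniform-parity⇔ (β shape) ⊎-⇔ self-complementary⇔ r shape))))
  where open VanishingOfSchur r
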